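{- Let $p\in[1,\infty]$. There is an algorithm which, given integers $1\le k\le m\le n$ and a matrix $A\in\mathbb{R}^{n\times m}$, runs in time $m^k\,\mathrm{poly}(nm)$ and outputs $U\in\mathbb{R}^{n\times k}$ and $V\in\mathbb{R}^{k\times m}$ with $$|A-UV|_p\le (k+1)\,\mathrm{opt}_{k,p}(A).$$ Specifically, this holds for the following enumeration algorithm: for every $k$-element subset $I$ of $\{1,\dots,m\}$, set $U=A_I$ and compute a matrix $V\in\mathbb{R}^{k\times m}$ minimizing $d_I=|A-UV|_p$; return the pair $(U,V)$ with the smallest $d_I$ over all $I$.
   Context: For a matrix $M$, $|M|_p=\left(\sum_{i,j}|M_{i,j}|^p\right)^{1/p}$ is the entrywise $\ell_p$ norm for $1\le p<\infty$, and $|M|_\infty=\max_{i,j}|M_{i,j}|$. $A_I$ is the submatrix of $A$ consisting of the columns with indices in $I$. The quantity $\mathrm{opt}_{k,p}(A)$ is the minimum of $|A-U'V'|_p$ over all $U'\in\mathbb{R}^{n\times k}$, $V'\in\mathbb{R}^{k\times m}$. By convention, $\ell_p$ regression (given $U\in\mathbb{R}^{n\times k}$ and $v\in\mathbb{R}^n$, find $y\in\mathbb{R}^k$ minimizing $|Uy-v|_p$), being a convex program, is regarded as solvable in polynomial time. -}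

module Defs where

open import Algebra.Bundles using (CommutativeRing; Semiring)
open import Algebra.Structures using (IsCommutativeRing)
import Algebra.Construct.NaturalChoice.Max as Max
import Algebra.Definitions.RawSemiring as RawSemiringDefinitions
open import Axiom.ExcludedMiddle using (ExcludedMiddle)
open import Data.Bool.Base using (Bool; if_then_else_)
open import Data.Fin.Base as Fin using (Fin)
open import Data.List.Base as List using (List; []; _∷_)
open import Data.Nat.Base as ℕ using (ℕ; zero; suc)
open import Data.Product.Base using (Σ; ∃; ∃₂; _×_; _,_)
open import Data.Unit.Base using (⊤; tt)
open import Data.Vec.Base as Vec using (Vec)
open import Data.Vec.Functional as Vector using (Vector)
open import Function.Base using (_∘_)
open import Level using (0ℓ)
open import Relation.Binary.Bundles using (TotalOrder)
open import Relation.Binary.Core using (Rel)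
open import Relation.Binary.Structures using (IsTotalOrder)
open import Relation.Nullary.Decidable.Core using (yes; no; does)
open import Relation.Nullary.Negation.Core using (¬_)
open import Relation.Unary using (Pred)

Matrix : Set → ℕ → ℕ → Set
Matrix R n m = Vector (Vector R m) n

-- The exponent of an entrywise norm.  That a finite exponent is at least 1 is
-- a separate hypothesis (`1≤ᵉ_` below), so that an exponent can be part of the
-- input of an algorithm over an arbitrary type R of scalars.
data Exponent (R : Set) : Set where
  finite   : R → Exponent R
  infinite : Exponent R

------------------------------------------------------------------------
-- Real-RAM programs
--
-- The type R of scalars is a parameter and the algorithms below are
-- polymorphic in it: a scalar can only be computed by `arith` or `regress`,
-- and inspected by `compare`.  Each of these is charged for; `tick` charges
-- one unit for a step that handles indices or stores a value.

data Instr (R : Set) : Set where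
  zeroᴵ            : Instr R
  addᴵ subᴵ mulᴵ   : R → R → Instr R
  maxᴵ powᴵ        : R → R → Instr R
  absᴵ invᴵ        : R → Instr R

data Prog (R : Set) (X : Set) : Set where
  return  : X → Prog R X
  tick    : Prog R X → Prog R X
  arith   : Instr R → (R → Prog R X) → Prog R X
  -- `compare x y` continues with the truth value of x ≤ y.
  compare : R → R → (Bool → Prog R X) → Prog R X
  -- `regress U v` continues with some y minimizing |Uy - v|.
  regress : ∀ {n k} → Matrix R n k → Vector R n →
            (Vector R k → Prog R X) → Prog R X

module _ {R : Set} where

  infixl 1 _>>=_

  _>>=_ : ∀ {X Y} → Prog R X → (X → Prog R Y) → Prog R Y
  return x       >>= f = f x
  tick q         >>= f = tick (q >>= f)
  arith i c      >>= f = arith i (λ r → c r >>= f)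
  compare x y c  >>= f = compare x y (λ b → c b >>= f)
  regress U v c  >>= f = regress U v (λ y → c y >>= f)

  instr : Instr R → Prog R R
  instr i = arith i return

  ticks : ℕ → Prog R ⊤
  ticks zero    = return tt
  ticks (suc l) = tick (ticks l)

  build : ∀ {X} l → (Fin l → Prog R X) → Prog R (Vector X l)
  build zero    f = return Vector.[]
  build (suc l) f = do
    x  ← f Fin.zero
    xs ← build l (f ∘ Fin.suc)
    tick (return (x Vector.∷ xs))

  sumᴾ : ∀ {l} → Vector R l → Prog R R
  sumᴾ {zero}  x = instr zeroᴵ
  sumᴾ {suc l} x = do
    s ← sumᴾ (Vector.tail x)
    instr (addᴵ (Vector.head x) s)

  maximumᴾ : ∀ {l} → Vector R l → Prog R R
  maximumᴾ {zero}  x = instr zeroᴵ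
  maximumᴾ {suc l} x = do
    s ← maximumᴾ (Vector.tail x)
    instr (maxᴵ (Vector.head x) s)

  normᴾ : ∀ {n m} → Exponent R → Matrix R n m → Prog R R
  normᴾ {n} {m} (finite p) M = do
    rows ← build n λ i → do
      row ← build m λ j → do
        a ← instr (absᴵ (M i j))
        instr (powᴵ a p)
      sumᴾ row
    s ← sumᴾ rows
    r ← instr (invᴵ p)
    instr (powᴵ s r)
  normᴾ {n} {m} infinite M = do
    rows ← build n λ i → do
      row ← build m λ j → instr (absᴵ (M i j))
      maximumᴾ row
    maximumᴾ rows

  residualᴾ : ∀ {n k m} → Matrix R n m → Matrix R n k → Matrix R k m →
              Prog R (Matrix R n m)
  residualᴾ {n} {k} {m} A U V =
    build n λ i → build m λ j → do
      products ← build k λ l → instr (mulᴵ (U i l) (V l j))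
      s        ← sumᴾ products
      instr (subᴵ (A i j) s)

  prependAll : ∀ {X : Set} {k} → X → List (Vec X k) → List (Vec X (suc k)) →
               Prog R (List (Vec X (suc k)))
  prependAll x []       rest = return rest
  prependAll x (I ∷ Is) rest = do
    L ← prependAll x Is rest
    tick (return ((x Vec.∷ I) ∷ L))

  -- All k-element sublists of a list.
  choose : ∀ {X : Set} k → List X → Prog R (List (Vec X k))
  choose zero    xs       = tick (return (Vec.[] ∷ []))
  choose (suc k) []       = tick (return [])
  choose (suc k) (x ∷ xs) = do
    with-x    ← choose k xs
    without-x ← choose (suc k) xs
    tick (prependAll x with-x without-x)

  -- All k-element subsets of Fin m, each listed in increasing order.
  subsets : ∀ k m → Prog R (List (Vec (Fin m) k))
  subsets k m = do
    _ ← ticks m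
    choose k (List.allFin m)

  record Candidate (n k m : ℕ) : Set where
    constructor candidate
    field
      d : R
      U : Matrix R n k
      V : Matrix R k m

  -- U = A_I, and the columns of V are found by one regression each.
  evaluate : ∀ {n k m} → Exponent R → Matrix R n m → Vec (Fin m) k →
             Prog R (Candidate n k m)
  evaluate {n} {k} {m} p A I = do
    U    ← build n λ i → build k λ l → return (A i (Vec.lookup I l))
    cols ← build m λ j → do
      a ← build n λ i → return (A i j)
      regress U a return
    V    ← build k λ l → build m λ j → return (cols j l)
    E    ← residualᴾ A U V
    d    ← normᴾ p E
    return (candidate d U V)

  selectBest : ∀ {n k m} → Exponent R → Matrix R n m → Candidate n k m →
               List (Vec (Fin m) k) → Prog R (Candidate n k m)
  selectBest p A best []       = return best
  selectBest p A best (I ∷ Is) = do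
    new    ← evaluate p A I
    better ← compare (Candidate.d best) (Candidate.d new) return
    selectBest p A (if better then best else new) Is

  -- The case of an empty list arises only for k > m.
  enumeration : ∀ {n k m} → Exponent R → Matrix R n m →
                Prog R (Matrix R n k × Matrix R k m)
  enumeration {n} {k} {m} p A = subsets k m >>= λ where
    [] → do
      z ← instr zeroᴵ
      return ((λ _ _ → z) , (λ _ _ → z))
    (I ∷ Is) → do
      first ← evaluate p A I
      best  ← selectBest p A first Is
      return (Candidate.U best , Candidate.V best)

------------------------------------------------------------------------
-- The real numbers, up to isomorphism: a Dedekind-complete ordered field

module _ {A : Set} (_≤_ : Rel A 0ℓ) where

  IsSupremum : Pred A 0ℓ → Pred A 0ℓ
  IsSupremum S s = (∀ x → S x → x ≤ s) × (∀ u → (∀ x → S x → x ≤ u) → s ≤ u)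

  IsInfimum : Pred A 0ℓ → Pred A 0ℓ
  IsInfimum S s = (∀ x → S x → s ≤ x) × (∀ u → (∀ x → S x → u ≤ x) → u ≤ s)

  IsMinimum : Pred A 0ℓ → Pred A 0ℓ
  IsMinimum S s = S s × (∀ x → S x → s ≤ x)

record CompleteOrderedField : Set₁ where
  infix  4 _≈_ _≤_
  infixl 6 _+_
  infixl 7 _*_
  infix  8 -_ _⁻¹
  field
    Carrier           : Set
    _≈_ _≤_           : Rel Carrier 0ℓ
    _+_ _*_           : Carrier → Carrier → Carrier
    -_ _⁻¹            : Carrier → Carrier
    0# 1#             : Carrier
    isCommutativeRing : IsCommutativeRing _≈_ _+_ _*_ -_ 0# 1#
    isTotalOrder      : IsTotalOrder _≈_ _≤_
    0≉1               : ¬ (0# ≈ 1#)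
    ⁻¹-cong           : ∀ {x y} → x ≈ y → x ⁻¹ ≈ y ⁻¹
    *-inverseʳ        : ∀ x → ¬ (x ≈ 0#) → x * x ⁻¹ ≈ 1#
    +-monoˡ-≤         : ∀ {x y} z → x ≤ y → x + z ≤ y + z
    *-nonNegative     : ∀ {x y} → 0# ≤ x → 0# ≤ y → 0# ≤ x * y
    complete          : (S : Pred Carrier 0ℓ) → ∃ S →
                        (∃ λ u → ∀ x → S x → x ≤ u) → ∃ (IsSupremum _≤_ S)

  commutativeRing : CommutativeRing 0ℓ 0ℓ
  commutativeRing = record { isCommutativeRing = isCommutativeRing }

  totalOrder : TotalOrder 0ℓ 0ℓ 0ℓ
  totalOrder = record { isTotalOrder = isTotalOrder }

  open CommutativeRing commutativeRing public using (_-_)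
  open Max totalOrder public using (_⊔_)
  open RawSemiringDefinitions
    (Semiring.rawSemiring (CommutativeRing.semiring commutativeRing)) public
    using (sum; _^_) renaming (_×_ to _·_)

  fromℕ : ℕ → Carrier
  fromℕ n = n · 1#

  ∣_∣ : Carrier → Carrier
  ∣ x ∣ = x ⊔ (- x)

  maximum : ∀ {n} → Vector Carrier n → Carrier
  maximum = Vector.foldr _⊔_ 0#

  infixl 7 _⊗_
  _⊗_ : ∀ {n k m} → Matrix Carrier n k → Matrix Carrier k m → Matrix Carrier n m
  (U ⊗ V) i j = sum λ l → U i l * V l j

  infixl 6 _⊖_
  _⊖_ : ∀ {n m} → Matrix Carrier n m → Matrix Carrier n m → Matrix Carrier n m
  (M ⊖ N) i j = M i j - N i j

  column : ∀ {n} → Vector Carrier n → Matrix Carrier n 1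
  column v i _ = v i

  1≤ᵉ_ : Pred (Exponent Carrier) 0ℓ
  1≤ᵉ finite p = 1# ≤ p
  1≤ᵉ infinite = ⊤

-- A k-element subset of Fin m, given by its elements in increasing order.
record Subset (k m : ℕ) : Set where
  field
    element    : Fin k → Fin m
    increasing : ∀ {i j} → i Fin.< j → element i Fin.< element j

_[_] : ∀ {R n k m} → Matrix R n m → Subset k m → Matrix R n k
(A [ I ]) i l = A i (Subset.element I l)

module Real (em : ExcludedMiddle 0ℓ) (𝓡 : CompleteOrderedField) where

  open CompleteOrderedField 𝓡 public renaming (Carrier to ℝ)

  -- The value 0# is a default for sets without a supremum (an infimum).
  ⋁ : Pred ℝ 0ℓ → ℝ
  ⋁ S with em {∃ (IsSupremum _≤_ S)}
  ... | yes (s , _) = s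
  ... | no  _       = 0#

  ⋀ : Pred ℝ 0ℓ → ℝ
  ⋀ S with em {∃ (IsInfimum _≤_ S)}
  ... | yes (s , _) = s
  ... | no  _       = 0#

  -- For x ≥ 1 and p ≥ 0, x to the power p is the supremum of the numbers
  -- x ^ (a / b) with a / b ≤ p, where y ≤ x ^ (a / b) is read y ^ b ≤ x ^ a.
  power≥1 : ℝ → ℝ → ℝ
  power≥1 x p = ⋁ λ y → 0# ≤ y × ∃₂ λ a b →
    (fromℕ a ≤ p * fromℕ (suc b)) × (y ^ suc b ≤ x ^ a)

  -- Powers with base x ≥ 0 and exponent p > 0.
  power : ℝ → ℝ → ℝ
  power x p with em {x ≤ 0#} | em {1# ≤ x}
  ... | yes _ | _     = 0#
  ... | no _  | yes _ = power≥1 x p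
  ... | no _  | no _  = power≥1 (x ⁻¹) p ⁻¹

  norm : ∀ {n m} → Exponent ℝ → Matrix ℝ n m → ℝ
  norm (finite p) M =
    power (sum λ i → sum λ j → power ∣ M i j ∣ p) (p ⁻¹)
  norm infinite   M = maximum λ i → maximum λ j → ∣ M i j ∣

  FactorizationError : ∀ {n m} → ℕ → Exponent ℝ → Matrix ℝ n m → Pred ℝ 0ℓ
  FactorizationError {n} {m} k p A r =
    Σ (Matrix ℝ n k) λ U′ → Σ (Matrix ℝ k m) λ V′ → r ≈ norm p (A ⊖ U′ ⊗ V′)

  opt : ∀ {n m} → ℕ → Exponent ℝ → Matrix ℝ n m → ℝ
  opt k p A = ⋀ (FactorizationError k p A)

  -- Defining opt as an infimum leaves the existence of a best factorization
  -- out of its definition; the infimum agrees with any minimum.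
  opt≈minimum : ∀ {n m} k p (A : Matrix ℝ n m) {o} →
                IsMinimum _≤_ (FactorizationError k p A) o → opt k p A ≈ o
  opt≈minimum k p A {o} (o∈ , o≤)
    with em {∃ (IsInfimum _≤_ (FactorizationError k p A))}
  ... | yes (s , s≤ , greatest) =
          TotalOrder.antisym totalOrder (s≤ o o∈) (greatest o o≤)
  ... | no none with () ← none (o , o≤ , λ u u≤ → u≤ o o∈)

  -- The outcome of the enumeration, however the minimizers are computed and
  -- whichever of several best subsets is returned.
  record IsEnumerationOutput {n k m} (p : Exponent ℝ) (A : Matrix ℝ n m)
                             (U : Matrix ℝ n k) (V : Matrix ℝ k m) : Set where
    field
      I          : Subset k m
      U≈A[I]     : ∀ i l → U i l ≈ (A [ I ]) i l
      minimizing : ∀ V′ → norm p (A ⊖ U ⊗ V) ≤ norm p (A ⊖ U ⊗ V′)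
      smallest   : ∀ (J : Subset k m) W →
                   (∀ V′ → norm p (A ⊖ A [ J ] ⊗ W) ≤ norm p (A ⊖ A [ J ] ⊗ V′)) →
                   norm p (A ⊖ U ⊗ V) ≤ norm p (A ⊖ A [ J ] ⊗ W)

  -- A polynomial-time solver for regression in the norm with exponent p.
  record RegressionSolver (p : Exponent ℝ) : Set where
    field
      solve      : ∀ {n k} → Matrix ℝ n k → Vector ℝ n → Vector ℝ k
      minimizing : ∀ {n k} (U : Matrix ℝ n k) (v : Vector ℝ n) (y : Vector ℝ k) →
                   norm p (U ⊗ column (solve U v) ⊖ column v) ≤
                   norm p (U ⊗ column y ⊖ column v)
      cost       : ℕ → ℕ → ℕ
      polynomial : ∃₂ λ c d → ∀ n k → 1 ℕ.≤ n → 1 ℕ.≤ k →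
                   cost n k ℕ.≤ c ℕ.* (n ℕ.* k) ℕ.^ d

  ⟦_⟧ : Instr ℝ → ℝ
  ⟦ zeroᴵ ⟧    = 0#
  ⟦ addᴵ x y ⟧ = x + y
  ⟦ subᴵ x y ⟧ = x - y
  ⟦ mulᴵ x y ⟧ = x * y
  ⟦ maxᴵ x y ⟧ = x ⊔ y
  ⟦ powᴵ x y ⟧ = power x y
  ⟦ absᴵ x ⟧   = ∣ x ∣
  ⟦ invᴵ x ⟧   = x ⁻¹

  module Execution {p : Exponent ℝ} (solver : RegressionSolver p) where

    open RegressionSolver solver

    result : ∀ {X} → Prog ℝ X → X
    result (return x)      = x
    result (tick q)        = result q
    result (arith i c)     = result (c ⟦ i ⟧)
    result (compare x y c) = result (c (does (em {x ≤ y})))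
    result (regress U v c) = result (c (solve U v))

    time : ∀ {X} → Prog ℝ X → ℕ
    time (return x)                = 0
    time (tick q)                  = 1 ℕ.+ time q
    time (arith i c)               = 1 ℕ.+ time (c ⟦ i ⟧)
    time (compare x y c)           = 1 ℕ.+ time (c (does (em {x ≤ y})))
    time (regress {n} {k} U v c)   = cost n k ℕ.+ time (c (solve U v))

{-# OPTIONS --safe #-}

-- Let E = A - U′V′ be the error of any factorization and weight each column j
-- by w j = |E j|ₚ + ε (in the p-th power).  Among the column sets of V′, with
-- columns scaled by 1 / w, take one of maximal volume; by Cramer's rule each
-- V′ j is a combination of the selected columns V′ l with coefficients of
-- absolute value at most w j / w l.  The same combinations of the columns of A
-- leave the residual R j = E j - Σ C l j E l, a sum of k + 1 columns of norm at
-- most w j, whence |R j|ₚ ≤ (k + 1) w j for every j and |R|ₚ ≤ (k + 1) |E|ₚ as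
-- ε tends to 0.  The rank of V′ need not be k: instead of determinants, volumes
-- are values of an alternating form φ₁ ∧ … ∧ φᵣ in a maximal number of rows of
-- V′.  Convexity of x ↦ xᵖ, which bounds |R j|ₚ, is derived from Bernoulli's
-- inequality, and that from the monotonicity of (1 + x / n)ⁿ in n.

module Submission where

import Algebra.Construct.NaturalChoice.Max as Max
import Algebra.Properties.CommutativeSemiring.Exp as Exponentiation
import Algebra.Properties.Ring as RingProperties
import Algebra.Properties.Semiring.Mult as Multiplication
import Algebra.Properties.Semiring.Sum as Summation
import Algebra.Solver.Ring as RingSolver
import Algebra.Solver.Ring.NaturalCoefficients.Default as NaturalCoefficients
import Data.List.Properties as List
import Data.List.Relation.Unary.AllPairs.Properties as AllPairs
import Data.Nat.Properties as ℕ
import Data.Nat.Tactic.RingSolver as ℕSolver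
import Data.Vec.Properties as Vec
open import Algebra.Bundles using (CommutativeRing; RawRing)
open import Algebra.Solver.Ring.AlmostCommutativeRing
  using (fromCommutativeRing; _-Raw-AlmostCommutative⟶_; Induced-equivalence)
open import Axiom.ExcludedMiddle using (ExcludedMiddle)
open import Data.Bool.Base using (if_then_else_)
open import Data.Fin.Base as Fin using (Fin)
open import Data.List.Base as List using (List; []; _∷_; _++_; length; allFin)
open import Data.List.Membership.Propositional using (_∈_)
open import Data.List.Membership.Propositional.Properties
  using (∈-map⁺; ∈-map⁻; ∈-++⁺ˡ; ∈-++⁺ʳ; ∈-++⁻; ∈-allFin; ∈-tabulate⁺)
open import Data.List.Relation.Unary.All as All using (All)
open import Data.List.Relation.Unary.AllPairs using (AllPairs; []; _∷_)
open import Data.List.Relation.Unary.Any using (here; there)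
open import Data.Maybe.Base using (just; nothing)
open import Data.Nat.Base as ℕ using (ℕ; zero; suc)
open import Data.Product.Base using (Σ; ∃; ∃₂; _×_; _,_; proj₁; proj₂)
open import Data.Sum.Base using (_⊎_; inj₁; inj₂)
open import Data.Unit.Base using (⊤; tt)
open import Data.Vec.Base as Vec using (Vec; []; _∷_; lookup; tabulate; _[_]≔_)
open import Data.Vec.Functional as Vector using (Vector)
open import Function.Base using (_∘_; id; case_of_)
open import Level using (0ℓ)
open import Relation.Binary.Bundles using (TotalOrder)
open import Relation.Binary.Definitions using (WeaklyDecidable)
open import Relation.Binary.PropositionalEquality as ≡ using (_≡_)
open import Relation.Nullary.Decidable.Core using (yes; no; does)
open import Relation.Nullary.Negation.Core using (¬_; contradiction)
open import Relation.Unary using (Pred)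
open import Defs

-- The weights keep m out of the constant. Maximal volume without them bounds the coefficients by 1,
-- and then column j of the residual may inherit errors far larger than its own, once for every j.
-- With them each inherited error is at most w j, so the bound holds column by column and the p-th
-- powers of the columns add up. For p = ∞ all columns are measured against one maximum, and
-- constant weights do. An error column may vanish while a weight may not, hence the ε. The
-- coefficients C only have to exist: regression on the selected columns of A does at least as well.
-- It may be carried out one column at a time because comparing norms columnwise compares the norms
-- of the matrices. When fewer than k columns are selected, they are padded to a k-element subset,
-- with zero coefficients for the added columns. Real powers are suprema over rational exponents.
-- Their laws come from clearing denominators, from integer roots, and from estimates whose error
-- stays bounded while the denominator grows.

-- Integer coefficients for ring identities in a commutative ring.

module IntegerCoefficients (R : CommutativeRing 0ℓ 0ℓ) where

  open CommutativeRing R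
  open RingProperties ring
  open Multiplication semiring using () renaming (_×_ to _·_; ×-homo-+ to ·-homo-+; ×1-homo-* to ·1-homo-*)
  open import Relation.Binary.Reasoning.Setoid setoid

  cancel : ℕ × ℕ → ℕ × ℕ
  cancel (suc a , suc b) = cancel (a , b)
  cancel c               = c

  -- The pair (a , b) stands for the integer a - b.  Cancelling keeps the
  -- coefficients canonical, as normal forms are compared syntactically.
  coefficients : RawRing 0ℓ 0ℓ
  coefficients = record
    { Carrier = ℕ × ℕ
    ; _≈_ = _≡_
    ; _+_ = λ (a , b) (c , d) → cancel (a ℕ.+ c , b ℕ.+ d)
    ; _*_ = λ (a , b) (c , d) → cancel (a ℕ.* c ℕ.+ b ℕ.* d , a ℕ.* d ℕ.+ b ℕ.* c)
    ; -_ = λ (a , b) → b , a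
    ; 0# = 0 , 0
    ; 1# = 1 , 0
    }

  difference : ℕ × ℕ → Carrier
  difference (a , b) = a · 1# - b · 1#

  -- Agrees with `difference`; the literals 0# and 1# are produced verbatim, so
  -- that solver goals match the terms they are meant for.
  integer : ℕ × ℕ → Carrier
  integer (0 , 0)               = 0#
  integer (1 , 0)               = 1#
  integer (suc (suc a) , 0)     = difference (suc (suc a) , 0)
  integer (a , suc b)           = difference (a , suc b)

  split : ∀ x y → x ≈ x - y + y
  split x y = sym (trans (+-assoc x (- y) y) (trans (+-congˡ (-‿inverseˡ y)) (+-identityʳ x)))

  -- Turns equations between differences into equations between sums, which the semiring solver or
  -- associativity and commutativity settle.
  minus : ∀ {x y z} → x ≈ z + y → x - y ≈ z
  minus {x} {y} {z} eq = trans (+-congʳ eq)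
    (trans (+-assoc z y (- y)) (trans (+-congˡ (-‿inverseʳ y)) (+-identityʳ z)))

  integer≈difference : ∀ c → integer c ≈ difference c
  integer≈difference (0 , 0)           = sym (-‿inverseʳ 0#)
  integer≈difference (1 , 0)           = sym (minus refl)
  integer≈difference (suc (suc a) , 0) = refl
  integer≈difference (zero , suc b)    = refl
  integer≈difference (suc zero , suc b) = refl
  integer≈difference (suc (suc a) , suc b) = refl

  cancel≈ : ∀ c → difference (cancel c) ≈ difference c
  cancel≈ (suc a , suc b) = trans (cancel≈ (a , b)) (sym (minus (begin
    1# + a · 1#                       ≈⟨ +-congˡ (split _ _) ⟩
    1# + (difference (a , b) + b · 1#) ≈⟨ +-assoc _ _ _ ⟨
    1# + difference (a , b) + b · 1#  ≈⟨ +-congʳ (+-comm _ _) ⟩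
    difference (a , b) + 1# + b · 1#  ≈⟨ +-assoc _ _ _ ⟩
    difference (a , b) + (1# + b · 1#) ∎)))
  cancel≈ (zero  , _)     = refl
  cancel≈ (suc _ , zero)  = refl

  module S = NaturalCoefficients commutativeSemiring

  homomorphism : coefficients -Raw-AlmostCommutative⟶ fromCommutativeRing R
  homomorphism = record
    { ⟦_⟧    = integer
    ; +-homo = λ x y → trans (integer≈difference (x C.+ y)) (trans (+-homo x y)
                 (sym (+-cong (integer≈difference x) (integer≈difference y))))
    ; *-homo = λ x y → trans (integer≈difference (x C.* y)) (trans (*-homo x y)
                 (sym (*-cong (integer≈difference x) (integer≈difference y))))
    ; -‿homo = λ x → trans (integer≈difference (C.- x)) (trans (-‿homo x)
                 (sym (-‿cong (integer≈difference x))))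
    ; 0-homo = refl
    ; 1-homo = refl
    }
    where
    module C = RawRing coefficients

    +-homo : ∀ x y → difference (x C.+ y) ≈ difference x + difference y
    +-homo x@(a , b) y@(c , d) = trans (cancel≈ (a ℕ.+ c , b ℕ.+ d)) (minus (begin
      (a ℕ.+ c) · 1#                               ≈⟨ ·-homo-+ 1# a c ⟩
      a · 1# + c · 1#                              ≈⟨ +-cong (split _ _) (split _ _) ⟩
      (difference x + b · 1#) + (difference y + d · 1#)
        ≈⟨ S.solve 4 (λ u v w z → (u S.:+ v) S.:+ (w S.:+ z) S.:= (u S.:+ w) S.:+ (v S.:+ z)) refl _ _ _ _ ⟩
      (difference x + difference y) + (b · 1# + d · 1#) ≈⟨ +-congˡ (·-homo-+ 1# b d) ⟨
      (difference x + difference y) + (b ℕ.+ d) · 1#    ∎))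

    *-homo : ∀ x y → difference (x C.* y) ≈ difference x * difference y
    *-homo x@(a , b) y@(c , d) = trans (cancel≈ (a ℕ.* c ℕ.+ b ℕ.* d , a ℕ.* d ℕ.+ b ℕ.* c)) (minus (begin
      (a ℕ.* c ℕ.+ b ℕ.* d) · 1#                    ≈⟨ expand a c b d ⟩
      A * C + B * D                                 ≈⟨ +-congʳ (*-cong (split A B) (split C D)) ⟩
      (X + B) * (Y + D) + B * D
        ≈⟨ S.solve 4 (λ u v w z → (u S.:+ v) S.:* (w S.:+ z) S.:+ v S.:* z
             S.:= u S.:* w S.:+ ((u S.:+ v) S.:* z S.:+ v S.:* (w S.:+ z))) refl X B Y D ⟩
      X * Y + ((X + B) * D + B * (Y + D))
        ≈⟨ +-congˡ (+-cong (*-congʳ (split A B)) (*-congˡ (split C D))) ⟨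
      X * Y + (A * D + B * C)                       ≈⟨ +-congˡ (expand a d b c) ⟨
      X * Y + (a ℕ.* d ℕ.+ b ℕ.* c) · 1#            ∎))
      where
      A = a · 1#
      B = b · 1#
      C = c · 1#
      D = d · 1#
      X = difference x
      Y = difference y
      expand : ∀ i j k l → (i ℕ.* j ℕ.+ k ℕ.* l) · 1# ≈ i · 1# * j · 1# + k · 1# * l · 1#
      expand i j k l = trans (·-homo-+ 1# (i ℕ.* j) (k ℕ.* l)) (+-cong (·1-homo-* i j) (·1-homo-* k l))

    -‿homo : ∀ x → difference (C.- x) ≈ - difference x
    -‿homo x@(a , b) = minus (begin
      b · 1#                                    ≈⟨ +-identityˡ _ ⟨
      0# + b · 1#                               ≈⟨ +-congʳ (-‿inverseˡ _) ⟨
      (- difference x + difference x) + b · 1#  ≈⟨ +-assoc _ _ _ ⟩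
      - difference x + (difference x + b · 1#)  ≈⟨ +-congˡ (split _ _) ⟨
      - difference x + a · 1#                   ∎)

  -- Cross-addition decides a - b = c - d within ℕ, whether or not the pairs are cancelled.
  _≟_ : WeaklyDecidable (Induced-equivalence homomorphism)
  x@(a , b) ≟ y@(c , d) with a ℕ.+ d ℕ.≟ c ℕ.+ b
  ... | no  _  = nothing
  ... | yes eq = just (trans (integer≈difference x) (trans (minus (begin
    a · 1#                                    ≈⟨ minus (·-homo-+ 1# a d) ⟨
    (a ℕ.+ d) · 1# - d · 1#                   ≡⟨ ≡.cong (λ e → e · 1# - d · 1#) eq ⟩
    (c ℕ.+ b) · 1# - d · 1#                   ≈⟨ +-congʳ (·-homo-+ 1# c b) ⟩
    (c · 1# + b · 1#) - d · 1#
      ≈⟨ S.solve 3 (λ u v w → (u S.:+ v) S.:+ w S.:= (u S.:+ w) S.:+ v) refl _ _ _ ⟩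
    difference y + b · 1#                     ∎)) (sym (integer≈difference y))))

  open RingSolver coefficients (fromCommutativeRing R) homomorphism _≟_ public
    using (solve; _:=_; _:+_; _:*_; _:-_; :-_; con; Polynomial)

  :1 : ∀ {n} → Polynomial n
  :1 = con (1 , 0)

  :0 : ∀ {n} → Polynomial n
  :0 = con (0 , 0)

-- Ordered-field arithmetic, the Archimedean property, absolute values and sums.

module OrderedField (em : ExcludedMiddle 0ℓ) (𝓡 : CompleteOrderedField) where

  open Real em 𝓡 public
  open CommutativeRing commutativeRing public
    using ( refl; sym; trans; reflexive
          ; +-cong; +-congˡ; +-congʳ; +-identityˡ; +-identityʳ; +-assoc; +-comm
          ; *-cong; *-congˡ; *-congʳ; *-identityˡ; *-identityʳ; *-assoc; *-comm
          ; -‿cong; -‿inverseʳ; zeroˡ; zeroʳ; distribʳ; semiring; commutativeSemiring; ring)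
  open TotalOrder totalOrder public
    using (total; antisym; poset)
    renaming (refl to ≤-refl; reflexive to ≤-reflexive; trans to ≤-trans)
  open Exponentiation commutativeSemiring public
    using (^-congˡ; ^-congʳ; ^-assocʳ; ^-distrib-*)
  open Multiplication semiring public
    using () renaming (×-homo-+ to ·-homo-+; ×1-homo-* to fromℕ-*)
  open Summation semiring public
    using (sum-cong-≋; ∑-comm; ∑-distrib-+; *-distribˡ-sum; *-distribʳ-sum)
  open RingProperties ring public using (-‿involutive; -‿distribˡ-*; -‿distribʳ-*; -0#≈0#)
  open Max totalOrder public
    using (⊔-cong; ⊔-lub; x≤x⊔y; x≤y⊔x; ⊔-sel; ⊔-comm)
  open IntegerCoefficients commutativeRing public
    using (solve; _:=_; _:+_; _:*_; _:-_; :-_; :1; :0)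
  module ≤R where
    open import Relation.Binary.Reasoning.PartialOrder poset public

  infix 4 _<_
  _<_ : ℝ → ℝ → Set
  x < y = ¬ (y ≤ x)

  <⇒≤ : ∀ {x y} → x < y → x ≤ y
  <⇒≤ {x} {y} x<y with total x y
  ... | inj₁ x≤y = x≤y
  ... | inj₂ y≤x = contradiction y≤x x<y

  ≤⊎> : ∀ x y → x ≤ y ⊎ y < x
  ≤⊎> x y with em {x ≤ y}
  ... | yes x≤y = inj₁ x≤y
  ... | no  x≰y = inj₂ x≰y

  ≤-<-trans : ∀ {x y z} → x ≤ y → y < z → x < z
  ≤-<-trans x≤y y<z z≤x = y<z (≤-trans z≤x x≤y)

  <-≤-trans : ∀ {x y z} → x < y → y ≤ z → x < z
  <-≤-trans x<y y≤z z≤x = x<y (≤-trans y≤z z≤x)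

  ≤∧≉⇒< : ∀ {x y} → x ≤ y → ¬ (x ≈ y) → x < y
  ≤∧≉⇒< x≤y x≉y y≤x = x≉y (antisym x≤y y≤x)

  <⇒≉ : ∀ {x y} → x < y → ¬ (y ≈ x)
  <⇒≉ x<y y≈x = x<y (≤-reflexive y≈x)

  <-respʳ : ∀ {x y z} → y ≈ z → x < y → x < z
  <-respʳ y≈z x<y = <-≤-trans x<y (≤-reflexive y≈z)

  ≤-resp : ∀ {x x′ y y′} → x ≈ x′ → y ≈ y′ → x ≤ y → x′ ≤ y′
  ≤-resp x≈ y≈ x≤y = ≤-trans (≤-reflexive (sym x≈)) (≤-trans x≤y (≤-reflexive y≈))

  +-monoʳ-≤ : ∀ {x y} z → x ≤ y → z + x ≤ z + y
  +-monoʳ-≤ z x≤y = ≤-resp (+-comm _ z) (+-comm _ z) (+-monoˡ-≤ z x≤y)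

  +-mono-≤ : ∀ {x y u v} → x ≤ y → u ≤ v → x + u ≤ y + v
  +-mono-≤ x≤y u≤v = ≤-trans (+-monoˡ-≤ _ x≤y) (+-monoʳ-≤ _ u≤v)

  x≤y⇒0≤y-x : ∀ {x y} → x ≤ y → 0# ≤ y - x
  x≤y⇒0≤y-x {x} x≤y = ≤-resp (-‿inverseʳ x) refl (+-monoˡ-≤ (- x) x≤y)

  0≤y-x⇒x≤y : ∀ {x y} → 0# ≤ y - x → x ≤ y
  0≤y-x⇒x≤y {x} {y} h = ≤-resp (+-identityˡ x)
    (solve 2 (λ a b → (b :- a) :+ a := b) refl x y) (+-monoˡ-≤ x h)

  -- Splits an inequality into a ring identity, left to the solver, and the sign of a single
  -- expression.
  ≤-by : ∀ {x y d} → 0# ≤ d → y - x ≈ d → x ≤ y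
  ≤-by 0≤d eq = 0≤y-x⇒x≤y (≤-resp refl (sym eq) 0≤d)

  x+y≤z⇒x≤z-y : ∀ {x y z} → x + y ≤ z → x ≤ z - y
  x+y≤z⇒x≤z-y {x} {y} {z} h = ≤-by (x≤y⇒0≤y-x h)
    (solve 3 (λ a b c → (c :- b) :- a := c :- (a :+ b)) refl x y z)

  0≤+ : ∀ {x y} → 0# ≤ x → 0# ≤ y → 0# ≤ x + y
  0≤+ 0≤x 0≤y = ≤-resp (+-identityˡ 0#) refl (+-mono-≤ 0≤x 0≤y)

  0<+ : ∀ {x y} → 0# ≤ x → 0# < y → 0# < x + y
  0<+ {x} {y} 0≤x 0<y = <-≤-trans 0<y (≤-resp (+-identityˡ y) refl (+-monoˡ-≤ y 0≤x))

  neg-mono-≤ : ∀ {x y} → x ≤ y → - y ≤ - x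
  neg-mono-≤ {x} {y} x≤y = ≤-by (x≤y⇒0≤y-x x≤y)
    (solve 2 (λ a b → (:- a) :- (:- b) := b :- a) refl x y)

  x≤0⇒0≤-x : ∀ {x} → x ≤ 0# → 0# ≤ - x
  x≤0⇒0≤-x x≤0 = ≤-resp -0#≈0# refl (neg-mono-≤ x≤0)

  *-monoʳ-≤ : ∀ {x y z} → 0# ≤ z → x ≤ y → x * z ≤ y * z
  *-monoʳ-≤ {x} {y} {z} 0≤z x≤y = ≤-by (*-nonNegative (x≤y⇒0≤y-x x≤y) 0≤z)
    (solve 3 (λ a b c → b :* c :- a :* c := (b :- a) :* c) refl x y z)

  *-monoˡ-≤ : ∀ {x y z} → 0# ≤ z → x ≤ y → z * x ≤ z * y
  *-monoˡ-≤ 0≤z x≤y = ≤-resp (*-comm _ _) (*-comm _ _) (*-monoʳ-≤ 0≤z x≤y)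

  *-mono-≤ : ∀ {x y u v} → 0# ≤ x → 0# ≤ v → x ≤ y → u ≤ v → x * u ≤ y * v
  *-mono-≤ 0≤x 0≤v x≤y u≤v = ≤-trans (*-monoˡ-≤ 0≤x u≤v) (*-monoʳ-≤ 0≤v x≤y)

  0≤x² : ∀ x → 0# ≤ x * x
  0≤x² x with total 0# x
  ... | inj₁ 0≤x = *-nonNegative 0≤x 0≤x
  ... | inj₂ x≤0 = ≤-resp refl (solve 1 (λ a → (:- a) :* (:- a) := a :* a) refl x)
                     (*-nonNegative (x≤0⇒0≤-x x≤0) (x≤0⇒0≤-x x≤0))

  0≤1 : 0# ≤ 1#
  0≤1 = ≤-resp refl (*-identityˡ 1#) (0≤x² 1#)

  0<1 : 0# < 1#
  0<1 = ≤∧≉⇒< 0≤1 0≉1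

  *-inverseˡ : ∀ x → ¬ (x ≈ 0#) → x ⁻¹ * x ≈ 1#
  *-inverseˡ x x≉0 = trans (*-comm _ _) (*-inverseʳ x x≉0)

  0<⁻¹ : ∀ {x} → 0# < x → 0# < x ⁻¹
  0<⁻¹ {x} 0<x x⁻¹≤0 = 0<1 (≤-resp (*-inverseˡ x (<⇒≉ 0<x)) (zeroˡ x) (*-monoʳ-≤ (<⇒≤ 0<x) x⁻¹≤0))

  *-cancelʳ-≤ : ∀ {x y z} → 0# < z → x * z ≤ y * z → x ≤ y
  *-cancelʳ-≤ {x} {y} {z} 0<z h = ≤-resp (cancel x) (cancel y) (*-monoʳ-≤ (<⇒≤ (0<⁻¹ 0<z)) h)
    where
    cancel : ∀ u → u * z * z ⁻¹ ≈ u
    cancel u = trans (*-assoc u z _) (trans (*-congˡ (*-inverseʳ z (<⇒≉ 0<z))) (*-identityʳ u))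

  *-cancelʳ : ∀ {x y z} → 0# < z → x * z ≈ y * z → x ≈ y
  *-cancelʳ 0<z h = antisym (*-cancelʳ-≤ 0<z (≤-reflexive h)) (*-cancelʳ-≤ 0<z (≤-reflexive (sym h)))

  0<* : ∀ {x y} → 0# < x → 0# < y → 0# < x * y
  0<* {x} {y} 0<x 0<y xy≤0 = 0<x (*-cancelʳ-≤ 0<y (≤-resp refl (sym (zeroˡ y)) xy≤0))

  1≤⇒0≤ : ∀ {x} → 1# ≤ x → 0# ≤ x
  1≤⇒0≤ = ≤-trans 0≤1

  1≤⇒0< : ∀ {x} → 1# ≤ x → 0# < x
  1≤⇒0< = <-≤-trans 0<1

  1≤⁻¹ : ∀ {x} → 0# < x → x ≤ 1# → 1# ≤ x ⁻¹
  1≤⁻¹ {x} 0<x x≤1 = ≤-resp (*-inverseʳ x (<⇒≉ 0<x)) (*-identityˡ _) (*-monoʳ-≤ (<⇒≤ (0<⁻¹ 0<x)) x≤1)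

  0≤^ : ∀ {x} n → 0# ≤ x → 0# ≤ x ^ n
  0≤^ zero    0≤x = 0≤1
  0≤^ (suc n) 0≤x = *-nonNegative 0≤x (0≤^ n 0≤x)

  0<^ : ∀ {x} n → 0# < x → 0# < x ^ n
  0<^ zero    0<x = 0<1
  0<^ (suc n) 0<x = 0<* 0<x (0<^ n 0<x)

  ^-monoˡ-≤ : ∀ {x y} n → 0# ≤ x → x ≤ y → x ^ n ≤ y ^ n
  ^-monoˡ-≤ zero    0≤x x≤y = ≤-refl
  ^-monoˡ-≤ (suc n) 0≤x x≤y = *-mono-≤ 0≤x (0≤^ n (≤-trans 0≤x x≤y)) x≤y (^-monoˡ-≤ n 0≤x x≤y)

  1^ : ∀ n → 1# ^ n ≈ 1#
  1^ zero    = refl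
  1^ (suc n) = trans (*-identityˡ _) (1^ n)

  1≤^ : ∀ {x} n → 1# ≤ x → 1# ≤ x ^ n
  1≤^ n 1≤x = ≤-resp (1^ n) refl (^-monoˡ-≤ n 0≤1 1≤x)

  ^-monoʳ-≤ : ∀ {x m n} → 1# ≤ x → m ℕ.≤ n → x ^ m ≤ x ^ n
  ^-monoʳ-≤ {n = n} 1≤x ℕ.z≤n       = 1≤^ n 1≤x
  ^-monoʳ-≤         1≤x (ℕ.s≤s m≤n) = *-monoˡ-≤ (1≤⇒0≤ 1≤x) (^-monoʳ-≤ 1≤x m≤n)

  ^-cancelˡ-< : ∀ {x y} n → 0# ≤ x → x < y → x ^ suc n < y ^ suc n
  ^-cancelˡ-< {x} {y} n 0≤x x<y h = x<y (*-cancelʳ-≤ (0<^ n (≤-<-trans 0≤x x<y))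
    (≤-trans h (*-monoˡ-≤ 0≤x (^-monoˡ-≤ n 0≤x (<⇒≤ x<y)))))

  ^-cancelˡ-≤ : ∀ {x y} n → 0# ≤ y → x ^ suc n ≤ y ^ suc n → x ≤ y
  ^-cancelˡ-≤ {x} {y} n 0≤y h with ≤⊎> x y
  ... | inj₁ x≤y = x≤y
  ... | inj₂ y<x = contradiction h (^-cancelˡ-< n 0≤y y<x)

  ^-injective : ∀ {x y} n → 0# ≤ x → 0# ≤ y → x ^ suc n ≈ y ^ suc n → x ≈ y
  ^-injective n 0≤x 0≤y h = antisym (^-cancelˡ-≤ n 0≤y (≤-reflexive h)) (^-cancelˡ-≤ n 0≤x (≤-reflexive (sym h)))

  ^-comm : ∀ x m n → (x ^ m) ^ n ≈ (x ^ n) ^ m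
  ^-comm x m n = trans (^-assocʳ x m n) (trans (^-congʳ x (ℕ.*-comm m n)) (sym (^-assocʳ x n m)))

  fromℕ-+ : ∀ m n → fromℕ (m ℕ.+ n) ≈ fromℕ m + fromℕ n
  fromℕ-+ = ·-homo-+ 1#

  0≤fromℕ : ∀ n → 0# ≤ fromℕ n
  0≤fromℕ zero    = ≤-refl
  0≤fromℕ (suc n) = 0≤+ 0≤1 (0≤fromℕ n)

  1≤fromℕ-suc : ∀ n → 1# ≤ fromℕ (suc n)
  1≤fromℕ-suc n = ≤-resp (+-identityʳ 1#) refl (+-monoʳ-≤ 1# (0≤fromℕ n))

  0<fromℕ-suc : ∀ n → 0# < fromℕ (suc n)
  0<fromℕ-suc n = 1≤⇒0< (1≤fromℕ-suc n)

  fromℕ-mono-≤ : ∀ {m n} → m ℕ.≤ n → fromℕ m ≤ fromℕ n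
  fromℕ-mono-≤ {n = n} ℕ.z≤n = 0≤fromℕ n
  fromℕ-mono-≤ (ℕ.s≤s m≤n)   = +-monoʳ-≤ 1# (fromℕ-mono-≤ m≤n)

  fromℕ-cancel-≤ : ∀ m n → fromℕ m ≤ fromℕ n → m ℕ.≤ n
  fromℕ-cancel-≤ m n h with ℕ.≤-<-connex m n
  ... | inj₁ m≤n = m≤n
  ... | inj₂ n<m = contradiction (≤-trans (fromℕ-mono-≤ n<m) h) λ 1+n≤n →
    0<1 (≤-by (x≤y⇒0≤y-x 1+n≤n) (solve 1 (λ a → :0 :- :1 := a :- (:1 :+ a)) refl (fromℕ n)))

  -- If the natural numbers were bounded, their supremum s would satisfy n + 1 ≤ s for all n, so s -
  -- 1 would be an upper bound as well.
  archimedean : ∀ x → ∃ λ n → x < fromℕ n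
  archimedean x with em {∃ λ n → x < fromℕ n}
  ... | yes h = h
  ... | no  h = contradiction 1≤0 0<1
    where
    S : ℝ → Set
    S y = ∃ λ n → y ≈ fromℕ n
    bound : ∀ n → fromℕ n ≤ x
    bound n with ≤⊎> (fromℕ n) x
    ... | inj₁ n≤x = n≤x
    ... | inj₂ x<n = contradiction (n , x<n) h
    supremum = complete S (0# , 0 , refl) (x , λ { _ (n , eq) → ≤-trans (≤-reflexive eq) (bound n) })
    s = proj₁ supremum
    s≤s-1 : s ≤ s - 1#
    s≤s-1 = proj₂ (proj₂ supremum) _ λ { y (n , eq) →
      ≤-by (x≤y⇒0≤y-x (proj₁ (proj₂ supremum) (fromℕ (suc n)) (suc n , refl)))
        (trans (+-congˡ (-‿cong eq)) (solve 2 (λ a b → (a :- :1) :- b := a :- (:1 :+ b)) refl s (fromℕ n))) }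
    1≤0 : 1# ≤ 0#
    1≤0 = ≤-by (x≤y⇒0≤y-x s≤s-1) (solve 1 (λ a → :0 :- :1 := (a :- :1) :- a) refl s)

  ≤-approximate : ∀ {x y c} → 0# ≤ c → (∀ δ → 0# < δ → x ≤ y + c * δ) → x ≤ y
  ≤-approximate {x} {y} {c} 0≤c h with ≤⊎> x y
  ... | inj₁ x≤y = x≤y
  ... | inj₂ y<x = contradiction δ≤0 0<δ
    where
    0<c+1 : 0# < c + 1#
    0<c+1 = 0<+ 0≤c 0<1
    e = x - y
    0<e : 0# < e
    0<e e≤0 = y<x (≤-by (x≤0⇒0≤-x e≤0) (solve 2 (λ a b → b :- a := :- (a :- b)) refl x y))
    -- The summand 1 keeps the divisor positive when c is 0. Since c δ = e - δ, the hypothesis e ≤ c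
    -- δ becomes δ ≤ 0.
    δ = e * (c + 1#) ⁻¹
    0<δ : 0# < δ
    0<δ = 0<* 0<e (0<⁻¹ 0<c+1)
    δ[c+1]≈e : δ * (c + 1#) ≈ e
    δ[c+1]≈e = trans (*-assoc _ _ _) (trans (*-congˡ (*-inverseˡ _ (<⇒≉ 0<c+1))) (*-identityʳ e))
    δ≤0 : δ ≤ 0#
    δ≤0 = ≤-by (x≤y⇒0≤y-x (h δ 0<δ)) (begin-equality
      0# - δ
        ≈⟨ solve 2 (λ d a → :0 :- d := a :* d :- d :* (a :+ :1)) refl δ c ⟩
      c * δ - δ * (c + 1#)                ≈⟨ +-congˡ (-‿cong δ[c+1]≈e) ⟩
      c * δ - (x - y)
        ≈⟨ solve 3 (λ a b d → d :- (a :- b) := (b :+ d) :- a) refl x y (c * δ) ⟩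
      (y + c * δ) - x                     ∎)
      where open ≤R

  0≤∣x∣ : ∀ x → 0# ≤ ∣ x ∣
  0≤∣x∣ x with total 0# x
  ... | inj₁ 0≤x = ≤-trans 0≤x (x≤x⊔y x (- x))
  ... | inj₂ x≤0 = ≤-trans (x≤0⇒0≤-x x≤0) (x≤y⊔x x (- x))

  ∣∣-cong : ∀ {x y} → x ≈ y → ∣ x ∣ ≈ ∣ y ∣
  ∣∣-cong eq = ⊔-cong eq (-‿cong eq)

  ∣-x∣≈∣x∣ : ∀ x → ∣ - x ∣ ≈ ∣ x ∣
  ∣-x∣≈∣x∣ x = trans (⊔-cong refl (-‿involutive x)) (⊔-comm (- x) x)

  0≤x⇒∣x∣≈x : ∀ {x} → 0# ≤ x → ∣ x ∣ ≈ x
  0≤x⇒∣x∣≈x {x} 0≤x = antisym (⊔-lub ≤-refl (≤-trans (≤-resp refl -0#≈0# (neg-mono-≤ 0≤x)) 0≤x)) (x≤x⊔y x _)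

  x≤0⇒∣x∣≈-x : ∀ {x} → x ≤ 0# → ∣ x ∣ ≈ - x
  x≤0⇒∣x∣≈-x {x} x≤0 = trans (sym (∣-x∣≈∣x∣ x)) (0≤x⇒∣x∣≈x (x≤0⇒0≤-x x≤0))

  ∣x+y∣≤∣x∣+∣y∣ : ∀ x y → ∣ x + y ∣ ≤ ∣ x ∣ + ∣ y ∣
  ∣x+y∣≤∣x∣+∣y∣ x y = ⊔-lub (+-mono-≤ (x≤x⊔y x _) (x≤x⊔y y _))
    (≤-resp (solve 2 (λ a b → (:- a) :+ (:- b) := :- (a :+ b)) refl x y) refl
      (+-mono-≤ (x≤y⊔x x (- x)) (x≤y⊔x y (- y))))

  ∣x*y∣≈∣x∣*∣y∣ : ∀ x y → ∣ x * y ∣ ≈ ∣ x ∣ * ∣ y ∣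
  ∣x*y∣≈∣x∣*∣y∣ x y with total 0# x
  ... | inj₁ 0≤x = trans (nonNegative x y 0≤x) (*-congʳ (sym (0≤x⇒∣x∣≈x 0≤x)))
    where
    nonNegative : ∀ x y → 0# ≤ x → ∣ x * y ∣ ≈ x * ∣ y ∣
    nonNegative x y 0≤x with total 0# y
    ... | inj₁ 0≤y = trans (0≤x⇒∣x∣≈x (*-nonNegative 0≤x 0≤y)) (*-congˡ (sym (0≤x⇒∣x∣≈x 0≤y)))
    ... | inj₂ y≤0 = trans (x≤0⇒∣x∣≈-x (≤-resp refl (zeroʳ x) (*-monoˡ-≤ 0≤x y≤0)))
                       (trans (-‿distribʳ-* x y) (*-congˡ (sym (x≤0⇒∣x∣≈-x y≤0))))
  ... | inj₂ x≤0 with total 0# y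
  ...   | inj₁ 0≤y = trans (x≤0⇒∣x∣≈-x (≤-resp refl (zeroˡ y) (*-monoʳ-≤ 0≤y x≤0)))
                       (trans (-‿distribˡ-* x y) (*-cong (sym (x≤0⇒∣x∣≈-x x≤0)) (sym (0≤x⇒∣x∣≈x 0≤y))))
  ...   | inj₂ y≤0 = trans (trans (∣∣-cong (solve 2 (λ a b → a :* b := (:- a) :* (:- b)) refl x y))
                       (0≤x⇒∣x∣≈x (*-nonNegative (x≤0⇒0≤-x x≤0) (x≤0⇒0≤-x y≤0))))
                       (*-cong (sym (x≤0⇒∣x∣≈-x x≤0)) (sym (x≤0⇒∣x∣≈-x y≤0)))

  0<∣x∣ : ∀ {x} → ¬ (x ≈ 0#) → 0# < ∣ x ∣
  0<∣x∣ {x} x≉0 h = x≉0 (antisym (≤-trans (x≤x⊔y x _) h)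
    (≤-resp -0#≈0# (-‿involutive x) (neg-mono-≤ (≤-trans (x≤y⊔x x (- x)) h))))

  -- An ordered field has no 2-torsion. This is how antisymmetry makes a wedge with a repeated
  -- factor vanish.
  x≈-x⇒x≈0 : ∀ {x} → x ≈ - x → x ≈ 0#
  x≈-x⇒x≈0 {x} h = antisym (≤-half (≤-reflexive h)) (≤-resp -0#≈0# (-‿involutive x) (neg-mono-≤ (≤-half (≤-reflexive (trans (sym h) (sym (-‿involutive x)))))))
    where
    ≤-half : ∀ {x} → x ≤ - x → x ≤ 0#
    ≤-half {x} x≤-x with total x 0#
    ... | inj₁ x≤0 = x≤0
    ... | inj₂ 0≤x = ≤-trans x≤-x (≤-resp refl -0#≈0# (neg-mono-≤ 0≤x))

  sum-mono-≤ : ∀ {n} {x y : Vector ℝ n} → (∀ i → x i ≤ y i) → sum x ≤ sum y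
  sum-mono-≤ {zero}  x≤y = ≤-refl
  sum-mono-≤ {suc n} x≤y = +-mono-≤ (x≤y Fin.zero) (sum-mono-≤ (x≤y ∘ Fin.suc))

  0≤sum : ∀ {n} {x : Vector ℝ n} → (∀ i → 0# ≤ x i) → 0# ≤ sum x
  0≤sum {zero}  0≤x = ≤-refl
  0≤sum {suc n} 0≤x = 0≤+ (0≤x Fin.zero) (0≤sum (0≤x ∘ Fin.suc))

  sum-const : ∀ n x → sum {n} (λ _ → x) ≈ fromℕ n * x
  sum-const zero    x = sym (zeroˡ x)
  sum-const (suc n) x = trans (+-cong (sym (*-identityˡ x)) (sum-const n x)) (sym (distribʳ x 1# (fromℕ n)))

  ∣sum∣≤sum∣∣ : ∀ {n} (x : Vector ℝ n) → ∣ sum x ∣ ≤ sum (∣_∣ ∘ x)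
  ∣sum∣≤sum∣∣ {zero}  x = ≤-reflexive (0≤x⇒∣x∣≈x ≤-refl)
  ∣sum∣≤sum∣∣ {suc n} x = ≤-trans (∣x+y∣≤∣x∣+∣y∣ _ _) (+-monoʳ-≤ _ (∣sum∣≤sum∣∣ (x ∘ Fin.suc)))

-- Integer roots, and the multiplicativity of real powers.

module Powers (em : ExcludedMiddle 0ℓ) (𝓡 : CompleteOrderedField) where

  open OrderedField em 𝓡
  open ≤R

  ⋁-isSupremum : ∀ {S} → ∃ S → (∃ λ u → ∀ x → S x → x ≤ u) → IsSupremum _≤_ S (⋁ S)
  ⋁-isSupremum {S} nonempty bounded with em {∃ (IsSupremum _≤_ S)}
  ... | yes (_ , isSupremum) = isSupremum
  ... | no  none             = contradiction (complete S nonempty bounded) none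

  -- After division by b + 1 the constant c tends to 0. Such a constant is the price of replacing p
  -- (b + 1) by its integer part.
  ≤-limit : ∀ {x y c} → (∀ b → x * fromℕ (suc b) ≤ y * fromℕ (suc b) + c) → x ≤ y
  ≤-limit {x} {y} {c} h with ≤⊎> x y
  ... | inj₁ x≤y = x≤y
  ... | inj₂ y<x = contradiction (≤-trans (fromℕ-mono-≤ (ℕ.n≤1+n n)) (*-cancelʳ-≤ 0<e n*e≤c)) c<n
    where
    e = x - y
    0<e : 0# < e
    0<e e≤0 = y<x (≤-by (x≤0⇒0≤-x e≤0) (solve 2 (λ a b → b :- a := :- (a :- b)) refl x y))
    n = proj₁ (archimedean (c * e ⁻¹))
    c<n = proj₂ (archimedean (c * e ⁻¹))
    n*e≤c : fromℕ (suc n) * e ≤ c * e ⁻¹ * e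
    n*e≤c = ≤-by (x≤y⇒0≤y-x (h n)) (begin-equality
      c * e ⁻¹ * e - fromℕ (suc n) * e
        ≈⟨ +-congʳ (trans (*-assoc _ _ _) (trans (*-congˡ (*-inverseˡ e (<⇒≉ 0<e))) (*-identityʳ c))) ⟩
      c - fromℕ (suc n) * e
        ≈⟨ solve 4 (λ c x y n → c :- n :* (x :- y) := (y :* n :+ c) :- x :* n) refl c x y (fromℕ (suc n)) ⟩
      y * fromℕ (suc n) + c - x * fromℕ (suc n) ∎)

  floor : ∀ {x} → 0# ≤ x → ∃ λ a → fromℕ a ≤ x × x < fromℕ (suc a)
  floor {x} 0≤x = search (proj₁ (archimedean x)) (proj₂ (archimedean x))
    where
    search : ∀ n → x < fromℕ n → ∃ λ a → fromℕ a ≤ x × x < fromℕ (suc a)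
    search zero    x<0   = contradiction 0≤x x<0
    search (suc n) x<1+n with ≤⊎> (fromℕ n) x
    ... | inj₁ n≤x = n , n≤x , x<1+n
    ... | inj₂ x<n = search n x<n

  -- The induction hypothesis multiplied by z exceeds the next tangent by (n + 1) yⁿ (z - y)², which
  -- is nonnegative. It takes the place of derivatives in the proofs about roots, means and inverse
  -- exponents.
  ^-tangent : ∀ n {y z} → 0# ≤ y → 0# ≤ z →
              y ^ suc n + fromℕ (suc n) * (y ^ n * (z - y)) ≤ z ^ suc n
  ^-tangent zero {y} {z} 0≤y 0≤z = ≤-reflexive
    (solve 2 (λ y z → y :* :1 :+ (:1 :+ :0) :* (:1 :* (z :- y)) := z :* :1) refl y z)
  ^-tangent (suc n) {y} {z} 0≤y 0≤z = ≤-trans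
    (≤-by (*-nonNegative (*-nonNegative (0≤fromℕ (suc n)) (0≤^ n 0≤y)) (0≤x² (z - y)))
      (solve 4 (λ y z Y N → z :* (y :* Y :+ N :* (Y :* (z :- y))) :- (y :* (y :* Y) :+ (:1 :+ N) :* (y :* Y :* (z :- y)))
                 := N :* Y :* ((z :- y) :* (z :- y))) refl y z (y ^ n) (fromℕ (suc n))))
    (*-monoˡ-≤ 0≤z (^-tangent n 0≤y 0≤z))

  -- Since (n + 1) z - n y = 1, the tangent at y of the power n + 1 takes exactly the value yⁿ at z.
  -- With y = 1 + x / n and z = 1 + x / (n + 1) this is the monotonicity of (1 + x / n)ⁿ.
  ^-mean-step : ∀ n {y z} → 0# ≤ y → 0# ≤ z →
                fromℕ n * y + 1# ≈ fromℕ (suc n) * z → y ^ n ≤ z ^ suc n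
  ^-mean-step n {y} {z} 0≤y 0≤z eq = ≤-trans (≤-reflexive (begin-equality
    y ^ n
      ≈⟨ solve 3 (λ y Y N → Y := y :* Y :+ Y :* ((N :* y :+ :1) :- (:1 :+ N) :* y)) refl y (y ^ n) (fromℕ n) ⟩
    y ^ suc n + y ^ n * (fromℕ n * y + 1# - fromℕ (suc n) * y)
      ≈⟨ +-congˡ (*-congˡ (+-congʳ eq)) ⟩
    y ^ suc n + y ^ n * (fromℕ (suc n) * z - fromℕ (suc n) * y)
      ≈⟨ +-congˡ (solve 4 (λ y z Y N → Y :* (N :* z :- N :* y) := N :* (Y :* (z :- y))) refl y z (y ^ n) (fromℕ (suc n))) ⟩
    y ^ suc n + fromℕ (suc n) * (y ^ n * (z - y)) ∎))
    (^-tangent n 0≤y 0≤z)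

  -- The inequality of arithmetic and geometric means for b copies of y and d
  -- copies of 1.
  ^-mean : ∀ d b {y z} → 0# ≤ y →
           fromℕ b * y + fromℕ d ≈ fromℕ (d ℕ.+ b) * z → y ^ b ≤ z ^ (d ℕ.+ b)
  ^-mean zero    zero    0≤y eq = ≤-refl
  ^-mean zero    (suc b) {y} {z} 0≤y eq = ≤-reflexive (^-congˡ (suc b) (*-cancelʳ (0<fromℕ-suc b)
    (trans (*-comm _ _) (trans (sym (+-identityʳ _)) (trans eq (*-comm _ _))))))
  ^-mean (suc d) b {y} {z} 0≤y eq = begin
    y ^ b                ≤⟨ ^-mean-step b 0≤y 0≤w (sym Nw) ⟩
    w ^ suc b            ≤⟨ ^-mean d (suc b) 0≤w eq′ ⟩
    z ^ (d ℕ.+ suc b)    ≡⟨ ≡.cong (z ^_) (ℕ.+-suc d b) ⟩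
    z ^ (suc d ℕ.+ b)    ∎
    where
    N = fromℕ (suc b)
    -- One copy of 1 is averaged with the b copies of y, which leaves b + 1 copies of w and d copies
    -- of 1.
    w = (fromℕ b * y + 1#) * N ⁻¹
    0≤w : 0# ≤ w
    0≤w = *-nonNegative (0≤+ (*-nonNegative (0≤fromℕ b) 0≤y) 0≤1) (<⇒≤ (0<⁻¹ (0<fromℕ-suc b)))
    Nw : N * w ≈ fromℕ b * y + 1#
    Nw = trans (*-comm N w) (trans (*-assoc _ _ _)
           (trans (*-congˡ (*-inverseˡ N (<⇒≉ (0<fromℕ-suc b)))) (*-identityʳ _)))
    eq′ : N * w + fromℕ d ≈ fromℕ (d ℕ.+ suc b) * z
    eq′ = begin-equality
      N * w + fromℕ d                 ≈⟨ +-congʳ Nw ⟩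
      fromℕ b * y + 1# + fromℕ d      ≈⟨ +-assoc _ _ _ ⟩
      fromℕ b * y + fromℕ (suc d)     ≈⟨ eq ⟩
      fromℕ (suc d ℕ.+ b) * z         ≡⟨ ≡.cong (λ e → fromℕ e * z) (ℕ.+-suc d b) ⟨
      fromℕ (d ℕ.+ suc b) * z         ∎

  RootSet : ℕ → ℝ → Pred ℝ 0ℓ
  RootSet n c y = 0# ≤ y × y ^ suc n ≤ c

  module Root (n : ℕ) {c : ℝ} (0≤c : 0# ≤ c) where

    N = suc n
    S = RootSet n c
    0∈S : S 0#
    0∈S = ≤-refl , ≤-resp (sym (zeroˡ _)) refl 0≤c
    1≤1+c : 1# ≤ 1# + c
    1≤1+c = ≤-resp (+-identityʳ 1#) refl (+-monoʳ-≤ 1# 0≤c)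
    c<[1+c]^ : c < (1# + c) ^ N
    c<[1+c]^ h = 0<1 (≤-by (x≤y⇒0≤y-x (≤-trans 1+c≤[1+c]^ h))
                   (solve 1 (λ c → :0 :- :1 := c :- (:1 :+ c)) refl c))
      where
      1+c≤[1+c]^ : 1# + c ≤ (1# + c) ^ N
      1+c≤[1+c]^ = ≤-resp (*-identityʳ _) refl (*-monoˡ-≤ (1≤⇒0≤ 1≤1+c) (1≤^ n 1≤1+c))
    supremum : ∃ (IsSupremum _≤_ S)
    supremum = complete S (0# , 0∈S) (1# + c , λ y (0≤y , y^≤c) →
      ^-cancelˡ-≤ n (1≤⇒0≤ 1≤1+c) (≤-trans y^≤c (<⇒≤ c<[1+c]^)))

  module RootSupremum (n : ℕ) {c s : ℝ} (0≤c : 0# ≤ c) (supremum : IsSupremum _≤_ (RootSet n c) s) where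

    open Root n 0≤c using (N; S; 0∈S)
    upper = proj₁ supremum
    least = proj₂ supremum
    0≤s : 0# ≤ s
    0≤s = upper 0# 0∈S
    s≰s-δ : ∀ {δ} → 0# < δ → ¬ (s ≤ s - δ)
    s≰s-δ {δ} 0<δ h = 0<δ (≤-by (x≤y⇒0≤y-x h) (solve 2 (λ s d → :0 :- d := (s :- d) :- s) refl s δ))
    K = fromℕ N * s ^ n
    0≤K : 0# ≤ K
    0≤K = *-nonNegative (0≤fromℕ N) (0≤^ n 0≤s)
    -- K is the slope at s. If `s ^ N` exceeded c + K δ, the tangent at s would force every member
    -- of the root set below s - δ, and s would not be the least upper bound.
    s^≤c : s ^ N ≤ c
    s^≤c = ≤-approximate 0≤K approximate
      where
      approximate : ∀ δ → 0# < δ → s ^ N ≤ c + K * δ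
      approximate δ 0<δ with ≤⊎> (s ^ N) (c + K * δ)
      ... | inj₁ h = h
      ... | inj₂ h = contradiction (least (s - δ) bound) (s≰s-δ 0<δ)
        where
        bound : ∀ u → S u → u ≤ s - δ
        bound u (0≤u , u^≤c) with ≤⊎> u (s - δ)
        ... | inj₁ u≤ = u≤
        ... | inj₂ >u = contradiction (begin
          s ^ N                                      ≤⟨ x+y≤z⇒x≤z-y (^-tangent n 0≤s 0≤u) ⟩
          u ^ N - fromℕ N * (s ^ n * (u - s))        ≤⟨ +-monoˡ-≤ _ u^≤c ⟩
          c - fromℕ N * (s ^ n * (u - s))
            ≈⟨ solve 5 (λ c N Y u s → c :- N :* (Y :* (u :- s)) := c :+ N :* Y :* (s :- u)) refl c (fromℕ N) (s ^ n) u s ⟩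
          c + K * (s - u)
            ≤⟨ +-monoʳ-≤ c (*-monoˡ-≤ 0≤K (≤-by (x≤y⇒0≤y-x (<⇒≤ >u))
                                                          (solve 3 (λ d s u → d :- (s :- u) := u :- (s :- d)) refl δ s u))) ⟩
          c + K * δ                                  ∎) h
    K′ = fromℕ N * (s + 1#) ^ n
    0≤s+1 : 0# ≤ s + 1#
    0≤s+1 = 0≤+ 0≤s 0≤1
    0≤K′ : 0# ≤ K′
    0≤K′ = *-nonNegative (0≤fromℕ N) (0≤^ n 0≤s+1)
    -- As s + δ lies above the supremum, its power exceeds c. The tangent at s + δ bounds the growth
    -- from s, and δ ≤ 1 replaces its slope by the fixed number K′.
    small : ∀ δ → 0# < δ → δ ≤ 1# → c ≤ s ^ N + K′ * δ
    small δ 0<δ δ≤1 with ≤⊎> ((s + δ) ^ N) c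
    ... | inj₁ h = contradiction (≤-by (x≤y⇒0≤y-x (upper (s + δ) (0≤s+δ , h)))
                     (solve 2 (λ s d → (s :- d) :- s := s :- (s :+ d)) refl s δ)) (s≰s-δ 0<δ)
      where
      0≤s+δ = 0≤+ 0≤s (<⇒≤ 0<δ)
    ... | inj₂ h = begin
      c                                                ≤⟨ <⇒≤ h ⟩
      (s + δ) ^ N                                      ≤⟨ x+y≤z⇒x≤z-y (^-tangent n 0≤s+δ 0≤s) ⟩
      s ^ N - fromℕ N * ((s + δ) ^ n * (s - (s + δ)))
        ≈⟨ solve 5 (λ S N Y s d → S :- N :* (Y :* (s :- (s :+ d))) := S :+ N :* Y :* d) refl (s ^ N) (fromℕ N) ((s + δ) ^ n) s δ ⟩
      s ^ N + fromℕ N * (s + δ) ^ n * δ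
        ≤⟨ +-monoʳ-≤ _ (*-monoʳ-≤ (<⇒≤ 0<δ) (*-monoˡ-≤ (0≤fromℕ N) (^-monoˡ-≤ n 0≤s+δ (+-monoʳ-≤ s δ≤1)))) ⟩
      s ^ N + K′ * δ                                   ∎
      where
      0≤s+δ = 0≤+ 0≤s (<⇒≤ 0<δ)
    c≤s^ : c ≤ s ^ N
    c≤s^ = ≤-approximate 0≤K′ λ δ 0<δ → approximate δ 0<δ
      where
      approximate : ∀ δ → 0# < δ → c ≤ s ^ N + K′ * δ
      approximate δ 0<δ with total δ 1#
      ... | inj₁ δ≤1 = small δ 0<δ δ≤1
      ... | inj₂ 1≤δ = ≤-trans (small 1# 0<1 ≤-refl) (+-monoʳ-≤ _ (*-monoˡ-≤ 0≤K′ 1≤δ))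

  abstract
    root : ∀ n {c} → 0# ≤ c → ∃ λ y → 0# ≤ y × y ^ suc n ≈ c
    root n 0≤c = let s , supremum = Root.supremum n 0≤c
                     open RootSupremum n 0≤c supremum
                 in s , 0≤s , antisym s^≤c c≤s^

  ^-clear : ∀ {u x} b a c → 0# ≤ u → u ^ b ≤ x ^ a → u ^ (b ℕ.* c) ≤ x ^ (a ℕ.* c)
  ^-clear {u} {x} b a c 0≤u h =
    ≤-resp (^-assocʳ u b c) (^-assocʳ x a c) (^-monoˡ-≤ c (0≤^ b 0≤u) h)

  module Base≥1 {p : ℝ} (0≤p : 0# ≤ p) where

    S : ℝ → Pred ℝ 0ℓ
    S x y = 0# ≤ y × ∃₂ λ a b → (fromℕ a ≤ p * fromℕ (suc b)) × (y ^ suc b ≤ x ^ a)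

    1∈S : ∀ x → S x 1#
    1∈S x = 0≤1 , 0 , 0 , *-nonNegative 0≤p (0≤fromℕ 1) , ≤-reflexive (*-identityˡ 1#)

    supremum : ∀ {x} → 1# ≤ x → IsSupremum _≤_ (S x) (power≥1 x p)
    supremum {x} 1≤x = ⋁-isSupremum (1# , 1∈S x) (x ^ P , bound)
      where
      -- Any natural number above p serves: a ≤ p (b + 1) ≤ P (b + 1), and powers of a base x ≥ 1
      -- increase with the exponent.
      P = proj₁ (archimedean p)
      bound : ∀ y → S x y → y ≤ x ^ P
      bound y (0≤y , a , b , a≤pb , y^≤x^) = ^-cancelˡ-≤ b (0≤^ P (1≤⇒0≤ 1≤x)) (begin
        y ^ suc b              ≤⟨ y^≤x^ ⟩
        x ^ a
          ≤⟨ ^-monoʳ-≤ 1≤x (fromℕ-cancel-≤ a (P ℕ.* suc b) (≤-trans a≤pb (≤-trans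
                                    (*-monoʳ-≤ (0≤fromℕ (suc b)) (<⇒≤ (proj₂ (archimedean p))))
                                    (≤-reflexive (sym (fromℕ-* P (suc b))))))) ⟩
        x ^ (P ℕ.* suc b)      ≈⟨ ^-assocʳ x P (suc b) ⟨
        (x ^ P) ^ suc b        ∎)

    upper : ∀ {x y} a b → 1# ≤ x → 0# ≤ y → fromℕ a ≤ p * fromℕ (suc b) → y ^ suc b ≤ x ^ a → y ≤ power≥1 x p
    upper a b 1≤x 0≤y a≤pb h = proj₁ (supremum 1≤x) _ (0≤y , a , b , a≤pb , h)

    least : ∀ {x u} → 1# ≤ x → (∀ y → S x y → y ≤ u) → power≥1 x p ≤ u
    least 1≤x = proj₂ (supremum 1≤x) _

    1≤power≥1 : ∀ {x} → 1# ≤ x → 1# ≤ power≥1 x p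
    1≤power≥1 {x} 1≤x = proj₁ (supremum 1≤x) 1# (1∈S x)

    0<power≥1 : ∀ {x} → 1# ≤ x → 0# < power≥1 x p
    0<power≥1 1≤x = 1≤⇒0< (1≤power≥1 1≤x)

    power≥1-cong : ∀ {x x′} → 1# ≤ x → x ≈ x′ → power≥1 x p ≈ power≥1 x′ p
    power≥1-cong {x} {x′} 1≤x eq = antisym (half 1≤x eq) (half 1≤x′ (sym eq))
      where
      1≤x′ = ≤-resp refl eq 1≤x
      half : ∀ {x x′} → 1# ≤ x → x ≈ x′ → power≥1 x p ≤ power≥1 x′ p
      half {x} {x′} 1≤x eq = least 1≤x λ y (0≤y , a , b , a≤pb , h) →
        upper a b (≤-resp refl eq 1≤x) 0≤y a≤pb (≤-resp refl (^-congˡ a eq) h)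

    -- For u > 0 divide by u; for u = 0 the member 1 of the set gives 0 ≤ c. Applied to one factor
    -- at a time, it bounds a product of two suprema.
    least-scaled : ∀ {x u c} → 1# ≤ x → 0# ≤ u → (∀ y → S x y → u * y ≤ c) → u * power≥1 x p ≤ c
    least-scaled {x} {u} {c} 1≤x 0≤u h with ≤⊎> u 0#
    ... | inj₁ u≤0 = begin
      u * power≥1 x p   ≈⟨ *-congʳ u≈0 ⟩
      0# * power≥1 x p  ≈⟨ zeroˡ _ ⟩
      0#                ≈⟨ zeroˡ _ ⟨
      0# * 1#           ≈⟨ *-congʳ u≈0 ⟨
      u * 1#            ≤⟨ h 1# (1∈S x) ⟩
      c                 ∎
      where
      u≈0 = antisym u≤0 0≤u
    ... | inj₂ 0<u = begin
      u * power≥1 x p   ≤⟨ *-monoˡ-≤ 0≤u (least 1≤x λ y y∈S → *-cancelʳ-≤ 0<u (begin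
                             y * u           ≈⟨ *-comm y u ⟩
                             u * y           ≤⟨ h y y∈S ⟩
                             c               ≈⟨ c/u*u ⟨
                             c * u ⁻¹ * u    ∎)) ⟩
      u * (c * u ⁻¹)    ≈⟨ *-comm _ _ ⟩
      c * u ⁻¹ * u      ≈⟨ c/u*u ⟩
      c                 ∎
      where
      c/u*u : c * u ⁻¹ * u ≈ c
      c/u*u = trans (*-assoc _ _ _) (trans (*-congˡ (*-inverseˡ u (<⇒≉ 0<u))) (*-identityʳ c))

    -- A member for x y with exponent a / (b + 1) is at most the product of the (b + 1)-th roots of
    -- xᵃ and yᵃ. Conversely, members for x and for y are brought to a common denominator; the
    -- larger numerator m serves both, because the bases are at least 1.
    power≥1-* : ∀ {x y} → 1# ≤ x → 1# ≤ y → power≥1 (x * y) p ≈ power≥1 x p * power≥1 y p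
    power≥1-* {x} {y} 1≤x 1≤y = antisym
      (least 1≤xy λ w (0≤w , a , b , a≤pb , h) →
        let ρ , 0≤ρ , ρ^ = root b (0≤^ a (1≤⇒0≤ 1≤x))
            σ , 0≤σ , σ^ = root b (0≤^ a (1≤⇒0≤ 1≤y))
        in begin
        w                          ≤⟨ ^-cancelˡ-≤ b (*-nonNegative 0≤ρ 0≤σ) (begin
             w ^ suc b                  ≤⟨ h ⟩
             (x * y) ^ a                ≈⟨ ^-distrib-* x y a ⟩
             x ^ a * y ^ a              ≈⟨ *-cong ρ^ σ^ ⟨
             ρ ^ suc b * σ ^ suc b      ≈⟨ ^-distrib-* ρ σ (suc b) ⟨
             (ρ * σ) ^ suc b            ∎) ⟩
        ρ * σ                      ≤⟨ *-mono-≤ 0≤ρ (<⇒≤ (0<power≥1 1≤y))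
                                        (upper a b 1≤x 0≤ρ a≤pb (≤-reflexive ρ^))
                                        (upper a b 1≤y 0≤σ a≤pb (≤-reflexive σ^)) ⟩
        power≥1 x p * power≥1 y p  ∎)
      (≤-resp (*-comm _ _) refl (least-scaled 1≤x (<⇒≤ (0<power≥1 1≤y)) λ u u∈S →
        ≤-resp (*-comm _ _) refl (least-scaled 1≤y (proj₁ u∈S) λ v v∈S → product u v u∈S v∈S)))
      where
      1≤xy : 1# ≤ x * y
      1≤xy = ≤-trans 1≤x (≤-resp (*-identityʳ x) refl (*-monoˡ-≤ (1≤⇒0≤ 1≤x) 1≤y))
      product : ∀ u v → S x u → S y v → u * v ≤ power≥1 (x * y) p
      product u v (0≤u , a , b , a≤pb , hu) (0≤v , a′ , b′ , a′≤pb′ , hv) =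
        upper m (b′ ℕ.+ b ℕ.* suc b′) 1≤xy (*-nonNegative 0≤u 0≤v) m≤pbb′ (begin
          (u * v) ^ (suc b ℕ.* suc b′)                      ≈⟨ ^-distrib-* u v (suc b ℕ.* suc b′) ⟩
          u ^ (suc b ℕ.* suc b′) * v ^ (suc b ℕ.* suc b′)
            ≈⟨ *-congˡ (^-congʳ v (ℕ.*-comm (suc b) (suc b′))) ⟩
          u ^ (suc b ℕ.* suc b′) * v ^ (suc b′ ℕ.* suc b)
            ≤⟨ *-mono-≤ (0≤^ (suc b ℕ.* suc b′) 0≤u) (0≤^ m (1≤⇒0≤ 1≤y))
            (≤-trans (^-clear (suc b) a (suc b′) 0≤u hu) (^-monoʳ-≤ 1≤x (ℕ.m≤m⊔n (a ℕ.* suc b′) (a′ ℕ.* suc b))))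
            (≤-trans (^-clear (suc b′) a′ (suc b) 0≤v hv) (^-monoʳ-≤ 1≤y (ℕ.m≤n⊔m (a ℕ.* suc b′) (a′ ℕ.* suc b)))) ⟩
          x ^ m * y ^ m                                     ≈⟨ ^-distrib-* x y m ⟨
          (x * y) ^ m                                       ∎)
        where
        m = (a ℕ.* suc b′) ℕ.⊔ (a′ ℕ.* suc b)
        scale : ∀ {a b} c → fromℕ a ≤ p * fromℕ b → fromℕ (a ℕ.* c) ≤ p * fromℕ (b ℕ.* c)
        scale {a} {b} c h = begin
          fromℕ (a ℕ.* c)           ≈⟨ fromℕ-* a c ⟩
          fromℕ a * fromℕ c         ≤⟨ *-monoʳ-≤ (0≤fromℕ c) h ⟩
          p * fromℕ b * fromℕ c     ≈⟨ *-assoc p _ _ ⟩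
          p * (fromℕ b * fromℕ c)   ≈⟨ *-congˡ (fromℕ-* b c) ⟨
          p * fromℕ (b ℕ.* c)       ∎
        m≤pbb′ : fromℕ m ≤ p * fromℕ (suc b ℕ.* suc b′)
        m≤pbb′ with ℕ.⊔-sel (a ℕ.* suc b′) (a′ ℕ.* suc b)
        ... | inj₁ eq = ≤-trans (≤-reflexive (reflexive (≡.cong fromℕ eq))) (scale {a} {suc b} (suc b′) a≤pb)
        ... | inj₂ eq = ≤-trans (≤-reflexive (reflexive (≡.cong fromℕ eq)))
                (≤-trans (scale {a′} {suc b′} (suc b) a′≤pb′) (≤-reflexive (*-congˡ (reflexive (≡.cong fromℕ (ℕ.*-comm (suc b′) (suc b)))))))

    -- By multiplicativity it is a positive idempotent.
    power≥1-1 : power≥1 1# p ≈ 1#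
    power≥1-1 = *-cancelʳ (0<power≥1 ≤-refl)
      (trans (sym (power≥1-* ≤-refl ≤-refl)) (trans (sym (power≥1-cong ≤-refl (sym (*-identityʳ 1#)))) (sym (*-identityˡ _))))

    power-≤0 : ∀ {x} → x ≤ 0# → power x p ≈ 0#
    power-≤0 {x} x≤0 with em {x ≤ 0#} | em {1# ≤ x}
    ... | yes _  | _ = refl
    ... | no x≰0 | _ = contradiction x≤0 x≰0

    -- Writing a positive x as X / Y with X and Y at least 1 removes the case distinction in
    -- `power`; its further laws then follow from those of `power≥1`.
    power-ratio : ∀ {x X Y} → 0# < x → 1# ≤ X → 1# ≤ Y → x * Y ≈ X →
                  power x p * power≥1 Y p ≈ power≥1 X p
    power-ratio {x} {X} {Y} 0<x 1≤X 1≤Y eq with em {x ≤ 0#} | em {1# ≤ x}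
    ... | yes x≤0 | _       = contradiction x≤0 0<x
    ... | no _    | yes 1≤x = trans (sym (power≥1-* 1≤x 1≤Y)) (sym (power≥1-cong 1≤X (sym eq)))
    ... | no _    | no  x<1 = begin-equality
      Q ⁻¹ * power≥1 Y p             ≈⟨ *-congˡ (power≥1-cong 1≤Y (begin-equality
           Y                 ≈⟨ *-identityˡ Y ⟨
           1# * Y            ≈⟨ *-congʳ (*-inverseˡ x (<⇒≉ 0<x)) ⟨
           x ⁻¹ * x * Y      ≈⟨ *-assoc _ _ _ ⟩
           x ⁻¹ * (x * Y)    ≈⟨ *-congˡ eq ⟩
           x ⁻¹ * X          ∎)) ⟩
      Q ⁻¹ * power≥1 (x ⁻¹ * X) p    ≈⟨ *-congˡ (power≥1-* 1≤x⁻¹ 1≤X) ⟩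
      Q ⁻¹ * (Q * power≥1 X p)       ≈⟨ *-assoc _ _ _ ⟨
      Q ⁻¹ * Q * power≥1 X p         ≈⟨ *-congʳ (*-inverseˡ Q (<⇒≉ (0<power≥1 1≤x⁻¹))) ⟩
      1# * power≥1 X p               ≈⟨ *-identityˡ _ ⟩
      power≥1 X p                    ∎
      where
      Q = power≥1 (x ⁻¹) p
      1≤x⁻¹ : 1# ≤ x ⁻¹
      1≤x⁻¹ = 1≤⁻¹ 0<x (<⇒≤ x<1)

    ratio : ∀ {x} → 0# < x → ∃₂ λ X Y → 1# ≤ X × 1# ≤ Y × x * Y ≈ X
    ratio {x} 0<x with total 1# x
    ... | inj₁ 1≤x = x , 1# , 1≤x , ≤-refl , *-identityʳ x
    ... | inj₂ x≤1 = 1# , x ⁻¹ , ≤-refl , 1≤⁻¹ 0<x x≤1 , *-inverseʳ x (<⇒≉ 0<x)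

    power-cong : ∀ {x x′} → x ≈ x′ → power x p ≈ power x′ p
    power-cong {x} {x′} eq with ≤⊎> x 0#
    ... | inj₁ x≤0 = trans (power-≤0 x≤0) (sym (power-≤0 (≤-resp eq refl x≤0)))
    ... | inj₂ 0<x = let X , Y , 1≤X , 1≤Y , xY≈X = ratio 0<x in
      *-cancelʳ (0<power≥1 1≤Y) (trans (power-ratio 0<x 1≤X 1≤Y xY≈X)
        (sym (power-ratio (<-respʳ eq 0<x) 1≤X 1≤Y (trans (*-congʳ (sym eq)) xY≈X))))

    0<power : ∀ {x} → 0# < x → 0# < power x p
    0<power 0<x h = let X , Y , 1≤X , 1≤Y , eq = ratio 0<x in
      0<power≥1 1≤X (≤-resp (power-ratio 0<x 1≤X 1≤Y eq) (zeroˡ _) (*-monoʳ-≤ (<⇒≤ (0<power≥1 1≤Y)) h))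

    0≤power : ∀ x → 0# ≤ power x p
    0≤power x with ≤⊎> x 0#
    ... | inj₁ x≤0 = ≤-reflexive (sym (power-≤0 x≤0))
    ... | inj₂ 0<x = <⇒≤ (0<power 0<x)

    power-* : ∀ {x y} → 0# ≤ x → 0# ≤ y → power (x * y) p ≈ power x p * power y p
    power-* {x} {y} 0≤x 0≤y with ≤⊎> x 0# | ≤⊎> y 0#
    ... | inj₁ x≤0 | _        = trans (power-≤0 (≤-resp refl (zeroˡ y) (*-monoʳ-≤ 0≤y x≤0)))
                                  (sym (trans (*-congʳ (power-≤0 x≤0)) (zeroˡ _)))
    ... | inj₂ _   | inj₁ y≤0 = trans (power-≤0 (≤-resp refl (zeroʳ x) (*-monoˡ-≤ 0≤x y≤0)))
                                  (sym (trans (*-congˡ (power-≤0 y≤0)) (zeroʳ _)))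
    ... | inj₂ 0<x | inj₂ 0<y =
      let X , Y , 1≤X , 1≤Y , xY≈X = ratio 0<x
          Z , W , 1≤Z , 1≤W , yW≈Z = ratio 0<y
          1≤* : ∀ {u v} → 1# ≤ u → 1# ≤ v → 1# ≤ u * v
          1≤* 1≤u 1≤v = ≤-trans 1≤u (≤-resp (*-identityʳ _) refl (*-monoˡ-≤ (1≤⇒0≤ 1≤u) 1≤v))
          interchange = solve 4 (λ x y z w → (x :* y) :* (z :* w) := (x :* z) :* (y :* w)) refl
      in *-cancelʳ (0<power≥1 (1≤* 1≤Y 1≤W)) (begin-equality
        power (x * y) p * power≥1 (Y * W) p
          ≈⟨ power-ratio (0<* 0<x 0<y) (1≤* 1≤X 1≤Z) (1≤* 1≤Y 1≤W)
                                                     (trans (interchange x y Y W) (*-cong xY≈X yW≈Z)) ⟩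
        power≥1 (X * Z) p                       ≈⟨ power≥1-* 1≤X 1≤Z ⟩
        power≥1 X p * power≥1 Z p
          ≈⟨ *-cong (power-ratio 0<x 1≤X 1≤Y xY≈X) (power-ratio 0<y 1≤Z 1≤W yW≈Z) ⟨
        (power x p * power≥1 Y p) * (power y p * power≥1 W p) ≈⟨ interchange _ _ _ _ ⟩
        (power x p * power y p) * (power≥1 Y p * power≥1 W p) ≈⟨ *-congˡ (power≥1-* 1≤Y 1≤W) ⟨
        power x p * power y p * power≥1 (Y * W) p ∎)

-- Bernoulli's inequality, convexity and inversion of real powers.

module ConvexPowers (em : ExcludedMiddle 0ℓ) (𝓡 : CompleteOrderedField) where

  open OrderedField em 𝓡
  open Powers em 𝓡
  open ≤R

  -- Bernoulli's inequality at the exponent a / (b + 1), with w the left side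
  -- 1 + a (x - 1) / (b + 1).
  bernoulli-rational : ∀ {a b x w} → suc b ℕ.≤ a → 0# ≤ w →
                       fromℕ (suc b) * w ≈ fromℕ (suc b) + fromℕ a * (x - 1#) → w ^ suc b ≤ x ^ a
  bernoulli-rational {a} {b} {x} {w} b<a 0≤w eq = begin
    w ^ suc b               ≤⟨ ^-mean d (suc b) 0≤w (begin-equality
      fromℕ (suc b) * w + fromℕ d                          ≈⟨ +-congʳ eq ⟩
      fromℕ (suc b) + fromℕ a * (x - 1#) + fromℕ d
        ≈⟨ solve 4 (λ B D A x → (B :+ A :* (x :- :1)) :+ D := (D :+ B) :+ (A :* x :- A)) refl _ _ _ _ ⟩
      fromℕ d + fromℕ (suc b) + (fromℕ a * x - fromℕ a)    ≈⟨ +-congʳ (fromℕ-+ d (suc b)) ⟨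
      fromℕ (d ℕ.+ suc b) + (fromℕ a * x - fromℕ a)
        ≡⟨ ≡.cong (λ e → fromℕ e + (fromℕ a * x - fromℕ a)) (ℕ.m∸n+n≡m b<a) ⟩
      fromℕ a + (fromℕ a * x - fromℕ a)
        ≈⟨ solve 2 (λ A x → A :+ (A :* x :- A) := A :* x) refl _ _ ⟩
      fromℕ a * x
        ≡⟨ ≡.cong (λ e → fromℕ e * x) (ℕ.m∸n+n≡m b<a) ⟨
      fromℕ (d ℕ.+ suc b) * x                              ∎) ⟩
    x ^ (d ℕ.+ suc b)       ≡⟨ ≡.cong (x ^_) (ℕ.m∸n+n≡m b<a) ⟩
    x ^ a                   ∎
    where
    d = a ℕ.∸ suc b

  weight-* : ∀ a b x → fromℕ (suc b) * (1# + fromℕ a * fromℕ (suc b) ⁻¹ * (x - 1#)) ≈ fromℕ (suc b) + fromℕ a * (x - 1#)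
  weight-* a b x = begin-equality
    B * (1# + A * B ⁻¹ * (x - 1#))
      ≈⟨ solve 4 (λ A B C x → B :* (:1 :+ A :* C :* x) := B :+ A :* (B :* C) :* x) refl A B (B ⁻¹) (x - 1#) ⟩
    B + A * (B * B ⁻¹) * (x - 1#)
      ≈⟨ +-congˡ (*-congʳ (trans (*-congˡ (*-inverseʳ B (<⇒≉ (0<fromℕ-suc b)))) (*-identityʳ A))) ⟩
    B + A * (x - 1#)                       ∎
    where
    A = fromℕ a
    B = fromℕ (suc b)

  module Exponent≥1 {p : ℝ} (1≤p : 1# ≤ p) where

    0≤p = 1≤⇒0≤ 1≤p
    open Base≥1 0≤p public

    module _ (b : ℕ) where
      floor-p = floor (*-nonNegative 0≤p (0≤fromℕ (suc b)))
      ⌊pb⌋ = proj₁ floor-p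
      ⌊pb⌋≤pb : fromℕ ⌊pb⌋ ≤ p * fromℕ (suc b)
      ⌊pb⌋≤pb = proj₁ (proj₂ floor-p)
      pb≤1+⌊pb⌋ : p * fromℕ (suc b) ≤ fromℕ (suc ⌊pb⌋)
      pb≤1+⌊pb⌋ = <⇒≤ (proj₂ (proj₂ floor-p))
      -- `⌊pb⌋` is the integer part of p (b + 1). By 1 ≤ p the rational exponent `⌊pb⌋` / (b + 1) is
      -- at least 1, as `bernoulli-rational` demands.
      b≤⌊pb⌋ : suc b ℕ.≤ ⌊pb⌋
      b≤⌊pb⌋ with ℕ.≤-<-connex (suc b) ⌊pb⌋
      ... | inj₁ h = h
      ... | inj₂ (ℕ.s≤s h) = contradiction (≤-trans (fromℕ-mono-≤ (ℕ.s≤s h))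
              (≤-resp (*-identityˡ _) refl (*-monoʳ-≤ (0≤fromℕ (suc b)) 1≤p))) (proj₂ (proj₂ floor-p))

    -- The rational inequality at a / (b + 1) ≤ p makes w a member of the set whose supremum is the
    -- power. Rounding p (b + 1) down to a costs at most x - 1, whatever b is.
    bernoulli≥1 : ∀ {x} → 1# ≤ x → 1# + p * (x - 1#) ≤ power≥1 x p
    bernoulli≥1 {x} 1≤x = ≤-limit {c = x - 1#} bound
      where
      0≤x-1 = x≤y⇒0≤y-x 1≤x
      bound : ∀ b → (1# + p * (x - 1#)) * fromℕ (suc b) ≤ power≥1 x p * fromℕ (suc b) + (x - 1#)
      bound b = begin
        (1# + p * (x - 1#)) * B
          ≈⟨ solve 3 (λ p t B → (:1 :+ p :* t) :* B := B :+ (p :* B) :* t) refl p (x - 1#) B ⟩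
        B + p * B * (x - 1#)              ≤⟨ +-monoʳ-≤ B (*-monoʳ-≤ 0≤x-1 (pb≤1+⌊pb⌋ b)) ⟩
        B + (1# + fromℕ a) * (x - 1#)
          ≈⟨ solve 3 (λ A t B → B :+ (:1 :+ A) :* t := (B :+ A :* t) :+ t) refl (fromℕ a) (x - 1#) B ⟩
        B + fromℕ a * (x - 1#) + (x - 1#) ≈⟨ +-congʳ (trans (*-comm w B) (weight-* a b x)) ⟨
        w * B + (x - 1#)
          ≤⟨ +-monoˡ-≤ _ (*-monoʳ-≤ (0≤fromℕ (suc b)) (upper a b 1≤x 0≤w (⌊pb⌋≤pb b)
                                               (bernoulli-rational {a} {b} (b≤⌊pb⌋ b) 0≤w (weight-* a b x)))) ⟩
        power≥1 x p * B + (x - 1#)        ∎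
        where
        B = fromℕ (suc b)
        a = ⌊pb⌋ b
        w = 1# + fromℕ a * B ⁻¹ * (x - 1#)
        0≤w : 0# ≤ w
        0≤w = 0≤+ 0≤1 (*-nonNegative (*-nonNegative (0≤fromℕ a) (<⇒≤ (0<⁻¹ (0<fromℕ-suc b)))) 0≤x-1)

    -- Below 1 the power is the inverse of a supremum over Y = 1 / x, so the claim becomes t y ≤ 1
    -- for every member y. The left side decreases in the exponent, so t ≤ w for each rational
    -- exponent up to p, and rounding costs nothing.
    bernoulli≤1 : ∀ {x} → 0# < x → x ≤ 1# → 1# + p * (x - 1#) ≤ power x p
    bernoulli≤1 {x} 0<x x≤1 with ≤⊎> (1# + p * (x - 1#)) 0#
    ... | inj₁ t≤0 = ≤-trans t≤0 (0≤power x)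
    ... | inj₂ 0<t = *-cancelʳ-≤ (0<power≥1 1≤Y) (begin
      t * power≥1 Y p           ≤⟨ least-scaled 1≤Y (<⇒≤ 0<t) bound ⟩
      1#                        ≈⟨ power≥1-1 ⟨
      power≥1 1# p              ≈⟨ power-ratio 0<x ≤-refl 1≤Y xY≈1 ⟨
      power x p * power≥1 Y p   ∎)
      where
      t = 1# + p * (x - 1#)
      Y = x ⁻¹
      1≤Y = 1≤⁻¹ 0<x x≤1
      xY≈1 = *-inverseʳ x (<⇒≉ 0<x)
      0≤1-x = x≤y⇒0≤y-x x≤1
      decrease : ∀ {r s} → r ≤ s → 1# + s * (x - 1#) ≤ 1# + r * (x - 1#)
      decrease {r} {s} r≤s = ≤-by (*-nonNegative (x≤y⇒0≤y-x r≤s) 0≤1-x)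
        (solve 3 (λ r s x → (:1 :+ r :* (x :- :1)) :- (:1 :+ s :* (x :- :1)) := (s :- r) :* (:1 :- x)) refl r s x)
      bound : ∀ y → S Y y → t * y ≤ 1#
      bound y (0≤y , a , b , a≤pb , h) with ℕ.≤-<-connex (suc b) a
      ... | inj₁ b<a = ^-cancelˡ-≤ b 0≤1 (begin
        (t * y) ^ suc b
          ≤⟨ ^-monoˡ-≤ (suc b) (*-nonNegative (<⇒≤ 0<t) 0≤y) (*-monoʳ-≤ 0≤y t≤w) ⟩
        (w * y) ^ suc b           ≈⟨ ^-distrib-* w y (suc b) ⟩
        w ^ suc b * y ^ suc b
          ≤⟨ *-mono-≤ (0≤^ (suc b) 0≤w) (0≤^ a (1≤⇒0≤ 1≤Y)) (bernoulli-rational {a} {b} b<a 0≤w (weight-* a b x)) h ⟩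
        x ^ a * Y ^ a             ≈⟨ ^-distrib-* x Y a ⟨
        (x * Y) ^ a               ≈⟨ ^-congˡ a xY≈1 ⟩
        1# ^ a                    ≈⟨ 1^ a ⟩
        1#                        ≈⟨ 1^ (suc b) ⟨
        1# ^ suc b                ∎)
        where
        B = fromℕ (suc b)
        w = 1# + fromℕ a * B ⁻¹ * (x - 1#)
        t≤w : t ≤ w
        t≤w = decrease (*-cancelʳ-≤ (0<fromℕ-suc b) (≤-trans (≤-reflexive (trans (*-assoc _ _ _)
                (trans (*-congˡ (*-inverseˡ B (<⇒≉ (0<fromℕ-suc b)))) (*-identityʳ _)))) a≤pb))
        0≤w = ≤-trans (<⇒≤ 0<t) t≤w
      -- Bernoulli's inequality does not apply to an exponent below 1, but here t ≤ x by 1 ≤ p, and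
      -- y ≤ Y.
      ... | inj₂ a≤b = begin
        t * y    ≤⟨ *-mono-≤ (<⇒≤ 0<t) (1≤⇒0≤ 1≤Y)
                      (≤-trans (decrease 1≤p) (≤-reflexive (solve 1 (λ x → :1 :+ :1 :* (x :- :1) := x) refl x)))
                      (^-cancelˡ-≤ b (1≤⇒0≤ 1≤Y) (≤-trans h (^-monoʳ-≤ 1≤Y (ℕ.<⇒≤ a≤b)))) ⟩
        x * Y    ≈⟨ xY≈1 ⟩
        1#       ∎

    bernoulli : ∀ {x} → 0# ≤ x → 1# + p * (x - 1#) ≤ power x p
    bernoulli {x} 0≤x with ≤⊎> x 0# | total 1# x
    ... | inj₁ x≤0 | _ = ≤-by (x≤y⇒0≤y-x 1≤p) (begin-equality
      power x p - (1# + p * (x - 1#))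
        ≈⟨ +-cong (power-≤0 x≤0) (-‿cong (+-congˡ (*-congˡ (+-congʳ (antisym x≤0 0≤x))))) ⟩
      0# - (1# + p * (0# - 1#))
        ≈⟨ solve 1 (λ p → :0 :- (:1 :+ p :* (:0 :- :1)) := p :- :1) refl p ⟩
      p - 1#                           ∎)
    ... | inj₂ 0<x | inj₂ x≤1 = bernoulli≤1 0<x x≤1
    ... | inj₂ 0<x | inj₁ 1≤x = ≤-trans (bernoulli≥1 1≤x) (≤-reflexive (begin-equality
      power≥1 x p                   ≈⟨ power-ratio 0<x 1≤x ≤-refl (*-identityʳ x) ⟨
      power x p * power≥1 1# p      ≈⟨ *-congˡ power≥1-1 ⟩
      power x p * 1#                ≈⟨ *-identityʳ _ ⟩
      power x p                     ∎))

    quotient : ∀ {x y} → 0# < y → x * y ⁻¹ * y ≈ x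
    quotient {x} {y} 0<y = trans (*-assoc _ _ _) (trans (*-congˡ (*-inverseˡ y (<⇒≉ 0<y))) (*-identityʳ x))

    power-quotient : ∀ {x y} → 0# ≤ x → 0# < y → power (x * y ⁻¹) p * power y p ≈ power x p
    power-quotient 0≤x 0<y = trans (sym (power-* (*-nonNegative 0≤x (<⇒≤ (0<⁻¹ 0<y))) (<⇒≤ 0<y))) (power-cong (quotient 0<y))

    -- Bernoulli's inequality at x / y.
    power-tangent : ∀ {x y} → 0# ≤ x → 0# < y → power y p + p * power y p * y ⁻¹ * (x - y) ≤ power x p
    power-tangent {x} {y} 0≤x 0<y = begin
      P + p * P * y ⁻¹ * (x - y)
        ≈⟨ solve 5 (λ P p i x y → P :+ p :* P :* i :* (x :- y) := (:1 :+ p :* (x :* i :- y :* i)) :* P) refl P p (y ⁻¹) x y ⟩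
      (1# + p * (x * y ⁻¹ - y * y ⁻¹)) * P
        ≈⟨ *-congʳ (+-congˡ (*-congˡ (+-congˡ (-‿cong (*-inverseʳ y (<⇒≉ 0<y)))))) ⟩
      (1# + p * (x * y ⁻¹ - 1#)) * P
        ≤⟨ *-monoʳ-≤ (0≤power y) (bernoulli (*-nonNegative 0≤x (<⇒≤ (0<⁻¹ 0<y)))) ⟩
      power (x * y ⁻¹) p * P                  ≈⟨ power-quotient 0≤x 0<y ⟩
      power x p                               ∎
      where
      P = power y p

    power-mono-≤ : ∀ {x y} → 0# ≤ x → x ≤ y → power x p ≤ power y p
    power-mono-≤ {x} {y} 0≤x x≤y with ≤⊎> x 0#
    ... | inj₁ x≤0 = ≤-trans (≤-reflexive (power-≤0 x≤0)) (0≤power y)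
    ... | inj₂ 0<x = ≤-trans (≤-by (*-nonNegative (*-nonNegative (*-nonNegative 0≤p (0≤power x)) (<⇒≤ (0<⁻¹ 0<x))) (x≤y⇒0≤y-x x≤y))
      (solve 2 (λ P d → (P :+ d) :- P := d) refl _ _)) (power-tangent (≤-trans 0≤x x≤y) 0<x)

    power-cancel-≤ : ∀ {x y} → 0# ≤ y → power x p ≤ power y p → x ≤ y
    power-cancel-≤ {x} {y} 0≤y h with ≤⊎> x y
    ... | inj₁ x≤y = x≤y
    ... | inj₂ y<x with ≤⊎> y 0#
    ...   | inj₁ y≤0 = contradiction (≤-trans h (≤-reflexive (power-≤0 y≤0))) (0<power (≤-<-trans 0≤y y<x))
    ...   | inj₂ 0<y = contradiction (≤-trans (power-tangent (≤-trans 0≤y (<⇒≤ y<x)) 0<y) h) λ le →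
      0<slope (≤-by (x≤y⇒0≤y-x le) (solve 2 (λ P d → :0 :- d := P :- (P :+ d)) refl _ _))
      where
      0<x-y : 0# < x - y
      0<x-y le = y<x (≤-by (x≤0⇒0≤-x le) (solve 2 (λ a b → b :- a := :- (a :- b)) refl x y))
      0<slope : 0# < p * power y p * y ⁻¹ * (x - y)
      0<slope = 0<* (0<* (0<* (1≤⇒0< 1≤p) (0<power 0<y)) (0<⁻¹ 0<y)) 0<x-y

    -- Jensen's inequality: the tangent at the mean M bounds every term from below, and the
    -- deviations from M sum to 0. A factor N on the left keeps the exponent p - 1, which may be 0,
    -- out of the statement.
    power-mean : ∀ {n} (t : Vector ℝ (suc n)) → (∀ i → 0# ≤ t i) →
                 fromℕ (suc n) * power (sum t) p ≤ power (fromℕ (suc n)) p * sum (λ i → power (t i) p)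
    power-mean {n} t 0≤t with ≤⊎> (sum t) 0#
    ... | inj₁ Σ≤0 = ≤-trans (≤-reflexive (trans (*-congˡ (power-≤0 Σ≤0)) (zeroʳ _)))
                       (*-nonNegative (0≤power _) (0≤sum λ i → 0≤power (t i)))
    ... | inj₂ 0<Σ = begin
      N * power (sum t) p               ≈⟨ *-congˡ (power-quotient (0≤sum 0≤t) (0<fromℕ-suc n)) ⟨
      N * (power M p * power N p)
        ≈⟨ solve 3 (λ a b c → a :* (b :* c) := c :* (a :* b)) refl _ _ _ ⟩
      power N p * (N * power M p)       ≤⟨ *-monoˡ-≤ (0≤power N) N*M^≤ ⟩
      power N p * sum (λ i → power (t i) p)  ∎
      where
      N = fromℕ (suc n)
      M = sum t * N ⁻¹
      0<M : 0# < M
      0<M = 0<* 0<Σ (0<⁻¹ (0<fromℕ-suc n))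
      K = p * power M p * M ⁻¹
      deviation : sum (λ i → t i - M) ≈ 0#
      deviation = begin-equality
        sum (λ i → t i - M)              ≈⟨ ∑-distrib-+ t (λ _ → - M) ⟩
        sum t + sum {suc n} (λ _ → - M)
          ≈⟨ +-cong (sym (quotient (0<fromℕ-suc n))) (sum-const (suc n) (- M)) ⟩
        M * N + N * - M                  ≈⟨ solve 2 (λ M N → M :* N :+ N :* (:- M) := :0) refl M N ⟩
        0#                               ∎
      N*M^≤ : N * power M p ≤ sum (λ i → power (t i) p)
      N*M^≤ = begin
        N * power M p                                          ≈⟨ sum-const (suc n) (power M p) ⟨
        sum {suc n} (λ _ → power M p)                          ≈⟨ +-identityʳ _ ⟨
        sum {suc n} (λ _ → power M p) + 0#
          ≈⟨ +-congˡ (trans (sym (*-distribˡ-sum K (λ i → t i - M))) (trans (*-congˡ deviation) (zeroʳ K))) ⟨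
        sum {suc n} (λ _ → power M p) + sum (λ i → K * (t i - M))
          ≈⟨ ∑-distrib-+ (λ _ → power M p) (λ i → K * (t i - M)) ⟨
        sum (λ i → power M p + K * (t i - M))
          ≤⟨ sum-mono-≤ (λ i → power-tangent (0≤t i) 0<M) ⟩
        sum (λ i → power (t i) p)                              ∎

  module InverseExponents {p q : ℝ} (1≤p : 1# ≤ p) (0≤q : 0# ≤ q) (pq≈1 : p * q ≈ 1#) where

    open Exponent≥1 1≤p
    module Q = Base≥1 0≤q

    -- Rational exponents below q and below p have a product of at most 1, so no member exceeds x.
    -- In the other direction, exponents near q and p from below produce the member v = x ^ (a / (a
    -- + 1)), which tends to x as a grows.
    power≥1-inverse : ∀ {x} → 1# ≤ x → power≥1 (power≥1 x q) p ≈ x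
    power≥1-inverse {x} 1≤x = antisym (least 1≤z below) above
      where
      z = power≥1 x q
      1≤z = Q.1≤power≥1 1≤x
      0≤x = 1≤⇒0≤ 1≤x
      z^≤x^ : ∀ a b → fromℕ a ≤ p * fromℕ b → z ^ a ≤ x ^ b
      z^≤x^ zero    b _    = 1≤^ b 1≤x
      -- ρ is x to the power b / (a + 1); it suffices that ρ bounds each member u of the set
      -- defining z.
      z^≤x^ (suc a) b a≤pb = let ρ , 0≤ρ , ρ^≈ = root a (0≤^ b 0≤x) in
        ≤-trans (^-monoˡ-≤ (suc a) (1≤⇒0≤ 1≤z) (Q.least 1≤x λ u (0≤u , a′ , b′ , a′≤qb′ , h) →
          ^-cancelˡ-≤ (a ℕ.+ b′ ℕ.* suc a) 0≤ρ (begin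
            u ^ (suc b′ ℕ.* suc a)      ≤⟨ ^-clear (suc b′) a′ (suc a) 0≤u h ⟩
            x ^ (a′ ℕ.* suc a)
              ≤⟨ ^-monoʳ-≤ 1≤x (fromℕ-cancel-≤ (a′ ℕ.* suc a) (b ℕ.* suc b′) (begin
              fromℕ (a′ ℕ.* suc a)            ≈⟨ fromℕ-* a′ (suc a) ⟩
              fromℕ a′ * fromℕ (suc a)
                ≤⟨ *-mono-≤ (0≤fromℕ a′) (*-nonNegative 0≤p (0≤fromℕ b)) a′≤qb′ a≤pb ⟩
              q * fromℕ (suc b′) * (p * fromℕ b)
                ≈⟨ solve 4 (λ q B p C → q :* B :* (p :* C) := (p :* q) :* (C :* B)) refl q (fromℕ (suc b′)) p (fromℕ b) ⟩
              p * q * (fromℕ b * fromℕ (suc b′))  ≈⟨ trans (*-congʳ pq≈1) (*-identityˡ _) ⟩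
              fromℕ b * fromℕ (suc b′)        ≈⟨ fromℕ-* b (suc b′) ⟨
              fromℕ (b ℕ.* suc b′)            ∎)) ⟩
            x ^ (b ℕ.* suc b′)          ≈⟨ ^-assocʳ x b (suc b′) ⟨
            (x ^ b) ^ suc b′            ≈⟨ ^-congˡ (suc b′) ρ^≈ ⟨
            (ρ ^ suc a) ^ suc b′        ≈⟨ ^-assocʳ ρ (suc a) (suc b′) ⟩
            ρ ^ (suc a ℕ.* suc b′)      ≡⟨ ≡.cong (ρ ^_) (ℕ.*-comm (suc a) (suc b′)) ⟩
            ρ ^ (suc b′ ℕ.* suc a)      ∎))) (≤-reflexive ρ^≈)
      below : ∀ y → S z y → y ≤ x
      below y (0≤y , a , b , a≤pb , h) = ^-cancelˡ-≤ b 0≤x (≤-trans h (z^≤x^ a (suc b) a≤pb))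
      F = power≥1 z p
      above : x ≤ F
      above with ≤⊎> x F
      ... | inj₁ x≤F = x≤F
      ... | inj₂ F<x = ≤-limit {c = (x - 1#) * F} bound
        where
        bound : ∀ b → x * fromℕ (suc b) ≤ F * fromℕ (suc b) + (x - 1#) * F
        bound b = ≤-trans (≤-by (*-nonNegative 0≤x-F (x≤y⇒0≤y-x (≤-trans (fromℕ-mono-≤ (b≤⌊pb⌋ b)) (fromℕ-mono-≤ (ℕ.n≤1+n a)))))
            (solve 4 (λ x F A B → (F :* B :+ (x :- F) :* A) :- x :* B := (x :- F) :* (A :- B)) refl x F (fromℕ (suc a)) (fromℕ (suc b))))
          (+-monoʳ-≤ _ (begin
            (x - F) * fromℕ (suc a)
              ≤⟨ *-monoʳ-≤ (0≤fromℕ (suc a)) (+-monoʳ-≤ x (neg-mono-≤ v≤F)) ⟩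
            (x - v) * fromℕ (suc a)   ≤⟨ *-cancelʳ-≤ (0<^ a 0<v) scaled ⟩
            (x - 1#) * v              ≤⟨ *-monoˡ-≤ (x≤y⇒0≤y-x 1≤x) v≤F ⟩
            (x - 1#) * F              ∎))
          where
          0≤x-F = x≤y⇒0≤y-x (<⇒≤ F<x)
          a = ⌊pb⌋ b
          -- u = x ^ ((b + 1) / (a + 1)) and v = u ^ (a / (b + 1)) = x ^ (a / (a + 1)).
          u-root = root a {x ^ suc b} (0≤^ (suc b) 0≤x)
          u = proj₁ u-root
          0≤u = proj₁ (proj₂ u-root)
          u^≈ = proj₂ (proj₂ u-root)
          v-root = root b {u ^ a} (0≤^ a 0≤u)
          v = proj₁ v-root
          0≤v = proj₁ (proj₂ v-root)
          v^≈ = proj₂ (proj₂ v-root)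
          u≤z : u ≤ z
          u≤z = Q.upper (suc b) a 1≤x 0≤u (begin
            fromℕ (suc b)               ≈⟨ trans (sym (*-identityˡ _)) (*-congʳ (sym pq≈1)) ⟩
            p * q * fromℕ (suc b)
              ≈⟨ solve 3 (λ p q B → p :* q :* B := q :* (p :* B)) refl p q (fromℕ (suc b)) ⟩
            q * (p * fromℕ (suc b))     ≤⟨ *-monoˡ-≤ 0≤q (pb≤1+⌊pb⌋ b) ⟩
            q * fromℕ (suc a)           ∎) (≤-reflexive u^≈)
          v≤F : v ≤ F
          v≤F = upper a b 1≤z 0≤v (⌊pb⌋≤pb b) (≤-trans (≤-reflexive v^≈) (^-monoˡ-≤ a 0≤u u≤z))
          v^≈x^ : v ^ suc a ≈ x ^ a
          v^≈x^ = ^-injective b (0≤^ (suc a) 0≤v) (0≤^ a 0≤x) (begin-equality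
            (v ^ suc a) ^ suc b   ≈⟨ ^-comm v (suc a) (suc b) ⟩
            (v ^ suc b) ^ suc a   ≈⟨ ^-congˡ (suc a) v^≈ ⟩
            (u ^ a) ^ suc a       ≈⟨ ^-comm u a (suc a) ⟩
            (u ^ suc a) ^ a       ≈⟨ ^-congˡ a u^≈ ⟩
            (x ^ suc b) ^ a       ≈⟨ ^-comm x (suc b) a ⟩
            (x ^ a) ^ suc b       ∎)
          0<v : 0# < v
          0<v v≤0 = 0<^ a (1≤⇒0< 1≤x) (≤-trans (≤-reflexive (sym v^≈x^)) (≤-resp refl (zeroˡ _) (*-monoʳ-≤ (0≤^ a 0≤v) v≤0)))
          -- The tangent at v of the power a + 1, evaluated at x, where x ^ (a + 1) = x · v ^ (a +
          -- 1). It shows that x - v is of order 1 / (a + 1).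
          scaled : (x - v) * fromℕ (suc a) * v ^ a ≤ (x - 1#) * v * v ^ a
          scaled = begin
            (x - v) * fromℕ (suc a) * v ^ a
              ≈⟨ solve 4 (λ x v A V → (x :- v) :* A :* V := (v :* V :+ A :* (V :* (x :- v))) :- v :* V) refl x v (fromℕ (suc a)) (v ^ a) ⟩
            (v ^ suc a + fromℕ (suc a) * (v ^ a * (x - v))) - v ^ suc a
              ≤⟨ +-monoˡ-≤ _ (^-tangent a 0≤v 0≤x) ⟩
            x * x ^ a - v ^ suc a            ≈⟨ +-congʳ (*-congˡ v^≈x^) ⟨
            x * v ^ suc a - v ^ suc a
              ≈⟨ solve 3 (λ x v V → x :* (v :* V) :- v :* V := (x :- :1) :* v :* V) refl x v (v ^ a) ⟩
            (x - 1#) * v * v ^ a             ∎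

    power-inverse : ∀ {x} → 0# ≤ x → power (power x q) p ≈ x
    power-inverse {x} 0≤x with ≤⊎> x 0#
    ... | inj₁ x≤0 = trans (power-≤0 (≤-reflexive (Q.power-≤0 x≤0))) (antisym 0≤x x≤0)
    ... | inj₂ 0<x =
      let X , Y , 1≤X , 1≤Y , xY≈X = ratio 0<x
      in *-cancelʳ (1≤⇒0< 1≤Y) (begin-equality
        power (power x q) p * Y                            ≈⟨ *-congˡ (power≥1-inverse 1≤Y) ⟨
        power (power x q) p * power≥1 (power≥1 Y q) p
          ≈⟨ power-ratio (Q.0<power 0<x) (Q.1≤power≥1 1≤X) (Q.1≤power≥1 1≤Y)
                                                                (Q.power-ratio 0<x 1≤X 1≤Y xY≈X) ⟩
        power≥1 (power≥1 X q) p                            ≈⟨ power≥1-inverse 1≤X ⟩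
        X                                                  ≈⟨ xY≈X ⟨
        x * Y                                              ∎)

-- Alternating forms, Cramer's rule and columns of maximal volume.

module ColumnSelection (em : ExcludedMiddle 0ℓ) (𝓡 : CompleteOrderedField) where

  open OrderedField em 𝓡
  open ≤R

  module Forms (X : Set) where

    Form : ℕ → Set
    Form r = Vec X r → ℝ

    -- The exterior product φ ∧ ω: the alternating sum over the arguments, one going to φ and the
    -- others to ω. The recursion is the contraction rule ι x (φ ∧ ω) = φ x · ω - φ ∧ ι x ω.
    wedge : ∀ {r} → (X → ℝ) → Form r → Form (suc r)
    wedge {zero}  φ ω (x ∷ J) = φ x * ω J
    wedge {suc r} φ ω (x ∷ J) = φ x * ω J - wedge φ (λ K → ω (x ∷ K)) J

    -- Only exchanges of neighbours are recorded; `wedge-replace` moves an argument into place one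
    -- position at a time.
    Antisymmetric : ∀ {r} → Form r → Set
    Antisymmetric {zero}        ω = ⊤
    Antisymmetric {suc zero}    ω = ⊤
    Antisymmetric {suc (suc r)} ω =
      (∀ x y J → ω (x ∷ y ∷ J) ≈ - ω (y ∷ x ∷ J)) × (∀ x → Antisymmetric (λ J → ω (x ∷ J)))

    wedge-cong : ∀ {r} φ {ω η : Form r} → (∀ J → ω J ≈ η J) → ∀ J → wedge φ ω J ≈ wedge φ η J
    wedge-cong {zero}  φ ω≈η (x ∷ J) = *-congˡ (ω≈η J)
    wedge-cong {suc r} φ ω≈η (x ∷ J) = +-cong (*-congˡ (ω≈η J)) (-‿cong (wedge-cong φ (ω≈η ∘ (x ∷_)) J))

    wedge-linear : ∀ {r} φ c (ω η : Form r) J →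
                   wedge φ (λ K → c * ω K - η K) J ≈ c * wedge φ ω J - wedge φ η J
    wedge-linear {zero}  φ c ω η (x ∷ J) =
      solve 4 (λ p c u v → p :* (c :* u :- v) := c :* (p :* u) :- p :* v) refl (φ x) c (ω J) (η J)
    wedge-linear {suc r} φ c ω η (x ∷ J) = trans
      (+-congˡ (-‿cong (wedge-linear φ c (ω ∘ (x ∷_)) (η ∘ (x ∷_)) J)))
      (solve 6 (λ p c u v s t → p :* (c :* u :- v) :- (c :* s :- t) := c :* (p :* u :- s) :- (p :* v :- t))
        refl (φ x) c (ω J) (η J) _ _)

    wedge-neg : ∀ {r} φ (ω : Form r) J → wedge φ (λ K → - ω K) J ≈ - wedge φ ω J
    wedge-neg {zero}  φ ω (x ∷ J) = solve 2 (λ p u → p :* (:- u) := :- (p :* u)) refl (φ x) (ω J)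
    wedge-neg {suc r} φ ω (x ∷ J) = trans (+-congˡ (-‿cong (wedge-neg φ (ω ∘ (x ∷_)) J)))
      (solve 3 (λ p u s → p :* (:- u) :- (:- s) := :- (p :* u :- s)) refl (φ x) (ω J) _)

    wedge-0 : ∀ {r} φ {ω : Form r} → (∀ J → ω J ≈ 0#) → ∀ J → wedge φ ω J ≈ 0#
    wedge-0 {zero}  φ ω≈0 (x ∷ J) = trans (*-congˡ (ω≈0 J)) (zeroʳ _)
    wedge-0 {suc r} φ ω≈0 (x ∷ J) = trans
      (+-cong (trans (*-congˡ (ω≈0 J)) (zeroʳ _)) (-‿cong (wedge-0 φ (ω≈0 ∘ (x ∷_)) J)))
      (-‿inverseʳ 0#)

    antisymmetric-linear : ∀ {r} c {ω η : Form r} → Antisymmetric ω → Antisymmetric η →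
                           Antisymmetric (λ J → c * ω J - η J)
    antisymmetric-linear {zero}        c _       _       = tt
    antisymmetric-linear {suc zero}    c _       _       = tt
    antisymmetric-linear {suc (suc r)} c {ω} {η} (s , a) (t , b) =
      (λ x y J → trans (+-cong (*-congˡ (s x y J)) (-‿cong (t x y J)))
        (solve 3 (λ c u v → c :* (:- u) :- (:- v) := :- (c :* u :- v)) refl c _ _)) ,
      (λ x → antisymmetric-linear c {ω ∘ (x ∷_)} {η ∘ (x ∷_)} (a x) (b x))

    -- With its first argument fixed at x, the wedge is φ x · ω minus a wedge of lower degree, a
    -- combination of antisymmetric forms.
    wedge-antisymmetric : ∀ {r} φ {ω : Form r} → Antisymmetric ω → Antisymmetric (wedge φ ω)
    wedge-antisymmetric {zero}        φ _       = tt
    wedge-antisymmetric {suc zero}    φ _       =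
      (λ x y J → solve 2 (λ u v → u :- v := :- (v :- u)) refl _ _) , λ _ → tt
    wedge-antisymmetric {suc (suc r)} φ {ω} (s , a) =
      (λ x y J → trans
        (+-congˡ (-‿cong (+-congˡ (-‿cong (trans (wedge-cong φ (s x y) J) (wedge-neg φ (λ K → ω (y ∷ x ∷ K)) J))))))
        (solve 3 (λ u v w → u :- (v :- (:- w)) := :- (v :- (u :- w))) refl _ _ _)) ,
      (λ x → antisymmetric-linear (φ x) {ω} {wedge φ (ω ∘ (x ∷_))} (s , a) (wedge-antisymmetric φ (a x)))

    -- Contract both sides with the first argument and expand by linearity. With φ = ψ it shows that
    -- wedging twice by the same φ gives 0.
    wedge-swap : ∀ {r} φ ψ (ω : Form r) J → wedge φ (wedge ψ ω) J ≈ - wedge ψ (wedge φ ω) J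
    wedge-swap {zero}  φ ψ ω (x ∷ y ∷ J) =
      solve 5 (λ p q s t w → p :* (s :* w) :- q :* (t :* w) := :- (t :* (q :* w) :- s :* (p :* w))) refl
        (φ x) (φ y) (ψ y) (ψ x) (ω J)
    wedge-swap {suc r} φ ψ ω (x ∷ J) = begin-equality
      φ x * wedge ψ ω J - wedge φ (λ K → ψ x * ω K - wedge ψ (ω ∘ (x ∷_)) K) J
        ≈⟨ +-congˡ (-‿cong (wedge-linear φ (ψ x) ω _ J)) ⟩
      φ x * wedge ψ ω J - (ψ x * wedge φ ω J - wedge φ (wedge ψ (ω ∘ (x ∷_))) J)
        ≈⟨ +-congˡ (-‿cong (+-congˡ (-‿cong (wedge-swap φ ψ (ω ∘ (x ∷_)) J)))) ⟩
      φ x * wedge ψ ω J - (ψ x * wedge φ ω J - - wedge ψ (wedge φ (ω ∘ (x ∷_))) J)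
        ≈⟨ solve 3 (λ u v w → u :- (v :- (:- w)) := :- (v :- (u :- w))) refl _ _ _ ⟩
      - (ψ x * wedge φ ω J - (φ x * wedge ψ ω J - wedge ψ (wedge φ (ω ∘ (x ∷_))) J))
        ≈⟨ -‿cong (+-congˡ (-‿cong (wedge-linear ψ (φ x) ω _ J))) ⟨
      - (ψ x * wedge φ ω J - wedge ψ (λ K → φ x * ω K - wedge φ (ω ∘ (x ∷_)) K) J) ∎

    -- The l-th term omits `lookup J l` and has x in front; moving x into the gap costs exactly the
    -- sign of that term.
    wedge-replace : ∀ {r} φ {ω : Form (suc r)} → Antisymmetric ω → ∀ x J →
                    wedge φ (λ K → ω (x ∷ K)) J ≈ sum λ l → φ (lookup J l) * ω (J [ l ]≔ x)
    wedge-replace {zero}  φ     _       x (y ∷ []) = sym (+-identityʳ _)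
    wedge-replace {suc r} φ {ω} (s , a) x (y ∷ J)  = +-congˡ (begin-equality
      - wedge φ (λ K → ω (x ∷ y ∷ K)) J    ≈⟨ -‿cong (wedge-cong φ (s x y) J) ⟩
      - wedge φ (λ K → - ω (y ∷ x ∷ K)) J  ≈⟨ -‿cong (wedge-neg φ _ J) ⟩
      - - wedge φ (λ K → ω (y ∷ x ∷ K)) J  ≈⟨ -‿involutive _ ⟩
      wedge φ (λ K → ω (y ∷ x ∷ K)) J      ≈⟨ wedge-replace φ (a y) x J ⟩
      (sum λ l → φ (lookup J l) * ω (y ∷ (J [ l ]≔ x)))  ∎)

    -- Cramer's rule: φ ∧ ω = 0 expresses φ x through the values of φ on J.
    cramer : ∀ {r} φ {ω : Form r} → Antisymmetric ω → (∀ K → wedge φ ω K ≈ 0#) → ∀ x J →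
             φ x * ω J ≈ sum λ l → φ (lookup J l) * ω (J [ l ]≔ x)
    cramer {zero}  φ     a vanishing x [] = vanishing (x ∷ [])
    cramer {suc r} φ {ω} a vanishing x J  = begin-equality
      φ x * ω J   ≈⟨ solve 2 (λ u v → u := (u :- v) :+ v) refl _ _ ⟩
      wedge φ ω (x ∷ J) + wedge φ (λ K → ω (x ∷ K)) J
        ≈⟨ +-cong (vanishing (x ∷ J)) (wedge-replace φ a x J) ⟩
      0# + (sum λ l → φ (lookup J l) * ω (J [ l ]≔ x)) ≈⟨ +-identityˡ _ ⟩
      (sum λ l → φ (lookup J l) * ω (J [ l ]≔ x))      ∎

    -- What solving by Cramer's rule takes: `maximal` is its hypothesis for every φ i, and `nonzero`
    -- ensures a nonzero value to divide by.
    record MaximalForm {k} (φ : Fin k → X → ℝ) : Set where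
      field
        {degree}      : ℕ
        degree≤       : degree ℕ.≤ k
        form          : Form degree
        antisymmetric : Antisymmetric form
        support       : Vec X degree
        nonzero       : ¬ (form support ≈ 0#)
        maximal       : ∀ i J → wedge (φ i) form J ≈ 0#

    -- The wedge of a maximal independent subfamily of φ.
    maximalForm : ∀ {k} (φ : Fin k → X → ℝ) → MaximalForm φ
    maximalForm {zero}  φ = record
      { degree≤       = ℕ.z≤n
      ; form          = λ _ → 1#
      ; antisymmetric = tt
      ; support       = []
      ; nonzero       = λ 1≈0 → 0≉1 (sym 1≈0)
      ; maximal       = λ ()
      }
    maximalForm {suc k} φ with maximalForm (φ ∘ Fin.suc)
    ... | previous with em {∃ λ J → ¬ (wedge (φ Fin.zero) (MaximalForm.form previous) J ≈ 0#)}
    ...   | no vanishing = record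
      { degree≤       = ℕ.m≤n⇒m≤1+n degree≤
      ; form          = form
      ; antisymmetric = antisymmetric
      ; support       = support
      ; nonzero       = nonzero
      ; maximal       = λ { Fin.zero J → vanishing′ J ; (Fin.suc i) J → maximal i J }
      }
      where
      open MaximalForm previous
      vanishing′ : ∀ J → wedge (φ Fin.zero) form J ≈ 0#
      vanishing′ J with em {wedge (φ Fin.zero) form J ≈ 0#}
      ... | yes eq = eq
      ... | no neq = contradiction (J , neq) vanishing
    ...   | yes (J , neq) = record
      { degree≤       = ℕ.s≤s degree≤
      ; form          = wedge (φ Fin.zero) form
      ; antisymmetric = wedge-antisymmetric (φ Fin.zero) antisymmetric
      ; support       = J
      ; nonzero       = neq
      ; maximal       = λ
        { Fin.zero    K → x≈-x⇒x≈0 (wedge-swap (φ Fin.zero) (φ Fin.zero) form K)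
        ; (Fin.suc i) K → trans (wedge-swap (φ (Fin.suc i)) (φ Fin.zero) form K)
            (trans (-‿cong (wedge-0 (φ Fin.zero) (maximal i) K)) -0#≈0#)
        }
      }
      where open MaximalForm previous

  argmax : ∀ {m} (f : Fin m → ℝ) → Fin m → ∃ λ i → ∀ j → f j ≤ f i
  argmax {suc zero}    f _ = Fin.zero , λ { Fin.zero → ≤-refl }
  argmax {suc (suc m)} f _ with argmax (f ∘ Fin.suc) Fin.zero
  ... | i , f≤ with total (f Fin.zero) (f (Fin.suc i))
  ...   | inj₁ le = Fin.suc i , λ { Fin.zero → le ; (Fin.suc j) → f≤ j }
  ...   | inj₂ ge = Fin.zero , λ { Fin.zero → ≤-refl ; (Fin.suc j) → ≤-trans (f≤ j) ge }

  argmax-Vec : ∀ {m r} (f : Vec (Fin m) r → ℝ) → Vec (Fin m) r → ∃ λ I → ∀ J → f J ≤ f I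
  argmax-Vec f []      = [] , λ { [] → ≤-refl }
  argmax-Vec f (x ∷ J) =
    let best    = λ j → argmax-Vec (f ∘ (j ∷_)) J
        i , f≤  = argmax (λ j → f (j ∷ proj₁ (best j))) x
    in i ∷ proj₁ (best i) , λ { (j ∷ K) → ≤-trans (proj₂ (best j) K) (f≤ j) }

  -- An Auerbach basis among the columns of V, each scaled by 1 / w.
  selectColumns : ∀ {k m} (V : Matrix ℝ k m) (w : Vector ℝ m) → (∀ j → 0# < w j) →
    ∃ λ r → r ℕ.≤ k × Σ (Fin r → Fin m) λ J → Σ (Matrix ℝ r m) λ C →
      (∀ i j → V i j ≈ sum λ l → V i (J l) * C l j) ×
      (∀ l j → ∣ C l j ∣ * w (J l) ≤ w j)
  selectColumns {k} {m} V w 0<w = degree , degree≤ , J , C , combination , bound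
    where
    open Forms (Fin m)
    φ : Fin k → Fin m → ℝ
    φ i j = V i j * w j ⁻¹
    open MaximalForm (maximalForm φ)
    best = argmax-Vec (∣_∣ ∘ form) support
    I = proj₁ best
    J = lookup I
    D = form I
    0<∣D∣ : 0# < ∣ D ∣
    0<∣D∣ = <-≤-trans (0<∣x∣ nonzero) (proj₂ best support)
    D≉0 : ¬ (D ≈ 0#)
    D≉0 D≈0 = 0<∣D∣ (≤-reflexive (trans (∣∣-cong D≈0) (0≤x⇒∣x∣≈x ≤-refl)))
    minor : Matrix ℝ degree m
    minor l j = form (I [ l ]≔ j)
    C : Matrix ℝ degree m
    -- The Cramer coefficient of the scaled columns, scaled back. Maximality of D bounds
    -- `minor l j * D ⁻¹` by 1, so only the ratio of the weights is left.
    C l j = minor l j * D ⁻¹ * (w j * w (J l) ⁻¹)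
    combination : ∀ i j → V i j ≈ sum λ l → V i (J l) * C l j
    combination i j = begin-equality
      V i j
        ≈⟨ trans (*-cong (trans (*-congˡ (*-inverseˡ _ (<⇒≉ (0<w j)))) (*-identityʳ _)) (*-inverseʳ D D≉0)) (*-identityʳ _) ⟨
      V i j * (w j ⁻¹ * w j) * (D * D ⁻¹)
        ≈⟨ solve 5 (λ v u w d e → v :* (u :* w) :* (d :* e) := e :* w :* (v :* u :* d)) refl (V i j) (w j ⁻¹) (w j) D (D ⁻¹) ⟩
      D ⁻¹ * w j * (φ i j * D)        ≈⟨ *-congˡ (cramer (φ i) antisymmetric (maximal i) j I) ⟩
      D ⁻¹ * w j * (sum λ l → φ i (J l) * minor l j)
        ≈⟨ *-distribˡ-sum (D ⁻¹ * w j) (λ l → φ i (J l) * minor l j) ⟩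
      (sum λ l → D ⁻¹ * w j * (φ i (J l) * minor l j)) ≈⟨ sum-cong-≋ (λ l →
        solve 5 (λ e w v u a → e :* w :* (v :* u :* a) := v :* (a :* e :* (w :* u))) refl (D ⁻¹) (w j) (V i (J l)) (w (J l) ⁻¹) (minor l j)) ⟩
      (sum λ l → V i (J l) * C l j)   ∎
    ∣minor/D∣≤1 : ∀ l j → ∣ minor l j * D ⁻¹ ∣ ≤ 1#
    ∣minor/D∣≤1 l j = *-cancelʳ-≤ 0<∣D∣ (begin
      ∣ minor l j * D ⁻¹ ∣ * ∣ D ∣    ≈⟨ ∣x*y∣≈∣x∣*∣y∣ _ _ ⟨
      ∣ minor l j * D ⁻¹ * D ∣
        ≈⟨ ∣∣-cong (trans (*-assoc _ _ _) (trans (*-congˡ (*-inverseˡ D D≉0)) (*-identityʳ _))) ⟩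
      ∣ minor l j ∣                   ≤⟨ proj₂ best (I [ l ]≔ j) ⟩
      ∣ D ∣                           ≈⟨ *-identityˡ _ ⟨
      1# * ∣ D ∣                      ∎)
    bound : ∀ l j → ∣ C l j ∣ * w (J l) ≤ w j
    bound l j = begin
      ∣ C l j ∣ * w (J l)                                       ≈⟨ *-congʳ (∣x*y∣≈∣x∣*∣y∣ _ _) ⟩
      ∣ minor l j * D ⁻¹ ∣ * ∣ w j * w (J l) ⁻¹ ∣ * w (J l)
        ≈⟨ trans (*-assoc _ _ _) (*-congˡ (trans (*-congʳ (0≤x⇒∣x∣≈x 0≤ratio)) (trans (*-assoc _ _ _)
                                                                     (trans (*-congˡ (*-inverseˡ _ (<⇒≉ (0<w (J l))))) (*-identityʳ _))))) ⟩
      ∣ minor l j * D ⁻¹ ∣ * w j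
        ≤⟨ *-monoʳ-≤ (<⇒≤ (0<w j)) (∣minor/D∣≤1 l j) ⟩
      1# * w j                                                  ≈⟨ *-identityˡ _ ⟩
      w j                                                       ∎
      where
      0≤ratio : 0# ≤ w j * w (J l) ⁻¹
      0≤ratio = *-nonNegative (<⇒≤ (0<w j)) (<⇒≤ (0<⁻¹ (0<w (J l))))

-- From weighted residuals to norm bounds, for finite p and for p = ∞.

module Norms (em : ExcludedMiddle 0ℓ) (𝓡 : CompleteOrderedField) where

  open OrderedField em 𝓡
  open Powers em 𝓡
  open ConvexPowers em 𝓡
  open ≤R

  -- The residual R of a regression on at most k columns J: for any weights w
  -- of the columns, the coefficients t can be kept below w j / w (J l).
  record WeightedResidual {n m} (k : ℕ) (E : Matrix ℝ n m) (w : Vector ℝ m) (R : Matrix ℝ n m) : Set where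
    field
      {size}   : ℕ
      size≤    : size ℕ.≤ k
      J        : Fin size → Fin m
      t        : Matrix ℝ size m
      0≤t      : ∀ l j → 0# ≤ t l j
      weighted : ∀ l j → t l j * w (J l) ≤ w j
      bounded  : ∀ i j → ∣ R i j ∣ ≤ ∣ E i j ∣ + sum λ l → t l j * ∣ E i (J l) ∣

  -- All that the selection argument uses about p. `norm-select` takes a residual for every choice
  -- of weights, since finite p needs a sequence of weights approaching the column errors; d is a
  -- common lower bound of the norms of these residuals.
  record NormProperties (p : Exponent ℝ) : Set where
    field
      norm-cong    : ∀ {n m} {M N : Matrix ℝ n m} → (∀ i j → ∣ M i j ∣ ≈ ∣ N i j ∣) → norm p M ≈ norm p N
      0≤norm       : ∀ {n m} (M : Matrix ℝ n m) → 0# ≤ norm p M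
      norm-columns : ∀ {n m} (M N : Matrix ℝ n m) →
                     (∀ j → norm p (column (λ i → M i j)) ≤ norm p (column (λ i → N i j))) →
                     norm p M ≤ norm p N
      norm-select  : ∀ {n m} k (E : Matrix ℝ n m) {d} → 0# ≤ d →
                     (∀ w → (∀ j → 0# < w j) → ∃ λ R → d ≤ norm p R × WeightedResidual k E w R) →
                     d ≤ fromℕ (suc k) * norm p E

  module _ {p : ℝ} (1≤p : 1# ≤ p) where

    open Exponent≥1 1≤p
    private
      0<p = 1≤⇒0< 1≤p
      0≤p⁻¹ = <⇒≤ (0<⁻¹ 0<p)
      module P⁻¹ = Base≥1 0≤p⁻¹
    open InverseExponents 1≤p 0≤p⁻¹ (*-inverseʳ p (<⇒≉ 0<p))

    columnPower : ∀ {n m} → Matrix ℝ n m → Vector ℝ m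
    columnPower M j = sum λ i → power ∣ M i j ∣ p

    totalPower : ∀ {n m} → Matrix ℝ n m → ℝ
    totalPower M = sum λ i → sum λ j → power ∣ M i j ∣ p

    0≤columnPower : ∀ {n m} (M : Matrix ℝ n m) j → 0# ≤ columnPower M j
    0≤columnPower M j = 0≤sum λ i → 0≤power ∣ M i j ∣

    0≤totalPower : ∀ {n m} (M : Matrix ℝ n m) → 0# ≤ totalPower M
    0≤totalPower M = 0≤sum λ i → 0≤sum λ j → 0≤power ∣ M i j ∣

    totalPower-columns : ∀ {n m} (M : Matrix ℝ n m) → totalPower M ≈ sum (columnPower M)
    totalPower-columns M = ∑-comm λ i j → power ∣ M i j ∣ p

    norm^p≈totalPower : ∀ {n m} (M : Matrix ℝ n m) → power (norm (finite p) M) p ≈ totalPower M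
    norm^p≈totalPower M = power-inverse (0≤totalPower M)

    0≤finiteNorm : ∀ {n m} (M : Matrix ℝ n m) → 0# ≤ norm (finite p) M
    0≤finiteNorm M = P⁻¹.0≤power (totalPower M)

    totalPower-mono : ∀ {n m n′ m′} (M : Matrix ℝ n m) (N : Matrix ℝ n′ m′) →
                      norm (finite p) M ≤ norm (finite p) N → totalPower M ≤ totalPower N
    totalPower-mono M N h = ≤-resp (norm^p≈totalPower M) (norm^p≈totalPower N) (power-mono-≤ (0≤finiteNorm M) h)

    totalPower-cancel : ∀ {n m n′ m′} (M : Matrix ℝ n m) (N : Matrix ℝ n′ m′) →
                        totalPower M ≤ totalPower N → norm (finite p) M ≤ norm (finite p) N
    totalPower-cancel M N h = power-cancel-≤ (0≤finiteNorm N) (≤-resp (sym (norm^p≈totalPower M)) (sym (norm^p≈totalPower N)) h)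

    -- `power-mean` is applied in each row to the N = `size` + 1 terms of the bound. Summed over the
    -- rows, each term contributes at most the p-th power of w j, because t l j times w (J l) is at
    -- most w j. The N equal contributions cancel the factor N on the left.
    columnPower-select : ∀ {n m k} {E : Matrix ℝ n m} {w R} → WeightedResidual k E w R →
                         (∀ j → 0# < w j) → (∀ j → columnPower E j ≤ power (w j) p) →
                         ∀ j → columnPower R j ≤ power (fromℕ (suc k)) p * power (w j) p
    columnPower-select {n} {m} {k} {E} {w} {R} residual 0<w E≤w j = ≤-trans
      (*-cancelʳ-≤ (0<fromℕ-suc size) (begin
        columnPower R j * N                                            ≈⟨ *-comm _ N ⟩
        N * columnPower R j
          ≤⟨ *-monoˡ-≤ (0≤fromℕ (suc size)) (sum-mono-≤ λ i → power-mono-≤ (0≤∣x∣ (R i j)) (bounded i j)) ⟩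
        N * (sum λ i → power (sum (T i)) p)
          ≈⟨ *-distribˡ-sum N (λ i → power (sum (T i)) p) ⟩
        (sum λ i → N * power (sum (T i)) p)
          ≤⟨ sum-mono-≤ (λ i → power-mean (T i) (0≤T i)) ⟩
        (sum λ i → power N p * sum λ l → power (T i l) p)
          ≈⟨ *-distribˡ-sum (power N p) (λ i → sum λ l → power (T i l) p) ⟨
        power N p * (sum λ i → sum λ l → power (T i l) p)
          ≈⟨ *-congˡ (∑-comm λ i l → power (T i l) p) ⟩
        power N p * (sum λ l → sum λ i → power (T i l) p)
          ≤⟨ *-monoˡ-≤ (0≤power N) (sum-mono-≤ term) ⟩
        power N p * sum {suc size} (λ _ → power (w j) p)
          ≈⟨ *-congˡ (sum-const (suc size) (power (w j) p)) ⟩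
        power N p * (N * power (w j) p)
          ≈⟨ solve 3 (λ a b c → a :* (b :* c) := a :* c :* b) refl _ _ _ ⟩
        power N p * power (w j) p * N                                  ∎))
      (*-monoʳ-≤ (0≤power (w j)) (power-mono-≤ (0≤fromℕ (suc size)) (fromℕ-mono-≤ (ℕ.s≤s size≤))))
      where
      open WeightedResidual residual
      N = fromℕ (suc size)
      T : Fin n → Vector ℝ (suc size)
      T i Fin.zero    = ∣ E i j ∣
      T i (Fin.suc l) = t l j * ∣ E i (J l) ∣
      0≤T : ∀ i l → 0# ≤ T i l
      0≤T i Fin.zero    = 0≤∣x∣ (E i j)
      0≤T i (Fin.suc l) = *-nonNegative (0≤t l j) (0≤∣x∣ (E i (J l)))
      term : ∀ l → sum (λ i → power (T i l) p) ≤ power (w j) p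
      term Fin.zero    = E≤w j
      term (Fin.suc l) = begin
        (sum λ i → power (t l j * ∣ E i (J l) ∣) p)
          ≈⟨ sum-cong-≋ (λ i → power-* (0≤t l j) (0≤∣x∣ (E i (J l)))) ⟩
        (sum λ i → power (t l j) p * power ∣ E i (J l) ∣ p)
          ≈⟨ *-distribˡ-sum (power (t l j) p) (λ i → power ∣ E i (J l) ∣ p) ⟨
        power (t l j) p * columnPower E (J l)
          ≤⟨ *-monoˡ-≤ (0≤power (t l j)) (E≤w (J l)) ⟩
        power (t l j) p * power (w (J l)) p
          ≈⟨ power-* (0≤t l j) (<⇒≤ (0<w (J l))) ⟨
        power (t l j * w (J l)) p
          ≤⟨ power-mono-≤ (*-nonNegative (0≤t l j) (<⇒≤ (0<w (J l)))) (weighted l j) ⟩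
        power (w j) p                                           ∎

    -- The columns are weighted by their errors, increased by δ since the
    -- weights have to be positive.
    finiteNorm-select : ∀ {n m} k (E : Matrix ℝ n m) {d} → 0# ≤ d →
      (∀ w → (∀ j → 0# < w j) → ∃ λ R → d ≤ norm (finite p) R × WeightedResidual k E w R) →
      d ≤ fromℕ (suc k) * norm (finite p) E
    finiteNorm-select {n} {m} k E {d} 0≤d select = power-cancel-≤ (*-nonNegative (0≤fromℕ (suc k)) (0≤finiteNorm E)) (begin
      power d p
        ≤⟨ ≤-approximate (*-nonNegative (0≤power K) (0≤fromℕ m)) approximate ⟩
      power K p * totalPower E                              ≈⟨ *-congˡ (norm^p≈totalPower E) ⟨
      power K p * power (norm (finite p) E) p
        ≈⟨ power-* (0≤fromℕ (suc k)) (0≤finiteNorm E) ⟨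
      power (K * norm (finite p) E) p                  ∎)
      where
      K = fromℕ (suc k)
      approximate : ∀ δ → 0# < δ → power d p ≤ power K p * totalPower E + power K p * fromℕ m * δ
      approximate δ 0<δ = let R , d≤R , residual = select w 0<w in begin
        power d p                                          ≤⟨ power-mono-≤ 0≤d d≤R ⟩
        power (norm (finite p) R) p
          ≈⟨ trans (norm^p≈totalPower R) (totalPower-columns R) ⟩
        sum (columnPower R)
          ≤⟨ sum-mono-≤ (columnPower-select residual 0<w
                                                                (λ j → ≤-trans (≤-by (<⇒≤ 0<δ) (solve 2 (λ e d → (e :+ d) :- e := d) refl (columnPower E j) δ)) (≤-reflexive (sym (w^p j))))) ⟩
        (sum λ j → power K p * power (w j) p)
          ≈⟨ *-distribˡ-sum (power K p) (λ j → power (w j) p) ⟨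
        power K p * (sum λ j → power (w j) p)              ≈⟨ *-congˡ (sum-cong-≋ w^p) ⟩
        power K p * (sum λ j → columnPower E j + δ)
          ≈⟨ *-congˡ (∑-distrib-+ (columnPower E) (λ _ → δ)) ⟩
        power K p * (sum (columnPower E) + sum {m} (λ _ → δ))
          ≈⟨ *-congˡ (+-cong (sym (totalPower-columns E)) (sum-const m δ)) ⟩
        power K p * (totalPower E + fromℕ m * δ)
          ≈⟨ solve 4 (λ a b c e → a :* (b :+ c :* e) := a :* b :+ a :* c :* e) refl _ _ _ _ ⟩
        power K p * totalPower E + power K p * fromℕ m * δ      ∎
        where
        w : Vector ℝ m
        -- Adding δ before the root is taken makes the p-th powers of the weights sum to
        -- `totalPower E` plus m δ, an error linear in δ.
        w j = power (columnPower E j + δ) (p ⁻¹)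
        0<s+δ : ∀ j → 0# < columnPower E j + δ
        0<s+δ j = 0<+ (0≤columnPower E j) 0<δ
        0<w : ∀ j → 0# < w j
        0<w j = P⁻¹.0<power (0<s+δ j)
        w^p : ∀ j → power (w j) p ≈ columnPower E j + δ
        w^p j = power-inverse (<⇒≤ (0<s+δ j))

    finiteNorm : NormProperties (finite p)
    finiteNorm = record
      { norm-cong    = λ {_} {_} {M} {N} M≈N → P⁻¹.power-cong
                         (sum-cong-≋ λ i → sum-cong-≋ λ j → power-cong (M≈N i j))
      ; 0≤norm       = 0≤finiteNorm
      -- The p-th power of the norm is the sum of those of the columns, so columnwise inequalities
      -- add up.
      ; norm-columns = λ M N h → totalPower-cancel M N (≤-resp (sym (totalPower-columns M)) (sym (totalPower-columns N))
                         (sum-mono-≤ λ j → ≤-resp (single M j) (single N j)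
                           (totalPower-mono (column (λ i → M i j)) (column (λ i → N i j)) (h j))))
      ; norm-select  = finiteNorm-select
      }
      where
      single : ∀ {n m} (M : Matrix ℝ n m) j → totalPower (column (λ i → M i j)) ≈ columnPower M j
      single {n} M j = sum-cong-≋ {n} λ i → +-identityʳ (power ∣ M i j ∣ p)

  maximum-cong : ∀ {n} {x y : Vector ℝ n} → (∀ i → x i ≈ y i) → maximum x ≈ maximum y
  maximum-cong {zero}  x≈y = refl
  maximum-cong {suc n} x≈y = ⊔-cong (x≈y Fin.zero) (maximum-cong (x≈y ∘ Fin.suc))

  x≤maximum : ∀ {n} (x : Vector ℝ n) i → x i ≤ maximum x
  x≤maximum x Fin.zero    = x≤x⊔y _ _
  x≤maximum x (Fin.suc i) = ≤-trans (x≤maximum (x ∘ Fin.suc) i) (x≤y⊔x (x Fin.zero) (maximum (x ∘ Fin.suc)))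

  0≤maximum : ∀ {n} (x : Vector ℝ n) → 0# ≤ maximum x
  0≤maximum {zero}  x = ≤-refl
  0≤maximum {suc n} x = ≤-trans (0≤maximum (x ∘ Fin.suc)) (x≤y⊔x (x Fin.zero) (maximum (x ∘ Fin.suc)))

  maximum-lub : ∀ {n} {x : Vector ℝ n} {u} → 0# ≤ u → (∀ i → x i ≤ u) → maximum x ≤ u
  maximum-lub {zero}  0≤u x≤u = 0≤u
  maximum-lub {suc n} 0≤u x≤u = ⊔-lub (x≤u Fin.zero) (maximum-lub 0≤u (x≤u ∘ Fin.suc))

  infiniteNorm-lub : ∀ {n m} {M : Matrix ℝ n m} {u} → 0# ≤ u → (∀ i j → ∣ M i j ∣ ≤ u) → norm infinite M ≤ u
  infiniteNorm-lub 0≤u M≤u = maximum-lub 0≤u λ i → maximum-lub 0≤u (M≤u i)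

  ∣x∣≤infiniteNorm : ∀ {n m} (M : Matrix ℝ n m) i j → ∣ M i j ∣ ≤ norm infinite M
  ∣x∣≤infiniteNorm M i j = ≤-trans (x≤maximum (λ j → ∣ M i j ∣) j) (x≤maximum (λ i → maximum λ j → ∣ M i j ∣) i)

  0≤infiniteNorm : ∀ {n m} (M : Matrix ℝ n m) → 0# ≤ norm infinite M
  0≤infiniteNorm M = 0≤maximum λ i → maximum λ j → ∣ M i j ∣

  infiniteNorm : NormProperties infinite
  infiniteNorm = record
    { norm-cong    = λ M≈N → maximum-cong λ i → maximum-cong λ j → M≈N i j
    ; 0≤norm       = 0≤infiniteNorm
    ; norm-columns = λ M N h → infiniteNorm-lub (0≤infiniteNorm N) λ i j → begin
        ∣ M i j ∣
          ≤⟨ ∣x∣≤infiniteNorm (column (λ i → M i j)) i Fin.zero ⟩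
        norm infinite (column (λ i → M i j))     ≤⟨ h j ⟩
        norm infinite (column (λ i → N i j))
          ≤⟨ infiniteNorm-lub {M = column (λ i → N i j)} (0≤infiniteNorm N) (λ i _ → ∣x∣≤infiniteNorm N i j) ⟩
        norm infinite N                          ∎
    ; norm-select  = norm-select
    }
    where
    norm-select : ∀ {n m} k (E : Matrix ℝ n m) {d} → 0# ≤ d →
      (∀ w → (∀ j → 0# < w j) → ∃ λ R → d ≤ norm infinite R × WeightedResidual k E w R) →
      d ≤ fromℕ (suc k) * norm infinite E
    norm-select k E {d} 0≤d select = ≤-trans d≤R (infiniteNorm-lub (*-nonNegative (0≤fromℕ (suc k)) 0≤e) λ i j → begin
      ∣ R i j ∣                                              ≤⟨ bounded i j ⟩
      ∣ E i j ∣ + (sum λ l → t l j * ∣ E i (J l) ∣)          ≤⟨ +-mono-≤ (∣x∣≤infiniteNorm E i j)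
        (sum-mono-≤ λ l → *-mono-≤ (0≤t l j) 0≤e (≤-resp (*-identityʳ _) refl (weighted l j)) (∣x∣≤infiniteNorm E i (J l))) ⟩
      e + sum {size} (λ _ → 1# * e)
        ≈⟨ +-cong (sym (*-identityˡ e)) (trans (sum-const size (1# * e)) (*-congˡ (*-identityˡ e))) ⟩
      1# * e + fromℕ size * e                                ≈⟨ distribʳ e 1# (fromℕ size) ⟨
      fromℕ (suc size) * e
        ≤⟨ *-monoʳ-≤ 0≤e (fromℕ-mono-≤ (ℕ.s≤s size≤)) ⟩
      fromℕ (suc k) * e                                      ∎)
      where
      e = norm infinite E
      0≤e = 0≤infiniteNorm E
      -- Unit weights bound all coefficients by 1, and every column of E is bounded by the same e,
      -- so a residual entry is at most (`size` + 1) e.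
      selected = select (λ _ → 1#) (λ _ → 0<1)
      R = proj₁ selected
      d≤R = proj₁ (proj₂ selected)
      open WeightedResidual (proj₂ (proj₂ selected))

  normProperties : ∀ p → 1≤ᵉ p → NormProperties p
  normProperties (finite p) 1≤p = finiteNorm 1≤p
  normProperties infinite   _   = infiniteNorm

-- Subsets of prescribed size containing given indices.

full : ∀ m → Subset m m
full m = record { element = id ; increasing = id }

shift : ∀ {k m} → Subset k m → Subset k (suc m)
shift I = record { element = Fin.suc ∘ Subset.element I ; increasing = λ i<j → ℕ.s≤s (Subset.increasing I i<j) }

include : ∀ {k m} → Subset k m → Subset (suc k) (suc m)
include {k} {m} I = record { element = element′ ; increasing = λ {i} {j} → increasing′ i j }
  where
  element′ : Fin (suc k) → Fin (suc m)
  element′ Fin.zero    = Fin.zero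
  element′ (Fin.suc i) = Fin.suc (Subset.element I i)
  increasing′ : ∀ i j → i Fin.< j → element′ i Fin.< element′ j
  increasing′ Fin.zero    (Fin.suc j) _           = ℕ.s≤s ℕ.z≤n
  increasing′ (Fin.suc i) (Fin.suc j) (ℕ.s≤s i<j) = ℕ.s≤s (Subset.increasing I i<j)

lower : ∀ {m} → List (Fin (suc m)) → List (Fin m)
lower []               = []
lower (Fin.zero  ∷ xs) = lower xs
lower (Fin.suc x ∷ xs) = x ∷ lower xs

length-lower : ∀ {m} (xs : List (Fin (suc m))) → length (lower xs) ℕ.≤ length xs
length-lower []               = ℕ.z≤n
length-lower (Fin.zero  ∷ xs) = ℕ.m≤n⇒m≤1+n (length-lower xs)
length-lower (Fin.suc x ∷ xs) = ℕ.s≤s (length-lower xs)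

suc∈⇒∈lower : ∀ {m} {x : Fin m} {xs} → Fin.suc x ∈ xs → x ∈ lower xs
suc∈⇒∈lower {xs = Fin.zero  ∷ xs} (there x∈)     = suc∈⇒∈lower x∈
suc∈⇒∈lower {xs = Fin.suc y ∷ xs} (here ≡.refl)  = here ≡.refl
suc∈⇒∈lower {xs = Fin.suc y ∷ xs} (there x∈)     = there (suc∈⇒∈lower x∈)

zero∈⇒length-lower : ∀ {m} {xs : List (Fin (suc m))} → Fin.zero ∈ xs → length (lower xs) ℕ.< length xs
zero∈⇒length-lower {xs = Fin.zero  ∷ xs} _          = ℕ.s≤s (length-lower xs)
zero∈⇒length-lower {xs = Fin.suc y ∷ xs} (there 0∈) = ℕ.s≤s (zero∈⇒length-lower 0∈)

-- Index 0 is taken, needed or not, whenever the other indices fit into the remaining places.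
-- Otherwise they fill all the places, so 0 does not occur in the list and is skipped, except when
-- every index must be taken.
subsetContaining : ∀ {k m} → k ℕ.≤ m → (xs : List (Fin m)) → length xs ℕ.≤ k →
                   Σ (Subset k m) λ I → ∀ x → x ∈ xs → ∃ λ l → Subset.element I l ≡ x
subsetContaining {zero}  _           []  _   = record { element = λ () ; increasing = λ {} } , λ _ ()
subsetContaining {suc k} {suc m} (ℕ.s≤s k≤m) xs len with ℕ.≤-<-connex (length (lower xs)) k
... | inj₁ len′ = let I , covers = subsetContaining k≤m (lower xs) len′ in
  include I , λ where
    Fin.zero    _  → Fin.zero , ≡.refl
    (Fin.suc x) x∈ → let l , eq = covers x (suc∈⇒∈lower x∈) in Fin.suc l , ≡.cong Fin.suc eq
... | inj₂ k<len with ℕ.m≤n⇒m<n∨m≡n k≤m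
...   | inj₂ ≡.refl = full (suc m) , λ x _ → x , ≡.refl
...   | inj₁ k<m    = let I , covers = subsetContaining k<m (lower xs) (ℕ.≤-trans (length-lower xs) len) in
  shift I , λ where
    Fin.zero    0∈ → contradiction (ℕ.<-≤-trans (zero∈⇒length-lower 0∈) len) (ℕ.≤⇒≯ k<len)
    (Fin.suc x) x∈ → let l , eq = covers x (suc∈⇒∈lower x∈) in l , ≡.cong Fin.suc eq

-- The approximation factor of the best column subset.

module Approximation (em : ExcludedMiddle 0ℓ) (𝓡 : CompleteOrderedField) where

  open OrderedField em 𝓡
  open ColumnSelection em 𝓡
  open Norms em 𝓡
  open ≤R

  δ : ∀ {n} → Fin n → Fin n → ℝ
  δ Fin.zero    Fin.zero    = 1#
  δ Fin.zero    (Fin.suc _) = 0#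
  δ (Fin.suc _) Fin.zero    = 0#
  δ (Fin.suc i) (Fin.suc j) = δ i j

  sum-0 : ∀ {n} {x : Vector ℝ n} → (∀ i → x i ≈ 0#) → sum x ≈ 0#
  sum-0 {n} x≈0 = trans (sum-cong-≋ x≈0) (trans (sum-const n 0#) (zeroʳ _))

  sum-δ : ∀ {n} (x : Vector ℝ n) i → sum (λ j → x j * δ i j) ≈ x i
  sum-δ x Fin.zero    = trans (+-cong (*-identityʳ _) (sum-0 {x = λ j → x (Fin.suc j) * 0#} λ j → zeroʳ _)) (+-identityʳ _)
  sum-δ x (Fin.suc i) = trans (+-cong (zeroʳ _) (sum-δ (x ∘ Fin.suc) i)) (+-identityˡ _)

  sum-assoc : ∀ {n m} (x : Vector ℝ n) (M : Matrix ℝ n m) (y : Vector ℝ m) →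
              (sum λ i → x i * sum λ j → M i j * y j) ≈ (sum λ j → (sum λ i → x i * M i j) * y j)
  sum-assoc x M y = begin-equality
    (sum λ i → x i * sum λ j → M i j * y j)
      ≈⟨ sum-cong-≋ (λ i → *-distribˡ-sum (x i) (λ j → M i j * y j)) ⟩
    (sum λ i → sum λ j → x i * (M i j * y j))   ≈⟨ ∑-comm (λ i j → x i * (M i j * y j)) ⟩
    (sum λ j → sum λ i → x i * (M i j * y j))
      ≈⟨ sum-cong-≋ (λ j → trans (sum-cong-≋ λ i → sym (*-assoc (x i) (M i j) (y j)))
                                                     (sym (*-distribʳ-sum (y j) (λ i → x i * M i j)))) ⟩
    (sum λ j → (sum λ i → x i * M i j) * y j)   ∎

  ∣x-y∣≈∣y-x∣ : ∀ x y → ∣ x - y ∣ ≈ ∣ y - x ∣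
  ∣x-y∣≈∣y-x∣ x y = trans (sym (∣-x∣≈∣x∣ (x - y))) (∣∣-cong (solve 2 (λ x y → :- (x :- y) := y :- x) refl x y))

  ⊗-cong : ∀ {n k m} {U U′ : Matrix ℝ n k} {V V′ : Matrix ℝ k m} →
           (∀ i l → U i l ≈ U′ i l) → (∀ l j → V l j ≈ V′ l j) → ∀ i j → (U ⊗ V) i j ≈ (U′ ⊗ V′) i j
  ⊗-cong U≈ V≈ i j = sum-cong-≋ λ l → *-cong (U≈ i l) (V≈ l j)

  -- The infimum is the supremum of the lower bounds.
  ⋀-isInfimum : ∀ {S} → ∃ S → (∃ λ u → ∀ x → S x → u ≤ x) → IsInfimum _≤_ S (⋀ S)
  ⋀-isInfimum {S} (x , x∈S) (u , u≤) with em {∃ (IsInfimum _≤_ S)}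
  ... | yes (_ , isInfimum) = isInfimum
  ... | no  none = contradiction (s , (λ y y∈S → least y λ v v≤ → v≤ y y∈S) , upper) none
    where
    supremum = complete (λ v → ∀ y → S y → v ≤ y) (u , u≤) (x , λ v v≤ → v≤ x x∈S)
    s = proj₁ supremum
    upper = proj₁ (proj₂ supremum)
    least = proj₂ (proj₂ supremum)

  module _ {p : Exponent ℝ} (properties : NormProperties p) where

    open NormProperties properties

    norm-≈ : ∀ {n m} {M N : Matrix ℝ n m} → (∀ i j → M i j ≈ N i j) → norm p M ≈ norm p N
    norm-≈ M≈N = norm-cong λ i j → ∣∣-cong (M≈N i j)

    residual-cong : ∀ {n k m} (A : Matrix ℝ n m) {U U′ : Matrix ℝ n k} (V : Matrix ℝ k m) →
                    (∀ i l → U i l ≈ U′ i l) → norm p (A ⊖ U ⊗ V) ≈ norm p (A ⊖ U′ ⊗ V)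
    residual-cong A {U} {U′} V U≈U′ = norm-≈ λ i j → +-congˡ (-‿cong (⊗-cong {V = V} {V} U≈U′ (λ _ _ → refl) i j))

    -- If the columns of V′ are combinations C of those indexed by J, then the
    -- error matrix E = A - U′V′ satisfies A - A_J C = E - E_J C.
    module _ {n k m : ℕ} (k≤m : k ℕ.≤ m) (A : Matrix ℝ n m) (U′ : Matrix ℝ n k) (V′ : Matrix ℝ k m) where

      private E = A ⊖ U′ ⊗ V′

      columnResidual : ∀ w → (∀ j → 0# < w j) →
        ∃ λ I → ∃ λ W → WeightedResidual k E w (A ⊖ A [ I ] ⊗ W)
      columnResidual w 0<w = I , W , record
        { size≤    = r≤k
        ; J        = J
        ; t        = λ l j → ∣ C l j ∣
        ; 0≤t      = λ l j → 0≤∣x∣ (C l j)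
        ; weighted = bound
        ; bounded  = bounded
        }
        where
        selected = selectColumns V′ w 0<w
        r   = proj₁ selected
        r≤k = proj₁ (proj₂ selected)
        J   = proj₁ (proj₂ (proj₂ selected))
        C   = proj₁ (proj₂ (proj₂ (proj₂ selected)))
        combination = proj₁ (proj₂ (proj₂ (proj₂ (proj₂ selected))))
        bound       = proj₂ (proj₂ (proj₂ (proj₂ (proj₂ selected))))
        -- The r ≤ k selected columns are padded to exactly k, the size that the enumeration
        -- examines.
        cover = subsetContaining k≤m (List.tabulate J)
                  (ℕ.≤-trans (ℕ.≤-reflexive (List.length-tabulate J)) r≤k)
        I = proj₁ cover
        position : ∀ l → ∃ λ l′ → Subset.element I l′ ≡ J l
        position l = proj₂ cover (J l) (∈-tabulate⁺ l)
        W : Matrix ℝ k m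
        -- Coefficients move to the positions of their columns in I; rows of columns added as
        -- padding are 0, and coefficients meeting at one position are added.
        W l′ j = sum λ l → δ (proj₁ (position l)) l′ * C l j
        A[I]W : ∀ i j → (A [ I ] ⊗ W) i j ≈ sum λ l → A i (J l) * C l j
        A[I]W i j = begin-equality
          (sum λ l′ → (A [ I ]) i l′ * W l′ j)
            ≈⟨ sum-assoc ((A [ I ]) i) (λ l′ l → δ (proj₁ (position l)) l′) (λ l → C l j) ⟩
          (sum λ l → (sum λ l′ → (A [ I ]) i l′ * δ (proj₁ (position l)) l′) * C l j)
            ≈⟨ sum-cong-≋ (λ l → *-congʳ (trans (sum-δ ((A [ I ]) i) (proj₁ (position l)))
                 (reflexive (≡.cong (A i) (proj₂ (position l)))))) ⟩
          (sum λ l → A i (J l) * C l j)         ∎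
        U′V′ : ∀ i j → (U′ ⊗ V′) i j ≈ sum λ l → (U′ ⊗ V′) i (J l) * C l j
        U′V′ i j = trans (sum-cong-≋ λ h → *-congˡ (combination h j))
          (sum-assoc (U′ i) (λ h l → V′ h (J l)) (λ l → C l j))
        residual : ∀ i j → (A ⊖ A [ I ] ⊗ W) i j ≈ E i j + sum λ l → - C l j * E i (J l)
        residual i j = begin-equality
          A i j - (A [ I ] ⊗ W) i j   ≈⟨ +-congˡ (-‿cong (A[I]W i j)) ⟩
          A i j - X
            ≈⟨ solve 3 (λ a u x → a :- x := (a :- u) :+ (u :- x)) refl (A i j) ((U′ ⊗ V′) i j) X ⟩
          E i j + ((U′ ⊗ V′) i j - X) ≈⟨ +-congˡ (begin-equality
            (U′ ⊗ V′) i j - X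
              ≈⟨ solve 3 (λ u x z → u :- x := (u :+ z) :- (x :+ z)) refl ((U′ ⊗ V′) i j) X Z ⟩
            (U′ ⊗ V′) i j + Z - (X + Z) ≈⟨ +-cong (+-congʳ (U′V′ i j)) (-‿cong X+Z) ⟩
            Y + Z - Y                   ≈⟨ solve 2 (λ y z → (y :+ z) :- y := z) refl Y Z ⟩
            Z                           ∎) ⟩
          E i j + Z                   ∎
          where
          X = sum λ l → A i (J l) * C l j
          Y = sum λ l → (U′ ⊗ V′) i (J l) * C l j
          Z = sum λ l → - C l j * E i (J l)
          X+Z : X + Z ≈ Y
          X+Z = trans (sym (∑-distrib-+ (λ l → A i (J l) * C l j) (λ l → - C l j * E i (J l)))) (sum-cong-≋ λ l →
            solve 3 (λ a c u → a :* c :+ (:- c) :* (a :- u) := u :* c) refl (A i (J l)) (C l j) ((U′ ⊗ V′) i (J l)))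
        bounded : ∀ i j → ∣ (A ⊖ A [ I ] ⊗ W) i j ∣ ≤ ∣ E i j ∣ + sum λ l → ∣ C l j ∣ * ∣ E i (J l) ∣
        bounded i j = begin
          ∣ (A ⊖ A [ I ] ⊗ W) i j ∣                            ≈⟨ ∣∣-cong (residual i j) ⟩
          ∣ E i j + (sum λ l → - C l j * E i (J l)) ∣          ≤⟨ ∣x+y∣≤∣x∣+∣y∣ _ _ ⟩
          ∣ E i j ∣ + ∣ (sum λ l → - C l j * E i (J l)) ∣
            ≤⟨ +-monoʳ-≤ _ (∣sum∣≤sum∣∣ (λ l → - C l j * E i (J l))) ⟩
          ∣ E i j ∣ + (sum λ l → ∣ - C l j * E i (J l) ∣)
            ≈⟨ +-congˡ (sum-cong-≋ λ l → trans (∣x*y∣≈∣x∣*∣y∣ _ _) (*-congʳ (∣-x∣≈∣x∣ (C l j)))) ⟩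
          ∣ E i j ∣ + (sum λ l → ∣ C l j ∣ * ∣ E i (J l) ∣)    ∎

    module _ (solver : RegressionSolver p) where

      open RegressionSolver solver using (minimizing) renaming (solve to regression)

      bestCoefficients : ∀ {n k m} → Matrix ℝ n k → Matrix ℝ n m → Matrix ℝ k m
      bestCoefficients U A l j = regression U (λ i → A i j) l

      -- `norm-columns` reduces the claim to one regression per column, up to the sign of the
      -- residual. The vectors `a` are the columns as a program builds them, known to agree with
      -- those of A only entry by entry.
      columnwise-minimizing : ∀ {n k m} (A : Matrix ℝ n m) (U : Matrix ℝ n k) (V : Matrix ℝ k m)
        (a : ∀ j → Vector ℝ n) → (∀ i j → a j i ≈ A i j) →
        (∀ l j → V l j ≈ regression U (a j) l) →
        ∀ V′ → norm p (A ⊖ U ⊗ V) ≤ norm p (A ⊖ U ⊗ V′)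
      columnwise-minimizing A U V a a≈A V≈ V′ = norm-columns (A ⊖ U ⊗ V) (A ⊖ U ⊗ V′) λ j → begin
        norm p (column λ i → (A ⊖ U ⊗ V) i j)                   ≈⟨ norm-cong (λ i _ → flip V i j) ⟩
        norm p (U ⊗ column (λ l → V l j) ⊖ column (a j))
          ≈⟨ norm-≈ (λ i _ → +-congʳ (sum-cong-≋ λ l → *-congˡ (V≈ l j))) ⟩
        norm p (U ⊗ column (regression U (a j)) ⊖ column (a j))
          ≤⟨ minimizing U (a j) (λ l → V′ l j) ⟩
        norm p (U ⊗ column (λ l → V′ l j) ⊖ column (a j))       ≈⟨ norm-cong (λ i _ → flip V′ i j) ⟨
        norm p (column λ i → (A ⊖ U ⊗ V′) i j)                  ∎
        where
        flip : ∀ W i j → ∣ (A ⊖ U ⊗ W) i j ∣ ≈ ∣ (sum λ l → U i l * W l j) - a j i ∣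
        flip W i j = trans (∣x-y∣≈∣y-x∣ _ _) (∣∣-cong (+-congˡ (-‿cong (sym (a≈A i j)))))

      approximation : ∀ {n k m} → k ℕ.≤ m → (A : Matrix ℝ n m) {U : Matrix ℝ n k} {V : Matrix ℝ k m} →
                      IsEnumerationOutput p A U V → norm p (A ⊖ U ⊗ V) ≤ fromℕ (suc k) * opt k p A
      approximation {n} {k} {m} k≤m A {U} {V} output = begin
        d
          ≈⟨ trans (*-comm K _) (trans (*-assoc _ _ _) (trans (*-congˡ (*-inverseˡ K (<⇒≉ 0<K))) (*-identityʳ d))) ⟨
        K * (d * K ⁻¹)                ≤⟨ *-monoˡ-≤ (<⇒≤ 0<K) (proj₂ infimum (d * K ⁻¹) lowerBound) ⟩
        K * opt k p A                 ∎
        where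
        open IsEnumerationOutput output using (smallest)
        d = norm p (A ⊖ U ⊗ V)
        K = fromℕ (suc k)
        0<K = 0<fromℕ-suc k
        -- `smallest` compares d with minimizers only, so the solver supplies one, W*, for the
        -- subset J; its error is at most that of the coefficients W obtained from the
        -- factorization.
        d≤error : ∀ U′ V′ → d ≤ K * norm p (A ⊖ U′ ⊗ V′)
        d≤error U′ V′ = norm-select k (A ⊖ U′ ⊗ V′) (0≤norm _) λ w 0<w →
          let J , W , residual = columnResidual k≤m A U′ V′ w 0<w
              W* = bestCoefficients (A [ J ]) A
              optimal = columnwise-minimizing A (A [ J ]) W* (λ j i → A i j) (λ _ _ → refl) (λ _ _ → refl)
          in A ⊖ A [ J ] ⊗ W , ≤-trans (smallest J W* optimal) (optimal W) , residual
        infimum : IsInfimum _≤_ (FactorizationError k p A) (opt k p A)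
        infimum = ⋀-isInfimum
          (_ , (λ _ _ → 0#) , (λ _ _ → 0#) , refl)
          (0# , λ { x (U′ , V′ , eq) → ≤-trans (0≤norm _) (≤-reflexive (sym eq)) })
        -- Dividing by K puts one number below all factorization errors, hence below their infimum
        -- `opt`.
        lowerBound : ∀ e → FactorizationError k p A e → d * K ⁻¹ ≤ e
        lowerBound e (U′ , V′ , eq) = *-cancelʳ-≤ 0<K (begin
          d * K ⁻¹ * K
            ≈⟨ trans (*-assoc _ _ _) (trans (*-congˡ (*-inverseˡ K (<⇒≉ 0<K))) (*-identityʳ d)) ⟩
          d                             ≤⟨ d≤error U′ V′ ⟩
          K * norm p (A ⊖ U′ ⊗ V′)      ≈⟨ trans (*-congˡ (sym eq)) (*-comm K e) ⟩
          e * K                         ∎)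

-- Correctness of the enumeration program.

Increasing : ∀ {k m} → Vec (Fin m) k → Set
Increasing v = ∀ {i j} → i Fin.< j → lookup v i Fin.< lookup v j

module Programs (em : ExcludedMiddle 0ℓ) (𝓡 : CompleteOrderedField)
                {p : Exponent (CompleteOrderedField.Carrier 𝓡)} (solver : Real.RegressionSolver em 𝓡 p) where

  open OrderedField em 𝓡
  open Approximation em 𝓡
  open Norms em 𝓡
  open Execution solver

  private variable
    X Y : Set

  result->>= : (q : Prog ℝ X) (f : X → Prog ℝ Y) → result (q >>= f) ≡ result (f (result q))
  result->>= (return x)      f = ≡.refl
  result->>= (tick q)        f = result->>= q f
  result->>= (arith i c)     f = result->>= (c _) f
  result->>= (compare x y c) f = result->>= (c _) f
  result->>= (regress U v c) f = result->>= (c _) f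

  -- Vectors are functions, so agreement is stated entry by entry. For the same reason the lemmas on
  -- `sumᴾ` and `maximumᴾ` accept pointwise equal vectors.
  result-build : ∀ l (f : Fin l → Prog ℝ X) i → result (build l f) i ≡ result (f i)
  result-build {X = X} (suc l) f i = ≡.trans (≡.cong-app unfold i) (cons i)
    where
    unfolded : Vector X (suc l)
    unfolded = result (f Fin.zero) Vector.∷ result (build l (f ∘ Fin.suc))
    unfold : result (build (suc l) f) ≡ unfolded
    unfold = ≡.trans (result->>= (f Fin.zero) _) (result->>= (build l (f ∘ Fin.suc)) _)
    cons : ∀ i → unfolded i ≡ result (f i)
    cons Fin.zero    = ≡.refl
    cons (Fin.suc i) = result-build l (f ∘ Fin.suc) i

  result-build₂ : ∀ {l l′} (f : Fin l → Fin l′ → Prog ℝ X) i j →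
                  result (build l λ i → build l′ (f i)) i j ≡ result (f i j)
  result-build₂ {l = l} {l′} f i j =
    ≡.trans (≡.cong-app (result-build l (λ i → build l′ (f i)) i) j) (result-build l′ (f i) j)

  result-sumᴾ : ∀ {l} (x : Vector ℝ l) {y : Vector ℝ l} → (∀ i → x i ≡ y i) → result (sumᴾ x) ≡ sum y
  result-sumᴾ {zero}  x x≗y = ≡.refl
  result-sumᴾ {suc l} x x≗y = ≡.trans (result->>= (sumᴾ (Vector.tail x)) _)
    (≡.cong₂ _+_ (x≗y Fin.zero) (result-sumᴾ (Vector.tail x) (x≗y ∘ Fin.suc)))

  result-maximumᴾ : ∀ {l} (x : Vector ℝ l) {y : Vector ℝ l} → (∀ i → x i ≡ y i) → result (maximumᴾ x) ≡ maximum y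
  result-maximumᴾ {zero}  x x≗y = ≡.refl
  result-maximumᴾ {suc l} x x≗y = ≡.trans (result->>= (maximumᴾ (Vector.tail x)) _)
    (≡.cong₂ _⊔_ (x≗y Fin.zero) (result-maximumᴾ (Vector.tail x) (x≗y ∘ Fin.suc)))

  result-normᴾ : ∀ {n m} p (M : Matrix ℝ n m) → result (normᴾ p M) ≡ norm p M
  result-normᴾ {n} {m} (finite p) M = ≡.trans (result->>= (build n row) _)
    (≡.trans (result->>= (sumᴾ (result (build n row))) _)
      (≡.cong (λ s → power s (p ⁻¹)) (result-sumᴾ (result (build n row)) λ i →
        ≡.trans (result-build n row i) (≡.trans (result->>= (build m (entry i)) sumᴾ)
          (result-sumᴾ (result (build m (entry i))) (result-build m (entry i)))))))
    where
    entry : Fin n → Fin m → Prog ℝ ℝ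
    entry i j = instr (absᴵ (M i j)) >>= λ a → instr (powᴵ a p)
    row : Fin n → Prog ℝ ℝ
    row i = build m (entry i) >>= sumᴾ
  result-normᴾ {n} {m} infinite M = ≡.trans (result->>= (build n row) maximumᴾ)
    (result-maximumᴾ (result (build n row)) λ i →
      ≡.trans (result-build n row i) (≡.trans (result->>= (build m (entry i)) maximumᴾ)
        (result-maximumᴾ (result (build m (entry i))) (result-build m (entry i)))))
    where
    entry : Fin n → Fin m → Prog ℝ ℝ
    entry i j = instr (absᴵ (M i j))
    row : Fin n → Prog ℝ ℝ
    row i = build m (entry i) >>= maximumᴾ

  result-residualᴾ : ∀ {n k m} (A : Matrix ℝ n m) (U : Matrix ℝ n k) (V : Matrix ℝ k m) i j →
                     result (residualᴾ A U V) i j ≡ (A ⊖ U ⊗ V) i j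
  result-residualᴾ {n} {k} {m} A U V i j = ≡.trans (result-build₂ entry i j)
    (≡.trans (result->>= (products i j) _) (≡.trans (result->>= (sumᴾ (result (products i j))) _)
      (≡.cong (λ s → A i j - s) (result-sumᴾ (result (products i j)) (result-build k (product i j))))))
    where
    product : Fin n → Fin m → Fin k → Prog ℝ ℝ
    product i j l = instr (mulᴵ (U i l) (V l j))
    products : Fin n → Fin m → Prog ℝ (Vector ℝ k)
    products i j = build k (product i j)
    entry : Fin n → Fin m → Prog ℝ ℝ
    entry i j = products i j >>= λ ps → sumᴾ ps >>= λ s → instr (subᴵ (A i j) s)

  result-prependAll : ∀ {k} (x : X) (Is : List (Vec X k)) rest →
                      result (prependAll x Is rest) ≡ List.map (x ∷_) Is ++ rest
  result-prependAll x []       rest = ≡.refl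
  result-prependAll x (I ∷ Is) rest = ≡.trans (result->>= (prependAll x Is rest) _)
    (≡.cong ((x ∷ I) ∷_) (result-prependAll x Is rest))

  sublists : ∀ {X : Set} k → List X → List (Vec X k)
  sublists k xs = result (choose k xs)

  sublists-∷ : ∀ {X : Set} k (x : X) xs →
               sublists (suc k) (x ∷ xs) ≡ List.map (x ∷_) (sublists k xs) ++ sublists (suc k) xs
  sublists-∷ k x xs = ≡.trans (result->>= (choose k xs) _)
    (≡.trans (result->>= (choose (suc k) xs) _) (result-prependAll x (sublists k xs) _))

  sublists-sound : ∀ {m k} {xs : List (Fin m)} {v : Vec (Fin m) k} → AllPairs Fin._<_ xs →
                   v ∈ sublists k xs → (∀ l → lookup v l ∈ xs) × Increasing v
  sublists-sound {k = zero} {v = []} _ _ = (λ ()) , λ { {()} }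
  sublists-sound {k = suc k} {x ∷ xs} {v} (x<xs ∷ ordered) v∈
    with ∈-++⁻ (List.map (x ∷_) (sublists k xs)) (≡.subst (v ∈_) (sublists-∷ k x xs) v∈)
  ... | inj₂ v∈′ = let v⊆xs , increasing = sublists-sound ordered v∈′ in there ∘ v⊆xs , λ {i} {j} → increasing {i} {j}
  ... | inj₁ v∈′ with ∈-map⁻ (x ∷_) v∈′
  ...   | u , u∈ , ≡.refl =
    let u⊆xs , increasing = sublists-sound ordered u∈
    in (λ { Fin.zero → here ≡.refl ; (Fin.suc l) → there (u⊆xs l) }) ,
       (λ { {Fin.zero} {Fin.suc j} _ → All.lookup x<xs (u⊆xs j)
          ; {Fin.suc i} {Fin.suc j} (ℕ.s≤s i<j) → increasing i<j })

  -- Whether v starts with x or further on in the list, its later entries lie strictly above x and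
  -- so are found in the tail.
  sublists-complete : ∀ {m k} {xs : List (Fin m)} {v : Vec (Fin m) k} → AllPairs Fin._<_ xs →
                      (∀ l → lookup v l ∈ xs) → Increasing v → v ∈ sublists k xs
  sublists-complete {k = zero} {v = []} _ _ _ = here ≡.refl
  sublists-complete {k = suc k} {[]} _ v⊆xs _ with () ← v⊆xs Fin.zero
  sublists-complete {k = suc k} {x ∷ xs} {y ∷ u} (x<xs ∷ ordered) v⊆xs increasing =
    ≡.subst ((y ∷ u) ∈_) (≡.sym (sublists-∷ k x xs)) (split (v⊆xs Fin.zero))
    where
    strictlyAbove : ∀ {z} → x Fin.< z → z ∈ x ∷ xs → z ∈ xs
    strictlyAbove x<z (here ≡.refl) = contradiction x<z (ℕ.<-irrefl ≡.refl)
    strictlyAbove x<z (there z∈)    = z∈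
    above : ∀ l → y Fin.< lookup u l
    above l = increasing {Fin.zero} {Fin.suc l} (ℕ.s≤s ℕ.z≤n)
    split : y ∈ x ∷ xs → (y ∷ u) ∈ List.map (x ∷_) (sublists k xs) ++ sublists (suc k) xs
    split (here ≡.refl) = ∈-++⁺ˡ (∈-map⁺ (x ∷_) (sublists-complete ordered
      (λ l → strictlyAbove (above l) (v⊆xs (Fin.suc l))) (λ i<j → increasing (ℕ.s≤s i<j))))
    split (there y∈)    = ∈-++⁺ʳ (List.map (x ∷_) (sublists k xs)) (sublists-complete ordered
      (λ { Fin.zero → y∈ ; (Fin.suc l) → strictlyAbove (ℕ.<-trans (All.lookup x<xs y∈) (above l)) (v⊆xs (Fin.suc l)) })
      (λ {i} {j} → increasing {i} {j}))

  allFin-ordered : ∀ m → AllPairs Fin._<_ (allFin m)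
  allFin-ordered m = AllPairs.tabulate⁺-< id

  result-subsets : ∀ k m → result (subsets k m) ≡ sublists k (allFin m)
  result-subsets k m = result->>= (ticks m) _

  subsets-sound : ∀ {k m} {v : Vec (Fin m) k} → v ∈ result (subsets k m) → Increasing v
  subsets-sound {k} {m} {v} v∈ =
    proj₂ (sublists-sound (allFin-ordered m) (≡.subst (v ∈_) (result-subsets k m) v∈))

  subsets-complete : ∀ {k m} (I : Subset k m) → tabulate (Subset.element I) ∈ result (subsets k m)
  subsets-complete {k} {m} I = ≡.subst (tabulate element ∈_) (≡.sym (result-subsets k m))
    (sublists-complete (allFin-ordered m) (λ l → ∈-allFin _) λ {i} {j} i<j →
      ≡.subst₂ Fin._<_ (≡.sym (Vec.lookup∘tabulate element i)) (≡.sym (Vec.lookup∘tabulate element j)) (increasing i<j))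
    where open Subset I

  record IsEvaluation {n k m} (A : Matrix ℝ n m) (I : Vec (Fin m) k) (c : Candidate {ℝ} n k m) : Set where
    open Candidate c
    field
      d≈norm     : d ≈ norm p (A ⊖ U ⊗ V)
      U≡columns  : ∀ i l → U i l ≡ A i (lookup I l)
      minimizing : ∀ V′ → norm p (A ⊖ U ⊗ V) ≤ norm p (A ⊖ U ⊗ V′)

  evaluation : ∀ {n k m} → NormProperties p → (A : Matrix ℝ n m) (I : Vec (Fin m) k) →
               IsEvaluation A I (result (evaluate p A I))
  evaluation {n} {k} {m} properties A I = ≡.subst (IsEvaluation A I) (≡.sym steps) record
    { d≈norm     = trans (reflexive (result-normᴾ p E)) (norm-≈ properties λ i j → reflexive (result-residualᴾ A U V i j))
    ; U≡columns  = result-build₂ (λ i l → return (A i (lookup I l)))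
    ; minimizing = columnwise-minimizing properties solver A U V a (λ i j → reflexive (result-build n (λ i → return (A i j)) i))
        λ l j → reflexive (≡.trans (result-build₂ (λ l j → return (result regressions j l)) l j)
          (≡.cong-app (≡.trans (result-build m regression j) (result->>= (build n λ i → return (A i j)) _)) l))
    }
    where
    U : Matrix ℝ n k
    U = result (build n λ i → build k λ l → return (A i (lookup I l)))
    a : Fin m → Vector ℝ n
    a j = result (build n λ i → return (A i j))
    regression : Fin m → Prog ℝ (Vector ℝ k)
    regression j = build n (λ i → return (A i j)) >>= λ a → regress U a return
    regressions : Prog ℝ (Vector (Vector ℝ k) m)
    regressions = build m regression
    transpose : Prog ℝ (Matrix ℝ k m)
    transpose = build k λ l → build m λ j → return (result regressions j l)
    V : Matrix ℝ k m
    V = result transpose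
    E : Matrix ℝ n m
    E = result (residualᴾ A U V)
    steps : result (evaluate p A I) ≡ candidate (result (normᴾ p E)) U V
    steps = ≡.trans (result->>= (build n _) _) (≡.trans (result->>= regressions _)
      (≡.trans (result->>= transpose _) (≡.trans (result->>= (residualᴾ A U V) _) (result->>= (normᴾ p E) _))))

  -- The loop invariant of `selectBest`, with Q the subsets examined so far. `evaluated` ties the
  -- candidate to a run of `evaluate`, so that the facts about that run carry over to it.
  record IsBest {n k m} (A : Matrix ℝ n m) (Q : Pred (Vec (Fin m) k) 0ℓ) (c : Candidate {ℝ} n k m) : Set where
    field
      I         : Vec (Fin m) k
      I∈Q       : Q I
      evaluated : c ≡ result (evaluate p A I)
      least     : ∀ J → Q J → Candidate.d c ≤ Candidate.d (result (evaluate p A J))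

  IsBest-resp : ∀ {n k m} {A : Matrix ℝ n m} {Q Q′ : Pred (Vec (Fin m) k) 0ℓ} {c} →
                (∀ J → Q J → Q′ J) → (∀ J → Q′ J → Q J) → IsBest A Q c → IsBest A Q′ c
  IsBest-resp Q⊆Q′ Q′⊆Q best = record
    { I = I ; I∈Q = Q⊆Q′ I I∈Q ; evaluated = evaluated ; least = λ J → least J ∘ Q′⊆Q J }
    where open IsBest best

  selectBest-least : ∀ {n k m} (A : Matrix ℝ n m) (Is : List (Vec (Fin m) k)) {Q best} → IsBest A Q best →
                     IsBest A (λ J → Q J ⊎ J ∈ Is) (result (selectBest p A best Is))
  selectBest-least A []       isBest = IsBest-resp (λ _ → inj₁) (λ { _ (inj₁ q) → q }) isBest
  selectBest-least {n} {k} {m} A (I ∷ Is) {Q} {best} isBest =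
    IsBest-resp
      (λ { _ (inj₁ (inj₁ q)) → inj₁ q ; _ (inj₁ (inj₂ eq)) → inj₂ (here eq) ; _ (inj₂ J∈) → inj₂ (there J∈) })
      (λ { _ (inj₁ q) → inj₁ (inj₁ q) ; _ (inj₂ (here eq)) → inj₁ (inj₂ eq) ; _ (inj₂ (there J∈)) → inj₂ J∈ })
      (≡.subst (IsBest A _) (≡.sym (result->>= (evaluate p A I) _)) (selectBest-least A Is better))
    where
    open IsBest isBest using (I∈Q; evaluated; least)
    new = result (evaluate p A I)
    better : IsBest A (λ J → Q J ⊎ J ≡ I)
      (if does (em {Candidate.d best ≤ Candidate.d new}) then best else new)
    better with em {Candidate.d best ≤ Candidate.d new}
    ... | yes best≤new = record
      { I = IsBest.I isBest ; I∈Q = inj₁ I∈Q ; evaluated = evaluated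
      ; least = λ { J (inj₁ q) → least J q ; J (inj₂ ≡.refl) → best≤new } }
    ... | no  best≰new = record
      { I = I ; I∈Q = inj₂ ≡.refl ; evaluated = ≡.refl
      ; least = λ { J (inj₁ q) → ≤-trans (<⇒≤ best≰new) (least J q) ; J (inj₂ ≡.refl) → ≤-refl } }

  -- Generalizes the result of q while keeping its equation, which allows the case distinction made
  -- inside `enumeration` to be followed.
  result-elim : (q : Prog ℝ X) (f : X → Prog ℝ Y) (P : Pred Y 0ℓ) →
                (∀ x → result q ≡ x → P (result (f x))) → P (result (q >>= f))
  result-elim q f P h = ≡.subst P (≡.sym (result->>= q f)) (h (result q) ≡.refl)

  enumeration-best : ∀ {n k m} (A : Matrix ℝ n m) → Subset k m → ∃ λ c →
    IsBest A (_∈ result (subsets k m)) c ×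
    result (enumeration {ℝ} {n} {k} {m} p A) ≡ (Candidate.U c , Candidate.V c)
  enumeration-best {n} {k} {m} A I₀ = result-elim (subsets k m) _
    (λ UV → ∃ λ c → IsBest A (_∈ result (subsets k m)) c × UV ≡ (Candidate.U c , Candidate.V c)) λ where
    -- The subset I₀ must occur in the list, which excludes the default output of zero matrices.
    []       eq → contradiction (≡.subst (tabulate (Subset.element I₀) ∈_) eq (subsets-complete I₀)) λ ()
    (I ∷ Is) eq → let first = result (evaluate p A I) in
      result (selectBest p A first Is) ,
      IsBest-resp
        (λ { J (inj₁ ≡.refl) → ≡.subst (I ∈_) (≡.sym eq) (here ≡.refl)
           ; J (inj₂ J∈) → ≡.subst (J ∈_) (≡.sym eq) (there J∈) })
        (λ J J∈ → case (≡.subst (J ∈_) eq J∈) of λ { (here ≡.refl) → inj₁ ≡.refl ; (there J∈Is) → inj₂ J∈Is })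
        (selectBest-least A Is {Q = _≡ I} record
          { I = I ; I∈Q = ≡.refl ; evaluated = ≡.refl ; least = λ { J ≡.refl → ≤-refl } }) ,
      ≡.trans (result->>= (evaluate p A I) _) (result->>= (selectBest p A first Is) _)

  enumeration-output : ∀ {n k m} → NormProperties p → k ℕ.≤ m → (A : Matrix ℝ n m) →
    let UV = result (enumeration {ℝ} {n} {k} {m} p A) in IsEnumerationOutput p A (proj₁ UV) (proj₂ UV)
  enumeration-output {n} {k} {m} properties k≤m A =
    ≡.subst (λ UV → IsEnumerationOutput p A (proj₁ UV) (proj₂ UV)) (≡.sym UV≡) record
      { I          = I′
      ; U≈A[I]     = λ i l → reflexive (U≡columns i l)
      ; minimizing = minimizing
      ; smallest   = smallest
      }
    where
    -- By k ≤ m some k-element subset exists: one covering the empty list.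
    I₀ = proj₁ (subsetContaining k≤m [] ℕ.z≤n)
    best = enumeration-best A I₀
    c = proj₁ best
    open IsBest (proj₁ (proj₂ best))
    UV≡ = proj₂ (proj₂ best)
    open IsEvaluation (≡.subst (IsEvaluation A I) (≡.sym evaluated) (evaluation properties A I))
    I′ : Subset k m
    I′ = record { element = lookup I ; increasing = subsets-sound I∈Q }
    smallest : ∀ (J : Subset k m) W →
      (∀ V′ → norm p (A ⊖ A [ J ] ⊗ W) ≤ norm p (A ⊖ A [ J ] ⊗ V′)) →
      norm p (A ⊖ Candidate.U c ⊗ Candidate.V c) ≤ norm p (A ⊖ A [ J ] ⊗ W)
    smallest J W _ = begin
      norm p (A ⊖ Candidate.U c ⊗ Candidate.V c)   ≈⟨ d≈norm ⟨
      Candidate.d c                                ≤⟨ least v (subsets-complete J) ⟩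
      Candidate.d e                                ≈⟨ Evaluation.d≈norm ⟩
      norm p (A ⊖ Candidate.U e ⊗ Candidate.V e)   ≤⟨ Evaluation.minimizing W ⟩
      norm p (A ⊖ Candidate.U e ⊗ W)
        ≈⟨ residual-cong properties A W (λ i l → reflexive
                                                        (≡.trans (Evaluation.U≡columns i l) (≡.cong (A i) (Vec.lookup∘tabulate (Subset.element J) l)))) ⟩
      norm p (A ⊖ A [ J ] ⊗ W)                     ∎
      where
      open ≤R
      v = tabulate (Subset.element J)
      e = result (evaluate p A v)
      module Evaluation = IsEvaluation (evaluation properties A v)

-- Polynomial bounds on the running time.

infixl 6 _⊕_
infixl 7 _⊛_
infixr 8 _⊛^_

-- Polynomials are kept as syntax so that the constants c and d of the final bound are read off a
-- term independent of n, k and m.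
data Polynomial : Set where
  con       : ℕ → Polynomial
  #n #k #m  : Polynomial
  _⊕_ _⊛_   : Polynomial → Polynomial → Polynomial
  _⊛^_      : Polynomial → ℕ → Polynomial

eval : Polynomial → ℕ → ℕ → ℕ → ℕ
eval (con a)  n k m = a
eval #n       n k m = n
eval #k       n k m = k
eval #m       n k m = m
eval (e ⊕ f)  n k m = eval e n k m ℕ.+ eval f n k m
eval (e ⊛ f)  n k m = eval e n k m ℕ.* eval f n k m
eval (e ⊛^ d) n k m = eval e n k m ℕ.^ d

coefficient : Polynomial → ℕ
coefficient (con a)  = a
coefficient #n       = 1
coefficient #k       = 1
coefficient #m       = 1
coefficient (e ⊕ f)  = coefficient e ℕ.+ coefficient f
coefficient (e ⊛ f)  = coefficient e ℕ.* coefficient f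
coefficient (e ⊛^ d) = coefficient e ℕ.^ d

-- An upper bound for the degree: at a sum the degrees are added, which is enough for some exponent
-- to exist.
degree : Polynomial → ℕ
degree (con a)  = 0
degree #n       = 1
degree #k       = 1
degree #m       = 1
degree (e ⊕ f)  = degree e ℕ.+ degree f
degree (e ⊛ f)  = degree e ℕ.+ degree f
degree (e ⊛^ d) = degree e ℕ.* d

^-distribʳ-* : ∀ d a b → (a ℕ.* b) ℕ.^ d ≡ a ℕ.^ d ℕ.* b ℕ.^ d
^-distribʳ-* zero    a b = ≡.refl
^-distribʳ-* (suc d) a b =
  ≡.trans (≡.cong (a ℕ.* b ℕ.*_) (^-distribʳ-* d a b)) (ℕ.[m*n]*[o*p]≡[m*o]*[n*p] a b _ _)

module _ (n k m N : ℕ) (n≤N : n ℕ.≤ N) (k≤N : k ℕ.≤ N) (m≤N : m ℕ.≤ N) (0<N : 0 ℕ.< N) where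

  open ℕ.≤-Reasoning

  ^-mono-exponent : ∀ d e → d ℕ.≤ e → N ℕ.^ d ℕ.≤ N ℕ.^ e
  ^-mono-exponent _ _ = ℕ.^-monoʳ-≤ N {{ℕ.>-nonZero 0<N}}

  variable≤ : ∀ {x} → x ℕ.≤ N → x ℕ.≤ 1 ℕ.* N ℕ.^ 1
  variable≤ x≤N = ℕ.≤-trans x≤N (ℕ.≤-reflexive (≡.sym (≡.trans (ℕ.*-identityˡ (N ℕ.^ 1)) (ℕ.^-identityʳ N))))

  -- One N bounds all three variables. As N is positive, its powers grow with the exponent, which
  -- lifts both summands of a sum to a common monomial.
  eval≤monomial : ∀ e → eval e n k m ℕ.≤ coefficient e ℕ.* N ℕ.^ degree e
  eval≤monomial (con a) = ℕ.≤-reflexive (≡.sym (ℕ.*-identityʳ a))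
  eval≤monomial #n      = variable≤ n≤N
  eval≤monomial #k      = variable≤ k≤N
  eval≤monomial #m      = variable≤ m≤N
  eval≤monomial (e ⊕ f) = begin
    eval e n k m ℕ.+ eval f n k m
      ≤⟨ ℕ.+-mono-≤ (eval≤monomial e) (eval≤monomial f) ⟩
    coefficient e ℕ.* N ℕ.^ degree e ℕ.+ coefficient f ℕ.* N ℕ.^ degree f
      ≤⟨ ℕ.+-mono-≤ (ℕ.*-monoʳ-≤ (coefficient e) (^-mono-exponent (degree e) (degree (e ⊕ f)) (ℕ.m≤m+n _ _)))
                    (ℕ.*-monoʳ-≤ (coefficient f) (^-mono-exponent (degree f) (degree (e ⊕ f)) (ℕ.m≤n+m _ (degree e)))) ⟩
    coefficient e ℕ.* N ℕ.^ degree (e ⊕ f) ℕ.+ coefficient f ℕ.* N ℕ.^ degree (e ⊕ f)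
      ≡⟨ ℕ.*-distribʳ-+ (N ℕ.^ degree (e ⊕ f)) (coefficient e) (coefficient f) ⟨
    coefficient (e ⊕ f) ℕ.* N ℕ.^ degree (e ⊕ f) ∎
  eval≤monomial (e ⊛ f) = begin
    eval e n k m ℕ.* eval f n k m
      ≤⟨ ℕ.*-mono-≤ (eval≤monomial e) (eval≤monomial f) ⟩
    (coefficient e ℕ.* N ℕ.^ degree e) ℕ.* (coefficient f ℕ.* N ℕ.^ degree f)
      ≡⟨ ℕ.[m*n]*[o*p]≡[m*o]*[n*p] (coefficient e) _ _ _ ⟩
    coefficient (e ⊛ f) ℕ.* (N ℕ.^ degree e ℕ.* N ℕ.^ degree f)
      ≡⟨ ≡.cong (coefficient (e ⊛ f) ℕ.*_) (ℕ.^-distribˡ-+-* N (degree e) (degree f)) ⟨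
    coefficient (e ⊛ f) ℕ.* N ℕ.^ degree (e ⊛ f) ∎
  eval≤monomial (e ⊛^ d) = begin
    eval e n k m ℕ.^ d
      ≤⟨ ℕ.^-monoˡ-≤ d (eval≤monomial e) ⟩
    (coefficient e ℕ.* N ℕ.^ degree e) ℕ.^ d
      ≡⟨ ^-distribʳ-* d (coefficient e) (N ℕ.^ degree e) ⟩
    coefficient e ℕ.^ d ℕ.* (N ℕ.^ degree e) ℕ.^ d
      ≡⟨ ≡.cong (coefficient (e ⊛^ d) ℕ.*_) (ℕ.^-*-assoc N (degree e) d) ⟩
    coefficient (e ⊛^ d) ℕ.* N ℕ.^ degree (e ⊛^ d) ∎

module RunningTime (em : ExcludedMiddle 0ℓ) (𝓡 : CompleteOrderedField)
                   {p : Exponent (CompleteOrderedField.Carrier 𝓡)} (solver : Real.RegressionSolver em 𝓡 p) where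

  open Real em 𝓡
  open Execution solver
  open Programs em 𝓡 solver
  open RegressionSolver solver using (cost; polynomial)
  open ℕ.≤-Reasoning

  private variable
    X Y : Set

  time->>= : (q : Prog ℝ X) (f : X → Prog ℝ Y) → time (q >>= f) ≡ time q ℕ.+ time (f (result q))
  time->>= (return x)      f = ≡.refl
  time->>= (tick q)        f = ≡.cong suc (time->>= q f)
  time->>= (arith i c)     f = ≡.cong suc (time->>= (c _) f)
  time->>= (compare x y c) f = ≡.cong suc (time->>= (c _) f)
  time->>= (regress {n} {k} U v c) f =
    ≡.trans (≡.cong (cost n k ℕ.+_) (time->>= (c _) f)) (≡.sym (ℕ.+-assoc (cost n k) _ _))

  time->>=-≤ : ∀ {a b} (q : Prog ℝ X) {f : X → Prog ℝ Y} →
               time q ℕ.≤ a → (∀ x → time (f x) ℕ.≤ b) → time (q >>= f) ℕ.≤ a ℕ.+ b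
  time->>=-≤ q {f} q≤a f≤b = ℕ.≤-trans (ℕ.≤-reflexive (time->>= q f)) (ℕ.+-mono-≤ q≤a (f≤b _))

  -- The additional unit per entry is the `tick` that stores it.
  time-build : ∀ l {f : Fin l → Prog ℝ X} {b} → (∀ i → time (f i) ℕ.≤ b) → time (build l f) ℕ.≤ l ℕ.* suc b
  time-build zero    f≤b = ℕ.z≤n
  time-build (suc l) {f} {b} f≤b = ℕ.≤-trans
    (time->>=-≤ (f Fin.zero) (f≤b Fin.zero) λ x →
      time->>=-≤ (build l (f ∘ Fin.suc)) (time-build l (f≤b ∘ Fin.suc)) λ xs → ℕ.≤-refl)
    (ℕ.≤-reflexive (≡.trans (≡.cong (b ℕ.+_) (ℕ.+-comm (l ℕ.* suc b) 1)) (ℕ.+-suc b (l ℕ.* suc b))))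

  time-sumᴾ : ∀ {l} (x : Vector ℝ l) → time (sumᴾ x) ℕ.≤ suc l
  time-sumᴾ {zero}  x = ℕ.≤-refl
  time-sumᴾ {suc l} x = ℕ.≤-trans (time->>=-≤ (sumᴾ (Vector.tail x)) (time-sumᴾ (Vector.tail x)) λ _ → ℕ.≤-refl)
    (ℕ.≤-reflexive (ℕ.+-comm (suc l) 1))

  time-maximumᴾ : ∀ {l} (x : Vector ℝ l) → time (maximumᴾ x) ℕ.≤ suc l
  time-maximumᴾ {zero}  x = ℕ.≤-refl
  time-maximumᴾ {suc l} x = ℕ.≤-trans (time->>=-≤ (maximumᴾ (Vector.tail x)) (time-maximumᴾ (Vector.tail x)) λ _ → ℕ.≤-refl)
    (ℕ.≤-reflexive (ℕ.+-comm (suc l) 1))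

  -- Each term follows the nesting of its program: `con 1` inside a product is the storing `tick` of
  -- `build`, and `con 0` a final `return`. The bounds then compose without rearrangement.
  normTime residualTime costBound evaluateTime : Polynomial
  normTime = #n ⊛ (con 1 ⊕ (#m ⊛ con 3 ⊕ (con 1 ⊕ #m))) ⊕ ((con 1 ⊕ #n) ⊕ con 2)
  residualTime = #n ⊛ (con 1 ⊕ #m ⊛ (con 1 ⊕ (#k ⊛ con 2 ⊕ ((con 1 ⊕ #k) ⊕ con 1))))
  costBound = con (proj₁ polynomial) ⊛ (#n ⊛ #k) ⊛^ proj₁ (proj₂ polynomial)
  evaluateTime = #n ⊛ (con 1 ⊕ #k ⊛ con 1) ⊕ (#m ⊛ (con 1 ⊕ (#n ⊛ con 1 ⊕ (costBound ⊕ con 0))) ⊕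
    (#k ⊛ (con 1 ⊕ #m ⊛ con 1) ⊕ (residualTime ⊕ (normTime ⊕ con 0))))

  time-normᴾ : ∀ {n m} k p (M : Matrix ℝ n m) → time (normᴾ p M) ℕ.≤ eval normTime n k m
  time-normᴾ {n} {m} k (finite p) M = time->>=-≤ (build n _)
    (time-build n λ i → time->>=-≤ (build m _) (time-build m λ j → ℕ.≤-refl) time-sumᴾ)
    λ rows → time->>=-≤ (sumᴾ rows) (time-sumᴾ rows) λ _ → ℕ.≤-refl
  time-normᴾ {n} {m} k infinite M = time->>=-≤ (build n _)
    (time-build n λ i → time->>=-≤ (build m _) (time-build m λ j → ℕ.s≤s ℕ.z≤n) time-maximumᴾ)
    λ rows → ℕ.≤-trans (time-maximumᴾ rows) (ℕ.m≤m+n _ 2)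

  module _ {n k m : ℕ} (1≤n : 1 ℕ.≤ n) (1≤k : 1 ℕ.≤ k) (A : Matrix ℝ n m) where

    time-residualᴾ : ∀ (U : Matrix ℝ n k) V → time (residualᴾ A U V) ℕ.≤ eval residualTime n k m
    time-residualᴾ U V = time-build n λ i → time-build m λ j →
      time->>=-≤ (build k _) (time-build k λ l → ℕ.≤-refl) λ ps →
      time->>=-≤ (sumᴾ ps) (time-sumᴾ ps) λ _ → ℕ.≤-refl

    time-evaluate : ∀ I → time (evaluate p A I) ℕ.≤ eval evaluateTime n k m
    time-evaluate I =
      time->>=-≤ (build n _) (time-build n λ i → time-build k λ l → ℕ.z≤n) λ U →
      time->>=-≤ (build m _) (time-build m λ j → time->>=-≤ (build n _) (time-build n λ i → ℕ.z≤n) λ a →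
        ℕ.+-monoˡ-≤ 0 (proj₂ (proj₂ polynomial) n k 1≤n 1≤k)) λ cols →
      time->>=-≤ (build k _) (time-build k λ l → time-build m λ j → ℕ.z≤n) λ V →
      time->>=-≤ (residualᴾ A U V) (time-residualᴾ U V) λ E →
      time->>=-≤ (normᴾ p E) (time-normᴾ k p E) λ d → ℕ.z≤n

    private
      T = eval evaluateTime n k m

    time-selectBest : ∀ best Is → time (selectBest p A best Is) ℕ.≤ length Is ℕ.* suc T
    time-selectBest best []       = ℕ.z≤n
    time-selectBest best (I ∷ Is) = ℕ.≤-trans
      (time->>=-≤ (evaluate p A I) (time-evaluate I) λ new → ℕ.s≤s (time-selectBest _ Is))
      (ℕ.≤-reflexive (ℕ.+-suc T _))

  time-ticks : ∀ l → time {⊤} (ticks l) ≡ l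
  time-ticks zero    = ≡.refl
  time-ticks (suc l) = ≡.cong suc (time-ticks l)

  -- Pascal's rule gives at most Mᵏ + M · Mᵏ sublists, which is (M + 1) Mᵏ.
  length-sublists : ∀ {X : Set} k (xs : List X) → length (sublists k xs) ℕ.≤ length xs ℕ.^ k
  length-sublists zero    xs       = ℕ.≤-refl
  length-sublists (suc k) []       = ℕ.z≤n
  length-sublists (suc k) (x ∷ xs) = begin
    length (sublists (suc k) (x ∷ xs))
      ≡⟨ ≡.cong length (sublists-∷ k x xs) ⟩
    length (List.map (x ∷_) (sublists k xs) ++ sublists (suc k) xs)
      ≡⟨ List.length-++ (List.map (x ∷_) (sublists k xs)) ⟩
    length (List.map (x ∷_) (sublists k xs)) ℕ.+ length (sublists (suc k) xs)
      ≡⟨ ≡.cong (ℕ._+ length (sublists (suc k) xs)) (List.length-map (x ∷_) (sublists k xs)) ⟩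
    length (sublists k xs) ℕ.+ length (sublists (suc k) xs)
      ≤⟨ ℕ.+-mono-≤ (length-sublists k xs) (length-sublists (suc k) xs) ⟩
    suc M ℕ.* M ℕ.^ k
      ≤⟨ ℕ.*-monoʳ-≤ (suc M) (ℕ.^-monoˡ-≤ k (ℕ.n≤1+n M)) ⟩
    suc M ℕ.^ suc k                                              ∎
    where
    M = length xs

  time-prependAll : ∀ {k} (x : X) (Is : List (Vec X k)) rest → time (prependAll x Is rest) ≡ length Is
  time-prependAll x []       rest = ≡.refl
  time-prependAll x (I ∷ Is) rest = ≡.trans (time->>= (prependAll x Is rest) _)
    (≡.trans (≡.cong (ℕ._+ 1) (time-prependAll x Is rest)) (ℕ.+-comm _ 1))

  -- The factor 3 pays for `A + 1 + 1`: prepending to at most A lists, and two of the three units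
  -- that come from the recursive calls and the `tick`. The third unit is the leading 1.
  time-choose : ∀ {X : Set} k (xs : List X) → time (choose k xs) ℕ.≤ 1 ℕ.+ 3 ℕ.* k ℕ.* length xs ℕ.^ k
  time-choose zero    xs       = ℕ.≤-refl
  time-choose (suc k) []       = ℕ.s≤s ℕ.z≤n
  time-choose (suc k) (x ∷ xs) = begin
    time (choose (suc k) (x ∷ xs))
      ≡⟨ ≡.trans (time->>= (choose k xs) _) (≡.cong (time (choose k xs) ℕ.+_)
           (≡.trans (time->>= (choose (suc k) xs) _) (≡.cong (λ t → time (choose (suc k) xs) ℕ.+ suc t)
             (time-prependAll x (sublists k xs) (sublists (suc k) xs))))) ⟩
    time (choose k xs) ℕ.+ (time (choose (suc k) xs) ℕ.+ suc (length (sublists k xs)))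
      ≤⟨ ℕ.+-mono-≤ (time-choose k xs) (ℕ.+-mono-≤ (time-choose (suc k) xs) (ℕ.s≤s (length-sublists k xs))) ⟩
    1 ℕ.+ 3 ℕ.* k ℕ.* A ℕ.+ (1 ℕ.+ 3 ℕ.* suc k ℕ.* (M ℕ.* A) ℕ.+ suc A)
      ≡⟨ lhs k M A ⟩
    1 ℕ.+ (3 ℕ.* k ℕ.* A ℕ.+ (A ℕ.+ 1 ℕ.+ 1) ℕ.+ 3 ℕ.* suc k ℕ.* (M ℕ.* A))
      ≤⟨ ℕ.s≤s (ℕ.+-mono-≤ (ℕ.+-mono-≤ (ℕ.*-monoʳ-≤ (3 ℕ.* k) A≤B) (ℕ.+-mono-≤ (ℕ.+-mono-≤ A≤B 1≤B) 1≤B))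
                   (ℕ.*-monoʳ-≤ (3 ℕ.* suc k) (ℕ.*-monoʳ-≤ M A≤B))) ⟩
    1 ℕ.+ (3 ℕ.* k ℕ.* B ℕ.+ (B ℕ.+ B ℕ.+ B) ℕ.+ 3 ℕ.* suc k ℕ.* (M ℕ.* B))
      ≡⟨ rhs k M B ⟩
    1 ℕ.+ 3 ℕ.* suc k ℕ.* suc M ℕ.^ suc k ∎
    where
    M = length xs
    A = M ℕ.^ k
    B = suc M ℕ.^ k
    A≤B : A ℕ.≤ B
    A≤B = ℕ.^-monoˡ-≤ k (ℕ.n≤1+n M)
    1≤B : 1 ℕ.≤ B
    1≤B = ℕ.m^n>0 (suc M) k
    lhs : ∀ k M A → 1 ℕ.+ 3 ℕ.* k ℕ.* A ℕ.+ (1 ℕ.+ 3 ℕ.* suc k ℕ.* (M ℕ.* A) ℕ.+ suc A) ≡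
                    1 ℕ.+ (3 ℕ.* k ℕ.* A ℕ.+ (A ℕ.+ 1 ℕ.+ 1) ℕ.+ 3 ℕ.* suc k ℕ.* (M ℕ.* A))
    lhs = ℕSolver.solve-∀
    rhs : ∀ k M B → 1 ℕ.+ (3 ℕ.* k ℕ.* B ℕ.+ (B ℕ.+ B ℕ.+ B) ℕ.+ 3 ℕ.* suc k ℕ.* (M ℕ.* B)) ≡
                    1 ℕ.+ 3 ℕ.* suc k ℕ.* (suc M ℕ.* B)
    rhs = ℕSolver.solve-∀

  enumerationTime : Polynomial
  enumerationTime = #m ⊕ (con 1 ⊕ con 3 ⊛ #k) ⊕ (con 1 ⊕ evaluateTime)

  time-subsets : ∀ k m → time (subsets k m) ℕ.≤ m ℕ.+ (1 ℕ.+ 3 ℕ.* k ℕ.* m ℕ.^ k)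
  time-subsets k m = ≡.subst (λ l → time (subsets k m) ℕ.≤ m ℕ.+ (1 ℕ.+ 3 ℕ.* k ℕ.* l ℕ.^ k)) (List.length-tabulate {n = m} id)
    (time->>=-≤ (ticks m) (ℕ.≤-reflexive (time-ticks m)) λ _ → time-choose k (allFin m))

  length-subsets : ∀ k m → length (result (subsets k m)) ℕ.≤ m ℕ.^ k
  length-subsets k m = begin
    length (result (subsets k m))   ≡⟨ ≡.cong length (result-subsets k m) ⟩
    length (sublists k (allFin m))  ≤⟨ length-sublists k (allFin m) ⟩
    length (allFin m) ℕ.^ k         ≡⟨ ≡.cong (ℕ._^ k) (List.length-tabulate {n = m} id) ⟩
    m ℕ.^ k                         ∎

  time-enumeration : ∀ {n k m} → 1 ℕ.≤ n → 1 ℕ.≤ k → 1 ℕ.≤ m → (A : Matrix ℝ n m) →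
                     time (enumeration {ℝ} {n} {k} {m} p A) ℕ.≤ m ℕ.^ k ℕ.* eval enumerationTime n k m
  time-enumeration {n} {k} {m} 1≤n 1≤k 1≤m A = begin
    time (enumeration {ℝ} {n} {k} {m} p A)                              ≤⟨ total ⟩
    m ℕ.+ (1 ℕ.+ 3 ℕ.* k ℕ.* M) ℕ.+ M ℕ.* suc T                         ≡⟨ split m k M T ⟩
    1 ℕ.* (m ℕ.+ 1) ℕ.+ M ℕ.* (3 ℕ.* k ℕ.+ suc T)
      ≤⟨ ℕ.+-monoˡ-≤ _ (ℕ.*-monoˡ-≤ (m ℕ.+ 1) 1≤M) ⟩
    M ℕ.* (m ℕ.+ 1) ℕ.+ M ℕ.* (3 ℕ.* k ℕ.+ suc T)                       ≡⟨ join m k M T ⟩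
    M ℕ.* (m ℕ.+ (1 ℕ.+ 3 ℕ.* k) ℕ.+ (1 ℕ.+ T))                         ∎
    where
    M = m ℕ.^ k
    T = eval evaluateTime n k m
    -- Absorbs the summand m + 1, the part of the cost of listing the subsets that lacks the factor
    -- `m ^ k`.
    1≤M : 1 ℕ.≤ M
    1≤M = ℕ.m^n>0 m {{ℕ.>-nonZero 1≤m}} k
    split : ∀ m k M T → m ℕ.+ (1 ℕ.+ 3 ℕ.* k ℕ.* M) ℕ.+ M ℕ.* suc T ≡ 1 ℕ.* (m ℕ.+ 1) ℕ.+ M ℕ.* (3 ℕ.* k ℕ.+ suc T)
    split = ℕSolver.solve-∀
    join : ∀ m k M T → M ℕ.* (m ℕ.+ 1) ℕ.+ M ℕ.* (3 ℕ.* k ℕ.+ suc T) ≡ M ℕ.* (m ℕ.+ (1 ℕ.+ 3 ℕ.* k) ℕ.+ (1 ℕ.+ T))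
    join = ℕSolver.solve-∀
    time-elim : (q : Prog ℝ X) (f : X → Prog ℝ Y) {b : ℕ} → (∀ x → result q ≡ x → time (f x) ℕ.≤ b) →
                time (q >>= f) ℕ.≤ time q ℕ.+ b
    time-elim q f h = ℕ.≤-trans (ℕ.≤-reflexive (time->>= q f)) (ℕ.+-monoʳ-≤ (time q) (h (result q) ≡.refl))
    total : time (enumeration {ℝ} {n} {k} {m} p A) ℕ.≤ m ℕ.+ (1 ℕ.+ 3 ℕ.* k ℕ.* M) ℕ.+ M ℕ.* suc T
    total = ℕ.≤-trans
      (time-elim (subsets k m) _ λ where
        []       eq → ℕ.*-mono-≤ 1≤M (ℕ.s≤s (ℕ.z≤n {T}))
        (I ∷ Is) eq → begin
          time (evaluate p A I >>= _)
            ≤⟨ time->>=-≤ (evaluate p A I) (time-evaluate 1≤n 1≤k A I) (λ first →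
                                                  time->>=-≤ (selectBest p A first Is) (time-selectBest 1≤n 1≤k A first Is) λ _ → ℕ.z≤n {0}) ⟩
          T ℕ.+ (length Is ℕ.* suc T ℕ.+ 0)
            ≤⟨ ℕ.+-mono-≤ (ℕ.n≤1+n T) (ℕ.≤-reflexive (ℕ.+-identityʳ _)) ⟩
          length (I ∷ Is) ℕ.* suc T
            ≤⟨ ℕ.*-monoˡ-≤ (suc T) (≡.subst (λ L → length L ℕ.≤ M) eq (length-subsets k m)) ⟩
          M ℕ.* suc T                        ∎)
      (ℕ.+-monoˡ-≤ (M ℕ.* suc T) (time-subsets k m))

theorem4 :
    (em : ExcludedMiddle 0ℓ) (𝓡 : CompleteOrderedField) →
    let open Real em 𝓡 in
    (p : Exponent ℝ) → 1≤ᵉ p → (solver : RegressionSolver p) →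
    let open Execution solver in
    ∃₂ λ c d →
    ∀ (n k m : ℕ) → 1 ℕ.≤ k → k ℕ.≤ m → m ℕ.≤ n → (A : Matrix ℝ n m) →
    let algorithm = enumeration {ℝ} {n} {k} {m} p A
        U = proj₁ (result algorithm)
        V = proj₂ (result algorithm)
    in
    (time algorithm ℕ.≤ m ℕ.^ k ℕ.* (c ℕ.* (n ℕ.* m) ℕ.^ d)) ×
    (norm p (A ⊖ U ⊗ V) ≤ fromℕ (suc k) * opt k p A) ×
    IsEnumerationOutput p A U V ×
    (∀ (U₁ : Matrix ℝ n k) (V₁ : Matrix ℝ k m) →
       IsEnumerationOutput p A U₁ V₁ →
       norm p (A ⊖ U₁ ⊗ V₁) ≤ fromℕ (suc k) * opt k p A)
theorem4 em 𝓡 p 1≤p solver = coefficient enumerationTime , degree enumerationTime ,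
  λ n k m 1≤k k≤m m≤n A →
    let 1≤m    = ℕ.≤-trans 1≤k k≤m
        1≤n    = ℕ.≤-trans 1≤m m≤n
        n≤nm   = ℕ.m≤m*n n m {{ℕ.>-nonZero 1≤m}}
        m≤nm   = ℕ.≤-trans m≤n n≤nm
        output = enumeration-output properties k≤m A
    in ℕ.≤-trans (time-enumeration 1≤n 1≤k 1≤m A) (ℕ.*-monoʳ-≤ (m ℕ.^ k)
         (eval≤monomial n k m (n ℕ.* m) n≤nm (ℕ.≤-trans k≤m m≤nm) m≤nm (ℕ.≤-trans 1≤n n≤nm) enumerationTime)) ,
       approximation properties solver k≤m A output ,
       output ,
       λ U₁ V₁ → approximation properties solver k≤m A
  where
  open Norms em 𝓡
  open Approximation em 𝓡
  open Programs em 𝓡 solver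
  open RunningTime em 𝓡 solver
  properties = normProperties p 1≤p
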